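{- Let $G$ be a simple plane graph, let $J$ be its line graph, and let $k:=\max\{10,\Delta(G)+1\}$. If $L$ is a $k$-assignment for $J$, then $J$ is $L$-swappable.
   Context: A list assignment $L$ for a graph assigns to each vertex $v$ a set $L(v)$ of colors; it is a $k$-assignment if $|L(v)|=k$ for all $v$. An $L$-coloring is a proper coloring $\varphi$ with $\varphi(v)\in L(v)$ for all $v$. An $\alpha,\beta$-Kempe swap interchanges colors $\alpha,\beta$ on one connected component of the subgraph induced by vertices colored $\alpha$ or $\beta$; it is $L$-valid for $\varphi$ if the result is again an $L$-coloring. A graph is $L$-swappable if every two of its $L$-colorings can be transformed into each other by a sequence of $L$-valid Kempe swaps. A plane graph is a planar graph with a fixed planar embedding. The line graph has vertex set $E(G)$, two edges adjacent iff they share an endpoint. -}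

module Defs where

open import Data.Nat using (ℕ; zero; suc; _+_; _*_; _≤ᵇ_; _⊔_)
open import Data.Bool using (Bool; true; false; _∧_; _∨_; not; if_then_else_)
open import Data.Fin using (Fin; toℕ; _≟_)
open import Data.List using (List; foldr; map; allFin; length)
open import Data.Bool.ListAction using (all; any)
open import Data.List.Membership.Propositional using (_∈_)
open import Data.List.Relation.Unary.Unique.Propositional using (Unique)
open import Data.Product using (Σ; ∃; _×_; _,_; proj₁; proj₂)
open import Data.Sum using (_⊎_)
open import Function.Bundles using (_↔_; Inverse)
open import Relation.Nullary using (¬_)
open import Relation.Nullary.Decidable using (⌊_⌋)
open import Relation.Binary.PropositionalEquality using (_≡_; _≢_)
open import Relation.Binary.Construct.Closure.ReflexiveTransitive using (Star)
import Data.Nat as ℕ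

iter : {A : Set} → ℕ → (A → A) → A → A
iter zero    f x = x
iter (suc k) f x = f (iter k f x)

countB : {n : ℕ} → (Fin n → Bool) → ℕ
countB {n} p = foldr (λ i acc → (if p i then 1 else 0) + acc) 0 (allFin n)

record SimpleGraph (n m : ℕ) : Set where
  field
    ends    : Fin m → Fin n × Fin n
    noLoop  : ∀ e → proj₁ (ends e) ≢ proj₂ (ends e)
    noMulti : ∀ e f →
      (proj₁ (ends e) ≡ proj₁ (ends f) × proj₂ (ends e) ≡ proj₂ (ends f)) ⊎
      (proj₁ (ends e) ≡ proj₂ (ends f) × proj₂ (ends e) ≡ proj₁ (ends f)) →
      e ≡ f

module _ {n m : ℕ} (G : SimpleGraph n m) where
  open SimpleGraph G

  incidentB : Fin m → Fin n → Bool
  incidentB e v = ⌊ proj₁ (ends e) ≟ v ⌋ ∨ ⌊ proj₂ (ends e) ≟ v ⌋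

  degree : Fin n → ℕ
  degree v = countB (λ e → incidentB e v)

  maxDegree : ℕ
  maxDegree = foldr _⊔_ 0 (map degree (allFin n))

  reach : ℕ → Fin n → Fin n → Bool
  reach zero    u v = ⌊ u ≟ v ⌋
  reach (suc k) u v = reach k u v ∨
    any (λ e → (reach k u (proj₁ (ends e)) ∧ ⌊ proj₂ (ends e) ≟ v ⌋) ∨
               (reach k u (proj₂ (ends e)) ∧ ⌊ proj₁ (ends e) ≟ v ⌋))
        (allFin m)

  -- number of connected components (count the least vertex of each)
  components : ℕ
  components = countB (λ v → all (λ u → not (reach n v u) ∨ (toℕ v ≤ᵇ toℕ u)) (allFin n))

  isolated : ℕ
  isolated = countB (λ v → not (any (λ e → incidentB e v) (allFin m)))

  Dart : Set
  Dart = Fin m × Bool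

  tail : Dart → Fin n
  tail (e , false) = proj₁ (ends e)
  tail (e , true)  = proj₂ (ends e)

  flipD : Dart → Dart
  flipD (e , b) = (e , not b)

  dcode : Dart → ℕ
  dcode (e , b) = toℕ e * 2 + (if b then 1 else 0)

  record RotationSystem : Set where
    field
      σ          : Dart ↔ Dart
      σ-tail     : ∀ d → tail (Inverse.to σ d) ≡ tail d
      σ-cyclic   : ∀ d d′ → tail d ≡ tail d′ → ∃ λ k → iter k (Inverse.to σ) d ≡ d′

    φ : Dart → Dart
    φ d = Inverse.to σ (flipD d)

    -- number of faces = number of φ-orbits (count the least dart of each orbit)
    faces : ℕ
    faces = foldr (λ d acc → (if isMin d then 1 else 0) + acc) 0
              (Data.List.concatMap (λ e → (e , false) Data.List.∷ (e , true) Data.List.∷ Data.List.[]) (allFin m))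
      where
      isMin : Dart → Bool
      isMin d = all (λ k → dcode d ≤ᵇ dcode (iter k φ d)) (Data.List.upTo (m + m))

  -- Genus zero on every component: generalized Euler formula
  -- n - m + f = 2c - i  (isolated vertices carry no darts/faces),
  -- i.e. each component with an edge satisfies V - E + F = 2.
  IsPlanarEmbedding : RotationSystem → Set
  IsPlanarEmbedding ρ = n + RotationSystem.faces ρ + isolated ≡ m + 2 * components

  record PlaneEmbedding : Set where
    field
      rotation : RotationSystem
      planar   : IsPlanarEmbedding rotation

  LineAdj : Fin m → Fin m → Set
  LineAdj e f = e ≢ f × (∃ λ v → (proj₁ (ends e) ≡ v ⊎ proj₂ (ends e) ≡ v) ×
                                 (proj₁ (ends f) ≡ v ⊎ proj₂ (ends f) ≡ v))

module _ {N : ℕ} (Adj : Fin N → Fin N → Set) where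

  ListAssignment : Set
  ListAssignment = Fin N → List ℕ

  IsKAssignment : ℕ → ListAssignment → Set
  IsKAssignment k L = ∀ v → Unique (L v) × length (L v) ≡ k

  Coloring : Set
  Coloring = Fin N → ℕ

  IsLColoring : ListAssignment → Coloring → Set
  IsLColoring L c = (∀ v → c v ∈ L v) × (∀ u v → Adj u v → c u ≢ c v)

  swapCol : ℕ → ℕ → ℕ → ℕ
  swapCol α β x = if x ℕ.≡ᵇ α then β else (if x ℕ.≡ᵇ β then α else x)

  data KComp (c : Coloring) (α β : ℕ) (u : Fin N) : Fin N → Set where
    here : (c u ≡ α ⊎ c u ≡ β) → KComp c α β u u
    step : ∀ {v w} → KComp c α β u v → Adj v w → (c w ≡ α ⊎ c w ≡ β) →
           KComp c α β u w

  KempeSwap : Coloring → Coloring → Set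
  KempeSwap c d = Σ ℕ λ α → Σ ℕ λ β → Σ (Fin N) λ u →
    (c u ≡ α ⊎ c u ≡ β) ×
    (∀ v → (KComp c α β u v → d v ≡ swapCol α β (c v)) ×
           (¬ KComp c α β u v → d v ≡ c v))

  LValidSwap : ListAssignment → Coloring → Coloring → Set
  LValidSwap L c d = KempeSwap c d × IsLColoring L d

  LSwappable : ListAssignment → Set
  LSwappable L = ∀ c d → IsLColoring L c → IsLColoring L d →
    ∃ λ d′ → Star (LValidSwap L) c d′ × (∀ v → d′ v ≡ d v)

{-# OPTIONS --safe #-}
-- A step between colourings changes, on some set of edges, the colour α to β and back; it is a product of
-- Kempe swaps because the set is a union of α,β-components. If an edge always has a free colour, steps
-- of the rest lift to it, so an edge with fewer than k neighbours may be deleted. In a graph without such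
-- edges every 3-vertex has only neighbours of degree k - 1, and all edges at 3-vertices have k neighbours.
--
-- Let H be an even cycle of such edges. For each colouring outside H the lists left on H have size at least 2,
-- and any colouring is equivalent to one that follows a given step outside: either the colours of H are
-- connected, or L(v_i) = {a_i, a_(i-1)} for the colouring a, and then a run of α,β on H touches the outside only at
-- its first vertex. It remains to find one outside colouring over which everything is connected. If f and d
-- are adjacent in a connected set of such edges around H and f has more neighbours there than d, then f can be given a
-- colour not available at d, after which the set is coloured greedily ending in d. Such a set exists as soon as
-- the bipartite graph of edges at 3-vertices has a component with two independent cycles, other than K₂₃.
-- Otherwise 3 n₃ ≤ 2 w, where n₃ is the number of 3-vertices and w that of their neighbours, and discharging with
-- charges d - 6 and 2ℓ - 6 contradicts Euler's formula. Euler's inequality passes to subgraphs by detaching one dart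
-- at a time, which changes the face permutation by a transposition.

module Submission where

open import Defs
open import Data.Nat using (ℕ; zero; suc; _+_; _*_; _∸_; _≤_; _<_; z≤n; s≤s; _≤?_; _<?_; _⊔_)
import Data.Nat as ℕ
open import Data.Nat.DivMod using (_/_; _%_; m≡m%n+[m/n]*n; m%n<n)
open import Data.Nat.Properties
open import Data.Nat.Solver using (module +-*-Solver)
open +-*-Solver using (solve; _:+_; _:*_; _:=_; con)
open import Data.Bool using (Bool; true; false; not; T; _∧_; _∨_; if_then_else_)
open import Data.Bool.ListAction using (all; any)
import Data.Bool.Properties as BP
open import Data.Bool.Properties using (T?; T-∧; T-∨)
open import Data.Empty using (⊥; ⊥-elim)
open import Data.Fin using (Fin; toℕ)
import Data.Fin as F
import Data.Fin.Properties as FP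
open import Data.List using (List; []; _∷_; _++_; length; map; filter; foldr; concatMap; upTo; applyUpTo; allFin; cartesianProduct)
open import Data.List.Properties using (length-map; length-++; length-tabulate; length-applyUpTo; filter-accept; filter-reject)
open import Data.List.Membership.Propositional using (_∈_; _∉_)
open import Data.List.Membership.Propositional.Properties using (∈-∃++; ∈-++⁻; ∈-++⁺ˡ; ∈-++⁺ʳ; ∈-map⁺; ∈-map⁻; ∈-filter⁺; ∈-filter⁻; ∈-allFin; ∈-cartesianProduct⁺; ∈-upTo⁺; ∈-applyUpTo⁺; ∈-applyUpTo⁻)
open import Data.List.Relation.Unary.All as All using ([]; _∷_)
open import Data.List.Relation.Unary.All.Properties using (all⁺; all⁻)
open import Data.List.Relation.Unary.AllPairs using ([]; _∷_)
open import Data.List.Relation.Unary.Any using (Any; here; there; any?)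
open import Data.List.Relation.Unary.Any.Properties using (any⁺; any⁻)
open import Data.List.Relation.Unary.Unique.Propositional using (Unique)
import Data.List.Relation.Unary.Unique.Propositional.Properties as Uniq
open import Data.Product using (∃; _×_; _,_; proj₁; proj₂)
open import Data.Product.Properties using (≡-dec)
open import Data.Sum using (_⊎_; inj₁; inj₂; [_,_]′)
open import Function using (id; case_of_)
open import Function.Bundles using (Inverse; Equivalence)
open import Relation.Binary using (DecidableEquality)
open import Relation.Binary.Construct.Closure.ReflexiveTransitive using (Star; ε; _◅_; _◅◅_)
open import Relation.Binary.Definitions using (tri<; tri≈; tri>)
open import Relation.Binary.PropositionalEquality using (_≡_; _≢_; refl; sym; trans; cong; cong₂; subst; subst₂)
open import Relation.Nullary using (¬_; Dec; yes; no)
open import Relation.Nullary.Decidable using (⌊_⌋; toWitness; fromWitness; _×-dec_; _⊎-dec_; ¬?)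

-- Greedy lifting needs more colours than neighbours; the edges at 3-vertices of the reduced graph
-- have exactly as many, and this tie is the difficulty. The constants come from that graph: each
-- edge has at least k neighbours, so the degrees of its ends sum to at least k + 2. As k > Δ, no
-- degree is below 3; as k ≥ 10, the sum is at least 12, so vertices of degree at most 5 are
-- pairwise non-adjacent, and the discharging balances.
--
-- A cycle with lists of size 2 can be frozen: it then has at most two colourings, one being the
-- other moved by a place, with possibly no steps between them. So the cycle is only asked to follow
-- the outside, and its colours are connected at one outside colouring where more edges are
-- released. The release starts from an imbalance between adjacent edges f and d. The line graphs of
-- a cycle and of K₂₃ are regular and offer none; hence the two independent cycles and the
-- exception. K₂₃ has 6 edges on 5 vertices, so without a configuration 5 · 3 n₃ ≤ 6 (n₃ + w), which
-- is 3 n₃ ≤ 2 w.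

private
  variable
    X : Set

-- Finite lists and pigeonhole arguments

∷-∉ : {x : X} {xs : List X} → Unique (x ∷ xs) → x ∉ xs
∷-∉ (px ∷ _) x∈xs = All.lookup px x∈xs refl

∷-unique : {x : X} {xs : List X} → x ∉ xs → Unique xs → Unique (x ∷ xs)
∷-unique {x = x} x∉xs u = All.tabulate (λ y∈xs x≡y → x∉xs (subst (_∈ _) (sym x≡y) y∈xs)) ∷ u

unique-tail : {x : X} {xs : List X} → Unique (x ∷ xs) → Unique xs
unique-tail (_ ∷ u) = u

remove : (x : X) (ys : List X) → x ∈ ys →
  ∃ λ zs → length ys ≡ suc (length zs) × (∀ {y} → y ∈ ys → y ≢ x → y ∈ zs)
remove x ys x∈ys with ∈-∃++ x∈ys
... | as , bs , refl = as ++ bs , len , keep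
  where
  len : length (as ++ x ∷ bs) ≡ suc (length (as ++ bs))
  len = trans (length-++ as) (trans (+-suc (length as) (length bs)) (cong suc (sym (length-++ as))))
  keep : ∀ {y} → y ∈ as ++ x ∷ bs → y ≢ x → y ∈ as ++ bs
  keep y∈ y≢x with ∈-++⁻ as y∈
  ... | inj₁ p = ∈-++⁺ˡ p
  ... | inj₂ (here q) = ⊥-elim (y≢x q)
  ... | inj₂ (there p) = ∈-++⁺ʳ as p

length-⊆ : {xs ys : List X} → Unique xs → (∀ {x} → x ∈ xs → x ∈ ys) → length xs ≤ length ys
length-⊆ {xs = []} u sub = z≤n
length-⊆ {xs = x ∷ xs} {ys} u sub with remove x ys (sub (here refl))
... | zs , len , keep rewrite len = s≤s (length-⊆ (unique-tail u) sub′)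
  where
  sub′ : ∀ {y} → y ∈ xs → y ∈ zs
  sub′ y∈ = keep (sub (there y∈)) (λ { refl → ∷-∉ u y∈ })

length-⊂ : {xs ys : List X} → Unique xs → (∀ {x} → x ∈ xs → x ∈ ys) →
  {y : X} → y ∈ ys → y ∉ xs → length xs < length ys
length-⊂ u sub y∈ y∉ = length-⊆ (∷-unique y∉ u) λ { (here refl) → y∈ ; (there p) → sub p }

fresh : {xs ys : List ℕ} → Unique xs → length ys < length xs → ∃ λ x → x ∈ xs × x ∉ ys
fresh {xs} {ys} u lt with any? (λ x → ¬? (any? (x ℕ.≟_) ys)) xs
... | yes p = find p
  where
  find : ∀ {zs} → Any (λ x → ¬ Any (x ≡_) ys) zs → ∃ λ x → x ∈ zs × x ∉ ys
  find (here q) = _ , here refl , q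
  find (there q) with find q
  ... | x , x∈ , x∉ = x , there x∈ , x∉
... | no none = ⊥-elim (<⇒≱ lt (length-⊆ u sub))
  where
  mem : ∀ {zs : List ℕ} {x} → x ∈ zs → ¬ Any (λ x → ¬ Any (x ≡_) ys) zs → x ∈ ys
  mem {x = x} x∈ none with any? (x ℕ.≟_) ys
  ... | yes q = q
  ... | no q = ⊥-elim (none (inj x∈))
    where
    inj : ∀ {zs} → x ∈ zs → Any (λ x → ¬ Any (x ≡_) ys) zs
    inj (here refl) = here q
    inj (there r) = there (inj r)
  sub : ∀ {x} → x ∈ xs → x ∈ ys
  sub x∈ = mem x∈ none

two-only : {xs : List ℕ} → length xs ≤ 2 → {p q r : ℕ} →
  p ∈ xs → q ∈ xs → p ≢ q → r ∈ xs → r ≡ p ⊎ r ≡ q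
two-only {xs} len {p} {q} {r} p∈ q∈ p≢q r∈ with r ℕ.≟ p | r ℕ.≟ q
... | yes e | _ = inj₁ e
... | no _ | yes e = inj₂ e
... | no r≢p | no r≢q = ⊥-elim (1+n≰n (≤-trans three len))
  where
  three : 3 ≤ length xs
  three = length-⊆ {xs = r ∷ p ∷ q ∷ []}
    ((r≢p ∷ r≢q ∷ []) ∷ (p≢q ∷ []) ∷ [] ∷ [])
    λ { (here refl) → r∈ ; (there (here refl)) → p∈ ; (there (there (here refl))) → q∈ }


-- Two-colour moves and their extension to a further vertex

Both : ℕ → ℕ → ℕ → Set
Both α β x = x ≡ α ⊎ x ≡ β

both? : ∀ α β x → Dec (Both α β x)
both? α β x = (x ℕ.≟ α) ⊎-dec (x ℕ.≟ β)

Move : ℕ → ℕ → ℕ → ℕ → Set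
Move α β x y = x ≡ y ⊎ (Both α β x × Both α β y)

move-sym : ∀ {α β x y} → Move α β x y → Move α β y x
move-sym (inj₁ e) = inj₁ (sym e)
move-sym (inj₂ (p , q)) = inj₂ (q , p)

module Coloring {V : Set} (_≟_ : DecidableEquality V) (Adj : V → V → Set)
  (adj? : ∀ u v → Dec (Adj u v)) (adj-sym : ∀ {u v} → Adj u v → Adj v u)
  (irr : ∀ {u} → ¬ Adj u u) where

  Col : (V → List ℕ) → List V → (V → ℕ) → Set
  Col M A c = (∀ {v} → v ∈ A → c v ∈ M v) × (∀ {u v} → u ∈ A → v ∈ A → Adj u v → c u ≢ c v)

  -- A pointwise condition between two proper colourings: properness alone forces whole
  -- α,β-components to change, which `Kempe` recovers at the end. In this form steps restrict to
  -- subsets and glue along disjoint sets without any talk of components.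
  record Step (M : V → List ℕ) (A : List V) (c d : V → ℕ) : Set where
    constructor mkStep
    field
      col₁ : Col M A c
      col₂ : Col M A d
      α β  : ℕ
      move : ∀ {v} → v ∈ A → Move α β (c v) (d v)

  Equiv : (V → List ℕ) → List V → (V → ℕ) → (V → ℕ) → Set
  Equiv M A = Star (Step M A)

  Swappable : (V → List ℕ) → List V → Set
  Swappable M A = ∀ {c d} → Col M A c → Col M A d → Equiv M A c d

  step-sym : ∀ {M A c d} → Step M A c d → Step M A d c
  step-sym (mkStep p q α β m) = mkStep q p α β (λ v∈ → move-sym (m v∈))

  equiv-sym : ∀ {M A c d} → Equiv M A c d → Equiv M A d c
  equiv-sym ε = ε
  equiv-sym (s ◅ ss) = equiv-sym ss ◅◅ (step-sym s ◅ ε)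

  col-agree : ∀ {M A c d} → Col M A c → (∀ {v} → v ∈ A → c v ≡ d v) → Col M A d
  col-agree {M} (mem , prop) eq =
    (λ {v} v∈ → subst (_∈ M v) (eq v∈) (mem v∈)) ,
    λ u∈ v∈ a e → prop u∈ v∈ a (trans (eq u∈) (trans e (sym (eq v∈))))

  -- Colourings are functions on all of V, compared only on A; this trivial step replaces function
  -- extensionality. The two colours 0 are placeholders.
  step-agree : ∀ {M A c d} → Col M A c → (∀ {v} → v ∈ A → c v ≡ d v) → Step M A c d
  step-agree p eq = mkStep p (col-agree p eq) 0 0 (λ v∈ → inj₁ (eq v∈))

  col-sub : ∀ {M A B c} → (∀ {v} → v ∈ B → v ∈ A) → Col M A c → Col M B c
  col-sub sub (mem , prop) = (λ v∈ → mem (sub v∈)) , λ u∈ v∈ → prop (sub u∈) (sub v∈)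

  col-mono : ∀ {M N A c} → (∀ {v x} → v ∈ A → x ∈ M v → x ∈ N v) → Col M A c → Col N A c
  col-mono sub (mem , prop) = (λ v∈ → sub v∈ (mem v∈)) , prop

  equiv-sub : ∀ {M A B c d} → (∀ {v} → v ∈ B → v ∈ A) → Equiv M A c d → Equiv M B c d
  equiv-sub sub ε = ε
  equiv-sub sub (mkStep p q α β m ◅ ss) =
    mkStep (col-sub sub p) (col-sub sub q) α β (λ v∈ → m (sub v∈)) ◅ equiv-sub sub ss

  equiv-mono : ∀ {M N A c d} → (∀ {v x} → v ∈ A → x ∈ M v → x ∈ N v) →
    Equiv M A c d → Equiv N A c d
  equiv-mono sub ε = ε
  equiv-mono sub (mkStep p q α β m ◅ ss) =
    mkStep (col-mono sub p) (col-mono sub q) α β m ◅ equiv-mono sub ss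

  swappable-≈ : ∀ {M A B} → (∀ {v} → v ∈ A → v ∈ B) → (∀ {v} → v ∈ B → v ∈ A) →
    Swappable M A → Swappable M B
  swappable-≈ ab ba sw p q = equiv-sub ba (sw (col-sub ab p) (col-sub ab q))

  upd : V → ℕ → (V → ℕ) → V → ℕ
  upd v x c u with u ≟ v
  ... | yes _ = x
  ... | no _ = c u

  upd-here : ∀ v x c → upd v x c v ≡ x
  upd-here v x c with v ≟ v
  ... | yes _ = refl
  ... | no q = ⊥-elim (q refl)

  upd-there : ∀ {v x c u} → u ≢ v → upd v x c u ≡ c u
  upd-there {v} {u = u} u≢v with u ≟ v
  ... | yes q = ⊥-elim (u≢v q)
  ... | no _ = refl

  Avail : List V → (V → ℕ) → V → ℕ → Set
  Avail A c v x = ∀ {u} → u ∈ A → Adj u v → c u ≢ x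

  Blocks : (V → ℕ) → V → ℕ → V → Set
  Blocks c v x u = Adj u v × c u ≡ x

  blocks? : ∀ c v x u → Dec (Blocks c v x u)
  blocks? c v x u = adj? u v ×-dec (c u ℕ.≟ x)

  find-any : ∀ {P : V → Set} {A} → Any P A → ∃ λ u → u ∈ A × P u
  find-any (here p) = _ , here refl , p
  find-any (there p) with find-any p
  ... | u , u∈ , q = u , there u∈ , q

  any-in : ∀ {P : V → Set} {A u} → u ∈ A → P u → Any P A
  any-in (here refl) p = here p
  any-in (there u∈) p = there (any-in u∈ p)

  avail? : ∀ A c v x → Avail A c v x ⊎ (∃ λ u → u ∈ A × Adj u v × c u ≡ x)
  avail? A c v x with any? (blocks? c v x) A
  ... | yes p = inj₂ (find-any p)
  ... | no p = inj₁ (λ u∈ a e → p (any-in u∈ (a , e)))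

  -- Quantified over the proper colourings instead of bounding a degree, because some later lists
  -- are singletons, and then the forced colours matter as well as the number of neighbours.
  Free : (V → List ℕ) → List V → V → Set
  Free M A v = ∀ {c} → Col M A c → ∃ λ x → x ∈ M v × Avail A c v x


  col-cons : ∀ {M A v c} → Col M A c → c v ∈ M v → Avail A c v (c v) → Col M (v ∷ A) c
  col-cons {M} {A} {v} {c} (mem , prop) cv av = mem′ , prop′
    where
    mem′ : ∀ {u} → u ∈ v ∷ A → c u ∈ M u
    mem′ (here refl) = cv
    mem′ (there u∈) = mem u∈
    prop′ : ∀ {u w} → u ∈ v ∷ A → w ∈ v ∷ A → Adj u w → c u ≢ c w
    prop′ (here refl) (here refl) a = ⊥-elim (irr a)
    prop′ (here refl) (there w∈) a e = av w∈ (adj-sym a) (sym e)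
    prop′ (there u∈) (here refl) a = av u∈ a
    prop′ (there u∈) (there w∈) a = prop u∈ w∈ a

  upd-agree : ∀ {A v x c} → v ∉ A → ∀ {u} → u ∈ A → c u ≡ upd v x c u
  upd-agree v∉ u∈ = sym (upd-there (λ { refl → v∉ u∈ }))

  col-upd : ∀ {M A v x c} → v ∉ A → Col M A c → x ∈ M v → Avail A c v x → Col M (v ∷ A) (upd v x c)
  col-upd {M} {A} {v} {x} {c} v∉ p x∈ av =
    col-cons (col-agree p (upd-agree v∉)) (subst (_∈ M v) (sym (upd-here v x c)) x∈)
      (λ u∈ a e → av u∈ a (trans (upd-agree v∉ u∈) (trans e (upd-here v x c))))

  -- If the colour of v becomes blocked while every new choice was blocked before, both are among the two
  -- swapped colours, so v can move along.
  lift-step : ∀ {M A v c d c′} → v ∉ A → Free M A v → Step M A c d →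
    Col M (v ∷ A) c′ → (∀ {u} → u ∈ A → c′ u ≡ c u) →
    ∃ λ d′ → Col M (v ∷ A) d′ × (∀ {u} → u ∈ A → d′ u ≡ d u) × Equiv M (v ∷ A) c′ d′
  lift-step {M} {A} {v} {c} {d} {c′} v∉ free (mkStep pc pd α β mv) pc′ agr
    with avail? A d v (c′ v) | free pd
  ... | inj₁ av | _ = upd v (c′ v) d , cold , (λ u∈ → sym (upd-agree v∉ u∈)) ,
        mkStep pc′ cold α β move ◅ ε
    where
    cold = col-upd v∉ pd (proj₁ pc′ (here refl)) av
    move : ∀ {u} → u ∈ v ∷ A → Move α β (c′ u) (upd v (c′ v) d u)
    move (here refl) = inj₁ (sym (upd-here v (c′ v) d))
    move {u} (there u∈) rewrite agr u∈ | sym (upd-agree {x = c′ v} {c = d} v∉ u∈) = mv u∈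
  ... | inj₂ (w , w∈ , aw , ew) | q , q∈ , avq with avail? A c v q
  -- The new colour q was available already before the step, so v takes it in advance by a step of
  -- its own with the colours `c′ v` and q.
  ... | inj₁ avc = upd v q d , cold , (λ u∈ → sym (upd-agree v∉ u∈)) ,
        mkStep pc′ cole (c′ v) q move₁ ◅ mkStep cole cold α β move₂ ◅ ε
    where
    cold = col-upd v∉ pd q∈ avq
    cole = col-upd v∉ pc q∈ avc
    move₁ : ∀ {u} → u ∈ v ∷ A → Move (c′ v) q (c′ u) (upd v q c u)
    move₁ (here refl) = inj₂ (inj₁ refl , inj₂ (upd-here v q c))
    move₁ (there u∈) = inj₁ (trans (agr u∈) (upd-agree v∉ u∈))
    move₂ : ∀ {u} → u ∈ v ∷ A → Move α β (upd v q c u) (upd v q d u)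
    move₂ (here refl) = inj₁ (trans (upd-here v q c) (sym (upd-here v q d)))
    move₂ (there u∈) rewrite sym (upd-agree {x = q} {c = c} v∉ u∈) | sym (upd-agree {x = q} {c = d} v∉ u∈) = mv u∈
  ... | inj₂ (z , z∈ , az , ez) = upd v q d , cold , (λ u∈ → sym (upd-agree v∉ u∈)) ,
        mkStep pc′ cold α β move ◅ ε
    where
    cold = col-upd v∉ pd q∈ avq
    lost : Both α β (c′ v)
    lost with mv w∈
    ... | inj₁ e = ⊥-elim (proj₂ pc′ (there w∈) (here refl) aw (trans (agr w∈) (trans e ew)))
    ... | inj₂ (_ , b) = subst (Both α β) ew b
    gained : Both α β q
    gained with mv z∈
    ... | inj₁ e = ⊥-elim (avq z∈ az (trans (sym e) ez))
    ... | inj₂ (b , _) = subst (Both α β) ez b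
    move : ∀ {u} → u ∈ v ∷ A → Move α β (c′ u) (upd v q d u)
    move (here refl) = inj₂ (lost , subst (Both α β) (sym (upd-here v q d)) gained)
    move (there u∈) rewrite agr u∈ | sym (upd-agree {x = q} {c = d} v∉ u∈) = mv u∈

  lift-equiv : ∀ {M A v c d c′} → v ∉ A → Free M A v → Equiv M A c d →
    Col M (v ∷ A) c′ → (∀ {u} → u ∈ A → c′ u ≡ c u) →
    ∃ λ d′ → Col M (v ∷ A) d′ × (∀ {u} → u ∈ A → d′ u ≡ d u) × Equiv M (v ∷ A) c′ d′
  lift-equiv v∉ free ε p agr = _ , p , agr , ε
  lift-equiv v∉ free (s ◅ ss) p agr with lift-step v∉ free s p agr
  ... | d′ , q , agr′ , e with lift-equiv v∉ free ss q agr′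
  ... | d″ , r , agr″ , e′ = d″ , r , agr″ , e ◅◅ e′

  -- After lifting, only v can still differ from the target, and a change at one vertex between two
  -- proper colourings is a single step.
  swappable-∷ : ∀ {M A v} → v ∉ A → Free M A v → Swappable M A → Swappable M (v ∷ A)
  swappable-∷ {M} {A} {v} v∉ free sw {c} {d} pc pd
    with lift-equiv v∉ free (sw (col-sub there pc) (col-sub there pd)) pc (λ _ → refl)
  ... | d′ , q , agr , e = e ◅◅ (mkStep q pd (d′ v) (d v) move ◅ ε)
    where
    move : ∀ {u} → u ∈ v ∷ A → Move (d′ v) (d v) (d′ u) (d u)
    move (here refl) = inj₂ (inj₁ refl , inj₂ refl)
    move (there u∈) = inj₁ (agr u∈)

  -- A greedy colouring order starting from B, with the vertex coloured last at the head.
  data Degenerate (M : V → List ℕ) (B : List V) : List V → Set where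
    base : Degenerate M B B
    add  : ∀ {v A} → v ∉ A → Free M A v → Degenerate M B A → Degenerate M B (v ∷ A)

  degenerate-swappable : ∀ {M B A} → Degenerate M B A → Swappable M B → Swappable M A
  degenerate-swappable base sw = sw
  degenerate-swappable (add v∉ f dg) sw = swappable-∷ v∉ f (degenerate-swappable dg sw)

  degenerate-extend : ∀ {M B A} → Degenerate M B A → ∀ {c} → Col M B c →
    ∃ λ d → Col M A d × (∀ {u} → u ∈ B → d u ≡ c u)
  degenerate-extend base {c} p = c , p , λ _ → refl
  degenerate-extend (add {v} v∉ f dg) p with degenerate-extend dg p
  ... | d , q , agr with f q
  ... | x , x∈ , av = upd v x d , col-upd v∉ q x∈ av ,
    λ u∈ → trans (sym (upd-agree v∉ (base-⊆ dg u∈))) (agr u∈)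
    where
    base-⊆ : ∀ {M B A u} → Degenerate M B A → u ∈ B → u ∈ A
    base-⊆ base u∈ = u∈
    base-⊆ (add _ _ dg) u∈ = there (base-⊆ dg u∈)

-- Parity, bounded search, avoiding one or two colours

even? : ℕ → Bool
even? zero = true
even? (suc n) = not (even? n)

search< : ∀ {P : ℕ → Set} → (∀ i → Dec (P i)) → ∀ n → (∃ λ i → i < n × P i) ⊎ (∀ {i} → i < n → ¬ P i)
search< P? zero = inj₂ λ ()
search< P? (suc n) with P? n | search< P? n
... | yes p | _ = inj₁ (n , ≤-refl , p)
... | no _ | inj₁ (i , lt , p) = inj₁ (i , m≤n⇒m≤1+n lt , p)
... | no q | inj₂ none = inj₂ λ {i} lt → case m≤n⇒m<n∨m≡n (≤-pred lt) of λ
  { (inj₁ lt′) → none lt′ ; (inj₂ refl) → q }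

search∈ : ∀ {X : Set} {P : X → Set} → (∀ x → Dec (P x)) → ∀ xs → (∃ λ x → x ∈ xs × P x) ⊎ (∀ {x} → x ∈ xs → ¬ P x)
search∈ P? [] = inj₂ λ ()
search∈ P? (x ∷ xs) with P? x | search∈ P? xs
... | yes p | _ = inj₁ (x , here refl , p)
... | no _ | inj₁ (y , y∈ , p) = inj₁ (y , there y∈ , p)
... | no q | inj₂ none = inj₂ λ { (here refl) → q ; (there y∈) → none y∈ }

avoid₁ : ∀ {xs : List ℕ} → Unique xs → 2 ≤ length xs → ∀ z → ∃ λ x → x ∈ xs × x ≢ z
avoid₁ u len z with fresh {ys = z ∷ []} u len
... | x , x∈ , x∉ = x , x∈ , λ e → x∉ (here e)

avoid₂ : ∀ {xs : List ℕ} → Unique xs → 3 ≤ length xs → ∀ z w → ∃ λ x → x ∈ xs × x ≢ z × x ≢ w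
avoid₂ u len z w with fresh {ys = z ∷ w ∷ []} u len
... | x , x∈ , x∉ = x , x∈ , (λ e → x∉ (here e)) , (λ e → x∉ (there (here e)))

-- Even cycles with periodic indices

module Cycles {V : Set} (_≟_ : DecidableEquality V) (Adj : V → V → Set)
  (adj? : ∀ u v → Dec (Adj u v)) (adj-sym : ∀ {u v} → Adj u v → Adj v u)
  (irr : ∀ {u} → ¬ Adj u u) where

  open Coloring _≟_ Adj adj? adj-sym irr

  -- A cycle of length suc e, indexed periodically so that rotating it is shifting the index.
  record Cycle (h : ℕ → V) (e : ℕ) : Set where
    field
      e≥3    : 3 ≤ e
      period : ∀ i → h (i + suc e) ≡ h i
      inj    : ∀ i t → 0 < t → t ≤ e → h i ≢ h (i + t)
      link   : ∀ i → Adj (h i) (h (suc i))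
      chord  : ∀ i t → 2 ≤ t → t < e → ¬ Adj (h i) (h (i + t))
      even   : even? (suc e) ≡ true

  module _ {h : ℕ → V} {e : ℕ} (C : Cycle h e) where
    open Cycle C

    shift-cycle : ∀ s → Cycle (λ i → h (s + i)) e
    shift-cycle s = record
      { e≥3 = e≥3
      ; period = λ i → trans (cong h (sym (+-assoc s i (suc e)))) (period (s + i))
      ; inj = λ i t p q eq → inj (s + i) t p q (trans eq (cong h (sym (+-assoc s i t))))
      ; link = λ i → subst (Adj (h (s + i))) (cong h (sym (+-suc s i))) (link (s + i))
      ; chord = λ i t p q a → chord (s + i) t p q (subst (Adj (h (s + i))) (cong h (sym (+-assoc s i t))) a)
      ; even = even
      }

    period* : ∀ k i → h (i + k * suc e) ≡ h i
    period* zero i = cong h (+-identityʳ i)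
    period* (suc k) i = trans (cong h (trans (cong (i +_) (+-comm (suc e) (k * suc e))) (sym (+-assoc i (k * suc e) (suc e)))))
      (trans (period (i + k * suc e)) (period* k i))

    private
      -- As e is -1 modulo the length, index `e * j` lies t places after index `e * (j + t)`.
      back : ∀ j t → h (e * j) ≡ h (e * (j + t) + t)
      back j t = sym (trans (cong h eq) (period* t (e * j)))
        where
        eq : e * (j + t) + t ≡ e * j + t * suc e
        eq = trans (cong (_+ t) (*-distribˡ-+ e j t)) (trans (+-assoc (e * j) (e * t) t)
          (cong (e * j +_) (trans (cong (_+ t) (*-comm e t)) (trans (+-comm (t * e) t) (sym (*-suc t e))))))

    -- Multiplying the index by e ≡ -1 reverses the orientation.
    reverse-cycle : Cycle (λ i → h (e * i)) e
    reverse-cycle = record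
      { e≥3 = e≥3
      ; period = λ i → trans (cong h (*-distribˡ-+ e i (suc e))) (period* e (e * i))
      ; inj = λ i t p q eq → inj (e * (i + t)) t p q (trans (sym eq) (back i t))
      ; link = λ i → subst (λ v → Adj v (h (e * suc i)))
          (sym (trans (back i 1) (cong h (trans (+-comm (e * (i + 1)) 1) (cong suc (cong (e *_) (+-comm i 1)))))))
          (adj-sym (link (e * suc i)))
      ; chord = λ i t p q a → chord (e * (i + t)) t p q
          (adj-sym (subst (λ v → Adj v (h (e * (i + t)))) (back i t) a))
      ; even = even
      }

    -- One j serves all offsets t, so a fact about a place and its successor is carried into the
    -- window at once.
    reduce : ∀ i → ∃ λ j → j ≤ e × (∀ t → h (t + i) ≡ h (t + j))
    reduce i = i % suc e , ≤-pred (m%n<n i (suc e)) , λ t →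
      trans (cong (λ z → h (t + z)) (m≡m%n+[m/n]*n i (suc e)))
        (trans (cong h (sym (+-assoc t (i % suc e) (i / suc e * suc e)))) (period* (i / suc e) (t + i % suc e)))

    -- Undoes a shift by s: adding `s * e` subtracts s modulo the length.
    reindex : ∀ s i → ∃ λ j → ∀ t → h (s + (t + j)) ≡ h (t + i)
    reindex s i = i + s * e , λ t → trans (cong h (eq t)) (period* s (t + i))
      where
      eq : ∀ t → s + (t + (i + s * e)) ≡ t + i + s * suc e
      eq t = trans (cong (s +_) (sym (+-assoc t i (s * e))))
        (trans (sym (+-assoc s (t + i) (s * e))) (trans (cong (_+ s * e) (+-comm s (t + i)))
          (trans (+-assoc (t + i) s (s * e)) (cong (t + i +_) (sym (*-suc s e))))))

    reverse-next : ∀ i → h (e * i) ≡ h (suc (e * suc i))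
    reverse-next i = trans (back i 1) (cong h (trans (+-comm (e * (i + 1)) 1) (cong (λ z → suc (e * z)) (+-comm i 1))))

    reverse-index : ∀ i → ∃ λ j → h (e * j) ≡ h i
    -- Reversal is an involution: `e * e` is 1 modulo `suc e`.
    reverse-index i = e * i , trans (cong h (square e e≥3)) (period* (ℕ.pred e * i) i)
      where
      square : ∀ e → 3 ≤ e → e * (e * i) ≡ i + ℕ.pred e * i * suc e
      square (suc e′) _ = solve 2 (λ x i → (con 1 :+ x) :* ((con 1 :+ x) :* i) := i :+ x :* i :* (con 2 :+ x)) refl e′ i

  record Round (h : ℕ → V) (e : ℕ) (A : List V) : Set where
    field
      cycle : Cycle h e
      on    : ∀ {v} → v ∈ A → ∃ λ i → v ≡ h i
      into  : ∀ i → h i ∈ A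

  module _ {h : ℕ → V} {e : ℕ} {A : List V} (R : Round h e A) where
    open Round R
    open Cycle cycle

    shift-round : ∀ s → Round (λ i → h (s + i)) e A
    shift-round s = record
      { cycle = shift-cycle cycle s
      ; on = λ v∈ → let i , eq = on v∈ ; j , f = reindex cycle s i in j , trans eq (sym (f 0))
      ; into = λ i → into (s + i) }

    reverse-round : Round (λ i → h (e * i)) e A
    reverse-round = record
      { cycle = reverse-cycle cycle
      ; on = λ v∈ → let i , eq = on v∈ ; j , f = reverse-index cycle i in j , trans eq (sym f)
      ; into = λ i → into (e * i) }

    on-window : ∀ {v} → v ∈ A → ∃ λ i → i ≤ e × v ≡ h i
    on-window v∈ = let i , eq = on v∈ ; j , j≤ , f = reduce cycle i in j , j≤ , trans eq (f 0)

    inj-window : ∀ {i j} → i ≤ e → j ≤ e → h i ≡ h j → i ≡ j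
    inj-window {i} {j} i≤ j≤ eq with <-cmp i j
    ... | tri≈ _ p _ = p
    ... | tri< lt _ _ = ⊥-elim (inj i (j ∸ i) (m<n⇒0<n∸m lt) (≤-trans (m∸n≤m j i) j≤)
            (trans eq (cong h (sym (m+[n∸m]≡n (<⇒≤ lt))))))
    ... | tri> _ _ gt = ⊥-elim (inj j (i ∸ j) (m<n⇒0<n∸m gt) (≤-trans (m∸n≤m i j) i≤)
            (trans (sym eq) (cong h (sym (m+[n∸m]≡n (<⇒≤ gt))))))

    close : Adj (h e) (h 0)
    close = subst (Adj (h e)) (period 0) (link e)

    -- `chord` excludes the differences from 2 to e - 1, and a difference of at least e inside the
    -- window leaves only its two ends.
    adj-window : ∀ {i j} → i < j → j ≤ e → Adj (h i) (h j) → j ≡ suc i ⊎ (i ≡ 0 × j ≡ e)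
    adj-window {i} {j} lt j≤ a with m≤n⇒m<n∨m≡n lt
    ... | inj₂ eq = inj₁ (sym eq)
    ... | inj₁ lt₂ with j ∸ i <? e
    ... | yes small = ⊥-elim (chord i (j ∸ i) (m+n≤o⇒m≤o∸n 2 lt₂) small (subst (Adj (h i)) (cong h (sym (m+[n∸m]≡n (<⇒≤ lt)))) a))
    ... | no big = inj₂ (i≡0 , j≡e)
      where
      e+i≤j : e + i ≤ j
      e+i≤j = m≤o∸n⇒m+n≤o e (<⇒≤ lt) (≮⇒≥ big)
      i≡0 : i ≡ 0
      i≡0 = n≤0⇒n≡0 (+-cancelˡ-≤ e i 0 (≤-trans e+i≤j (≤-trans j≤ (≤-reflexive (sym (+-identityʳ e))))))
      j≡e : j ≡ e
      j≡e = ≤-antisym j≤ (≤-trans (m≤m+n e i) e+i≤j)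

    pos : V → ℕ
    pos v with search< (λ i → h i ≟ v) (suc e)
    ... | inj₁ (i , _) = i
    -- A dummy value for vertices off the cycle.
    ... | inj₂ _ = 0

    pos-h : ∀ {i} → i ≤ e → pos (h i) ≡ i
    pos-h {i} i≤ with search< (λ j → h j ≟ h i) (suc e)
    ... | inj₁ (j , j< , eq) = inj-window (≤-pred j<) i≤ eq
    ... | inj₂ none = ⊥-elim (none (s≤s i≤) refl)

    col-seq : ∀ {M} (x : ℕ → ℕ) → (∀ {i} → i ≤ e → x i ∈ M (h i)) →
      (∀ {i} → i < e → x i ≢ x (suc i)) → x e ≢ x 0 → Col M A (λ v → x (pos v))
    col-seq {M} x mem hop last = mem′ , prop
      where
      mem′ : ∀ {v} → v ∈ A → x (pos v) ∈ M v
      mem′ v∈ with on-window v∈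
      ... | i , i≤ , refl rewrite pos-h i≤ = mem i≤
      ordered : ∀ {i j} → i < j → j ≤ e → Adj (h i) (h j) → x i ≢ x j
      ordered lt j≤ a with adj-window lt j≤ a
      ... | inj₁ refl = hop j≤
      ... | inj₂ (refl , refl) = λ eq → last (sym eq)
      prop : ∀ {u v} → u ∈ A → v ∈ A → Adj u v → x (pos u) ≢ x (pos v)
      prop u∈ v∈ a with on-window u∈ | on-window v∈
      ... | i , i≤ , refl | j , j≤ , refl rewrite pos-h i≤ | pos-h j≤ with <-cmp i j
      ... | tri< lt _ _ = ordered lt j≤ a
      ... | tri≈ _ refl _ = ⊥-elim (irr a)
      ... | tri> _ _ gt = λ eq → ordered gt i≤ (adj-sym a) (sym eq)

    seg : ℕ → ℕ → List V
    seg i zero = []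
    seg i (suc n) = h i ∷ seg (suc i) n

    ∈-seg : ∀ i n {v} → v ∈ seg i n → ∃ λ j → i ≤ j × j < i + n × v ≡ h j
    ∈-seg i (suc n) (here refl) = i , ≤-refl , m<m+n i (s≤s z≤n) , refl
    ∈-seg i (suc n) (there v∈) with ∈-seg (suc i) n v∈
    ... | j , p , q , eq = j , <⇒≤ p , ≤-trans q (≤-reflexive (sym (+-suc i n))) , eq

    seg-∈ : ∀ i n {j} → i ≤ j → j < i + n → h j ∈ seg i n
    seg-∈ i zero p q = ⊥-elim (<⇒≱ q (≤-trans (≤-reflexive (+-identityʳ i)) p))
    seg-∈ i (suc n) p q with m≤n⇒m<n∨m≡n p
    ... | inj₂ refl = here refl
    ... | inj₁ lt = there (seg-∈ (suc i) n lt (≤-trans q (≤-reflexive (+-suc i n))))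

    -- Colour the cycle backwards from position e; only position 0 also sees position e.
    module Unroll {N : V → List ℕ}
      (extend : ∀ {i} → i < e → ∀ {x z} → x ∈ N (h (suc i)) → z ∈ N (h e) →
        ∃ λ y → y ∈ N (h i) × y ≢ x × (i ≡ 0 → y ≢ z)) where

      degenerate : ∀ n i → i + n ≡ e → Degenerate N (h e ∷ []) (seg i (suc n))
      degenerate zero i eq rewrite +-identityʳ i | eq = base
      degenerate (suc n) i eq = add fresh-v free (degenerate n (suc i) (trans (sym (+-suc i n)) eq))
        where
        i<e : i < e
        i<e = subst (i <_) eq (m<m+n i (s≤s z≤n))
        bound : ∀ {j} → j < suc i + suc n → j ≤ e
        bound {j} p = ≤-pred (≤-trans p (≤-reflexive (cong suc eq)))
        fresh-v : h i ∉ seg (suc i) (suc n)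
        fresh-v v∈ with ∈-seg (suc i) (suc n) v∈
        ... | j , p , q , e₁ = <-irrefl (inj-window (<⇒≤ i<e) (bound q) e₁) p
        free : Free N (seg (suc i) (suc n)) (h i)
        free {c} (mem , _) with extend i<e (mem (here refl))
            (mem (seg-∈ (suc i) (suc n) i<e (≤-reflexive (cong suc (sym eq)))))
        ... | y , y∈ , y≢x , y≢z = y , y∈ , av
          where
          av : Avail (seg (suc i) (suc n)) c (h i) y
          av u∈ a with ∈-seg (suc i) (suc n) u∈
          ... | j , p , q , refl with adj-window p (bound q) (adj-sym a)
          ... | inj₁ refl = λ eq′ → y≢x (sym eq′)
          ... | inj₂ (refl , refl) = λ eq′ → y≢z refl (sym eq′)

      private
        A→seg : ∀ {v} → v ∈ A → v ∈ seg 0 (suc e)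
        A→seg v∈ with on-window v∈
        ... | i , i≤ , refl = seg-∈ 0 (suc e) z≤n (s≤s i≤)
        seg→A : ∀ {v} → v ∈ seg 0 (suc e) → v ∈ A
        seg→A v∈ with ∈-seg 0 (suc e) v∈
        ... | i , _ , _ , refl = into i

      swappable : Swappable N A
      swappable = swappable-≈ seg→A A→seg (degenerate-swappable (degenerate e 0 refl) single)
        where
        single : Swappable N (h e ∷ [])
        single {c} {d} p q = mkStep p q (c (h e)) (d (h e))
          (λ { (here refl) → inj₂ (inj₁ refl , inj₂ refl) }) ◅ ε

      from-last : ∀ {z} → z ∈ N (h e) → ∃ λ d → Col N A d × d (h e) ≡ z
      from-last {z} z∈ with degenerate-extend (degenerate e 0 refl) {λ _ → z}
          ((λ { (here refl) → z∈ }) , λ { (here refl) (here refl) a → ⊥-elim (irr a) })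
      ... | d , p , agr = d , col-sub A→seg p , agr (here refl)

-- Following an outside step on an even cycle

module CycleLift {V : Set} (_≟_ : DecidableEquality V) (Adj : V → V → Set)
  (adj? : ∀ u v → Dec (Adj u v)) (adj-sym : ∀ {u v} → Adj u v → Adj v u)
  (irr : ∀ {u} → ¬ Adj u u)
  (A : List V) (M N : V → List ℕ) (α β : ℕ)
  (uM : ∀ {v} → v ∈ A → Unique (M v)) (uN : ∀ {v} → v ∈ A → Unique (N v))
  (M≥2 : ∀ {v} → v ∈ A → 2 ≤ length (M v)) (N≥2 : ∀ {v} → v ∈ A → 2 ≤ length (N v))
  (M→N : ∀ {v x} → v ∈ A → ¬ Both α β x → x ∈ M v → x ∈ N v)
  (N→M : ∀ {v x} → v ∈ A → ¬ Both α β x → x ∈ N v → x ∈ M v) where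

  open Coloring _≟_ Adj adj? adj-sym irr
  open Cycles _≟_ Adj adj? adj-sym irr

  -- M and N stand for the lists that the outside leaves to the cycle before and after a step with α
  -- and β, so they agree on all other colours. A lift lets the cycle take part in that same step.
  Lifts : (V → ℕ) → (V → ℕ) → Set
  Lifts a b = Col N A b × (∀ {v} → v ∈ A → Move α β (a v) (b v))

  move-outside : ∀ {x y} → ¬ Both α β y → Move α β x y → x ≡ y
  move-outside n (inj₁ e) = e
  move-outside n (inj₂ (_ , b)) = ⊥-elim (n b)

  -- A colour of `M v` other than α, β and x also lies in `N v` and serves on both sides. If there
  -- is none, `M v` without x and `N v` without y consist of α and β only, and any choice from them
  -- is an allowed exchange.
  greedy : ∀ {v} → v ∈ A → ∀ {x y} → Move α β x y →
    ∃ λ x′ → ∃ λ y′ → x′ ∈ M v × y′ ∈ N v × Move α β x′ y′ × x′ ≢ x × y′ ≢ y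
  greedy {v} v∈ {x} {y} mv
    with search∈ (λ z → ¬? (both? α β z) ×-dec ¬? (z ℕ.≟ x)) (M v)
  ... | inj₁ (z , z∈ , nb , z≢x) = z , z , z∈ , M→N v∈ nb z∈ , inj₁ refl , z≢x ,
        λ { refl → z≢x (sym (move-outside nb mv)) }
  ... | inj₂ none with avoid₁ (uM v∈) (M≥2 v∈) x | avoid₁ (uN v∈) (N≥2 v∈) y
  ... | p , p∈ , p≢x | q , q∈ , q≢y = p , q , p∈ , q∈ , inj₂ (bp , bq) , p≢x , q≢y
    where
    bp : Both α β p
    bp with both? α β p
    ... | yes b = b
    ... | no n = ⊥-elim (none p∈ (n , p≢x))
    bq : Both α β q
    bq with both? α β q
    ... | yes b = b
    ... | no n = ⊥-elim (none (N→M v∈ n q∈) (n , λ { refl → q≢y (outside n mv) }))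
      where
      outside : ∀ {x y} → ¬ Both α β x → Move α β x y → x ≡ y
      outside n m = sym (move-outside n (move-sym m))

  record Pair (v : V) : Set where
    constructor pair
    field
      fst snd : ℕ
      fst∈ : fst ∈ M v
      snd∈ : snd ∈ N v
      moves : Move α β fst snd
  open Pair

  next : ∀ {u v} → v ∈ A → (p : Pair u) → ∃ λ (q : Pair v) → fst q ≢ fst p × snd q ≢ snd p
  next v∈ p with greedy v∈ (moves p)
  ... | x , y , x∈ , y∈ , m , n₁ , n₂ = pair x y x∈ y∈ m , n₁ , n₂

  from-pairs : ∀ {h e} → Round h e A → (p : ∀ i → Pair (h i)) →
    (∀ {i} → i < e → fst (p i) ≢ fst (p (suc i)) × snd (p i) ≢ snd (p (suc i))) →
    fst (p e) ≢ fst (p 0) × snd (p e) ≢ snd (p 0) →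
    ∃ λ a → ∃ λ b → Col M A a × Lifts a b
  from-pairs {h} {e} R p hop (l₁ , l₂) =
    (λ v → fst (p (pos R v))) , (λ v → snd (p (pos R v))) ,
    col-seq R (λ i → fst (p i)) (λ {i} _ → fst∈ (p i)) (λ lt → proj₁ (hop lt)) l₁ ,
    col-seq R (λ i → snd (p i)) (λ {i} _ → snd∈ (p i)) (λ lt → proj₂ (hop lt)) l₂ ,
    λ {v} _ → moves (p (pos R v))

  Common : V → ℕ → Set
  Common v x = x ∈ M v × ¬ Both α β x

  _∈?_ : (x : ℕ) (xs : List ℕ) → Dec (x ∈ xs)
  x ∈? xs = any? (x ℕ.≟_) xs

  -- A common colour γ of h 0 that is missing at h e lets a greedy walk close up.
  close-up : ∀ {h e} → Round h e A → ∀ {γ} → Common (h 0) γ → γ ∉ M (h e) →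
    ∃ λ a → ∃ λ b → Col M A a × Lifts a b
  close-up {h} {e} R {γ} (γ∈ , nb) γ∉ = from-pairs R p hop last
    where
    open Round R
    p : ∀ i → Pair (h i)
    p zero = pair γ γ γ∈ (M→N (into 0) nb γ∈) (inj₁ refl)
    p (suc i) = proj₁ (next (into (suc i)) (p i))
    hop : ∀ {i} → i < e → fst (p i) ≢ fst (p (suc i)) × snd (p i) ≢ snd (p (suc i))
    hop {i} _ = let n = proj₂ (next (into (suc i)) (p i)) in
      (λ eq → proj₁ n (sym eq)) , (λ eq → proj₂ n (sym eq))
    last : fst (p e) ≢ γ × snd (p e) ≢ γ
    last = (λ eq → γ∉ (subst (_∈ M (h e)) eq (fst∈ (p e)))) ,
      λ eq → γ∉ (N→M (into e) nb (subst (_∈ N (h e)) eq (snd∈ (p e))))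

  -- If a common colour is in some list but not in the preceding one, the greedy walk started there
  -- closes up. Otherwise each common colour passes to all lists around the cycle, and since the
  -- length is even two alternating pairs of colours do.
  liftable : ∀ {h e} → Round h e A → ∃ λ a → ∃ λ b → Col M A a × Lifts a b
  liftable {h} {e} R with search< (λ i → dec i) (suc e)
    where
    dec : ∀ i → Dec (∃ λ γ → Common (h (suc i)) γ × γ ∉ M (h i))
    dec i with search∈ (λ γ → ¬? (both? α β γ) ×-dec ¬? (γ ∈? M (h i))) (M (h (suc i)))
    ... | inj₁ (γ , γ∈ , nb , γ∉) = yes (γ , (γ∈ , nb) , γ∉)
    ... | inj₂ none = no λ { (γ , (γ∈ , nb) , γ∉) → none γ∈ (nb , γ∉) }
  ... | inj₁ (i , _ , γ , (γ∈ , nb) , γ∉) =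
        close-up (shift-round R (suc i)) (subst (γ ∈_) (cong M (cong h (sym (+-identityʳ (suc i))))) γ∈ , nb)
          (subst (γ ∉_) (cong M (sym (trans (cong h (sym (+-suc i e))) (period i)))) γ∉)
    where open Cycle (Round.cycle R)
  ... | inj₂ none = alternate
    where
    open Round R
    open Cycle cycle
    down : ∀ i {γ} → Common (h (suc i)) γ → γ ∈ M (h i)
    down i {γ} (γ∈ , nb) with reduce cycle i
    ... | j , j≤ , f with γ ∈? M (h i)
    ... | yes p = p
    ... | no γ∉ = ⊥-elim (none (s≤s j≤)
          (γ , (subst (γ ∈_) (cong M (f 1)) γ∈ , nb) , subst (γ ∉_) (cong M (f 0)) γ∉))
    down* : ∀ k i {γ} → Common (h (k + i)) γ → γ ∈ M (h i)
    down* zero i (γ∈ , _) = γ∈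
    down* (suc k) i (γ∈ , nb) = down* k i (down (k + i) (γ∈ , nb) , nb)
    everywhere : ∀ {γ} → Common (h 0) γ → ∀ i → γ ∈ M (h i)
    -- `i * e + i` is a multiple of the length, so the place with that index is `h 0`; descending
    -- from it reaches i.
    everywhere {γ} (γ∈ , nb) i = down* (i * e) i (subst (γ ∈_) (cong M (sym eq)) γ∈ , nb)
      where
      eq : h (i * e + i) ≡ h 0
      eq = trans (cong h (trans (+-comm (i * e) i) (sym (*-suc i e)))) (period* cycle i 0)
    finish : (p : ∀ i → Bool → Pair (h i)) →
      (∀ i j → fst (p i true) ≢ fst (p j false) × snd (p i true) ≢ snd (p j false)) →
      ∃ λ a → ∃ λ b → Col M A a × Lifts a b
    finish p apart = from-pairs R (λ i → p i (even? i)) (λ {i} _ → hop i) last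
      where
      flip : ∀ {x y x′ y′ : ℕ} → x ≢ y × x′ ≢ y′ → y ≢ x × y′ ≢ x′
      flip (n , n′) = (λ eq → n (sym eq)) , (λ eq → n′ (sym eq))
      hop : ∀ i → fst (p i (even? i)) ≢ fst (p (suc i) (not (even? i))) × snd (p i (even? i)) ≢ snd (p (suc i) (not (even? i)))
      hop i with even? i
      ... | true = apart i (suc i)
      ... | false = flip (apart (suc i) i)
      last : fst (p e (even? e)) ≢ fst (p 0 true) × snd (p e (even? e)) ≢ snd (p 0 true)
      last with even? e | even
      ... | false | _ = flip (apart 0 e)
      ... | true | ()
    alternate : ∃ λ a → ∃ λ b → Col M A a × Lifts a b
    alternate with search∈ (λ γ → ¬? (both? α β γ)) (M (h 0))
    -- The colour γ occupies the even places; each odd place takes a pair that avoids γ on both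
    -- sides.
    ... | inj₁ (γ , γ∈ , nb) = finish p (λ i j → apart j)
      where
      always : ∀ i → γ ∈ M (h i)
      always = everywhere (γ∈ , nb)
      γγ : ∀ i → Pair (h i)
      γγ i = pair γ γ (always i) (M→N (into i) nb (always i)) (inj₁ refl)
      p : ∀ i → Bool → Pair (h i)
      p i true = γγ i
      p i false = proj₁ (next (into i) (γγ i))
      apart : ∀ j → γ ≢ fst (p j false) × γ ≢ snd (p j false)
      apart j = let n = proj₂ (next (into j) (γγ j)) in
        (λ eq → proj₁ n (sym eq)) , (λ eq → proj₂ n (sym eq))
    -- No common colour exists, so all lists consist of α and β, and both colourings alternate
    -- between them.
    ... | inj₂ none₀ = finish p apart
      where
      M-both : ∀ i {x} → x ∈ M (h i) → Both α β x
      M-both i {x} x∈ with both? α β x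
      ... | yes b = b
      ... | no nb = ⊥-elim (none₀ (down* i 0 (subst (λ k → x ∈ M (h k)) (sym (+-identityʳ i)) x∈ , nb)) nb)
      N-both : ∀ i {x} → x ∈ N (h i) → Both α β x
      N-both i {x} x∈ with both? α β x
      ... | yes b = b
      ... | no nb = M-both i (N→M (into i) nb x∈)
      full : ∀ {xs : List ℕ} → Unique xs → 2 ≤ length xs → (∀ {x} → x ∈ xs → Both α β x) →
        α ∈ xs × β ∈ xs × α ≢ β
      full u len bo with avoid₁ u len α | avoid₁ u len β
      ... | x , x∈ , x≢α | y , y∈ , y≢β with bo x∈ | bo y∈
      ... | inj₁ eq | _ = ⊥-elim (x≢α eq)
      ... | inj₂ _ | inj₂ eq = ⊥-elim (y≢β eq)
      ... | inj₂ refl | inj₁ refl = y∈ , x∈ , λ eq → x≢α (sym eq)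
      p : ∀ i → Bool → Pair (h i)
      p i true = pair α α (proj₁ (full (uM (into i)) (M≥2 (into i)) (M-both i)))
        (proj₁ (full (uN (into i)) (N≥2 (into i)) (N-both i))) (inj₁ refl)
      p i false = pair β β (proj₁ (proj₂ (full (uM (into i)) (M≥2 (into i)) (M-both i))))
        (proj₁ (proj₂ (full (uN (into i)) (N≥2 (into i)) (N-both i)))) (inj₁ refl)
      α≢β : α ≢ β
      α≢β = proj₂ (proj₂ (full (uM (into 0)) (M≥2 (into 0)) (M-both 0)))
      apart : ∀ i j → α ≢ β × α ≢ β
      apart _ _ = α≢β , α≢β

  Forward : (ℕ → V) → (V → ℕ) → Set
  Forward h a = ∀ i {x} → x ∈ M (h (suc i)) → x ≡ a (h (suc i)) ⊎ x ≡ a (h i)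

  Violation : (ℕ → V) → (V → ℕ) → ℕ → Set
  Violation h a i = ∃ λ d → d ∈ M (h (suc i)) × d ≢ a (h (suc i)) × d ≢ a (h i)

  forward? : ∀ {h e} → Cycle h e → ∀ a → Forward h a ⊎ ∃ (Violation h a)
  forward? {h} {e} C a with search< dec (suc e)
    where
    dec : ∀ i → Dec (Violation h a i)
    dec i with search∈ (λ d → ¬? (d ℕ.≟ a (h (suc i))) ×-dec ¬? (d ℕ.≟ a (h i))) (M (h (suc i)))
    ... | inj₁ v = yes v
    ... | inj₂ none = no λ { (d , d∈ , n) → none d∈ n }
  ... | inj₁ (i , _ , v) = inj₂ (i , v)
  ... | inj₂ none = inj₁ fwd
    where
    fwd : Forward h a
    fwd i {x} x∈ with x ℕ.≟ a (h (suc i)) | x ℕ.≟ a (h i)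
    ... | yes p | _ = inj₁ p
    ... | no _ | yes q = inj₂ q
    ... | no p | no q with reduce C i
    ... | j , j≤ , f = ⊥-elim (none (s≤s j≤) (x , subst (λ v → x ∈ M v) (f 1) x∈ ,
          (λ eq → p (trans eq (cong a (sym (f 1))))) , λ eq → q (trans eq (cong a (sym (f 0))))))

  -- If a uses α and β only, so do the lists N, and a remains valid. Otherwise begin at a vertex
  -- with another colour. Colours outside {α, β} stay; along a run of α, β each vertex takes from N
  -- a colour different from the one just given to its predecessor, and `Forward` makes this again α
  -- or β. The circle closes because the starting colour is neither.
  forward-lift : ∀ {h e} → Round h e A → ∀ {a} → Col M A a → Forward h a → ∃ (Lifts a)
  forward-lift {h} {e} R {a} (mem , prop) fwd with search< (λ i → ¬? (both? α β (a (h i)))) (suc e)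
  ... | inj₂ none = a , (mem′ , prop) , λ _ → inj₁ refl
    where
    open Round R
    open Cycle cycle
    always : ∀ i → Both α β (a (h i))
    always i with reduce cycle i
    ... | j , j≤ , f with both? α β (a (h j))
    ... | yes b = subst (λ v → Both α β (a v)) (sym (f 0)) b
    ... | no n = ⊥-elim (none (s≤s j≤) n)
    N-both : ∀ i {x} → x ∈ N (h (suc i)) → Both α β x
    N-both i {x} x∈ with both? α β x
    ... | yes b = b
    ... | no nb with fwd i (N→M (into (suc i)) nb x∈)
    ... | inj₁ refl = always (suc i)
    ... | inj₂ refl = always i
    mem-suc : ∀ i → a (h (suc i)) ∈ N (h (suc i))
    mem-suc i with avoid₁ (uN (into (suc i))) (N≥2 (into (suc i))) α | avoid₁ (uN (into (suc i))) (N≥2 (into (suc i))) β | always (suc i)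
    ... | x , x∈ , x≢α | y , y∈ , y≢β | b with N-both i x∈ | N-both i y∈ | b
    ... | inj₁ p | _ | _ = ⊥-elim (x≢α p)
    ... | _ | inj₂ p | _ = ⊥-elim (y≢β p)
    ... | inj₂ p | inj₁ q | inj₁ r = subst (_∈ N (h (suc i))) (trans q (sym r)) y∈
    ... | inj₂ p | inj₁ q | inj₂ r = subst (_∈ N (h (suc i))) (trans p (sym r)) x∈
    mem′ : ∀ {v} → v ∈ A → a v ∈ N v
    mem′ v∈ with on v∈
    ... | i , refl with reindex cycle 1 i
    ... | j , f = subst (λ v → a v ∈ N v) (f 0) (mem-suc j)
  ... | inj₁ (s , _ , outside) = (λ v → b (pos R′ v)) ,
        col-seq R′ b (λ {i} _ → mem-b i) (λ {i} _ → b-step i) last , move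
    where
    R′ = shift-round R s
    h′ : ℕ → V
    h′ i = h (s + i)
    open Round R′
    open Cycle cycle
    fwd′ : ∀ i {x} → x ∈ M (h′ (suc i)) → x ≡ a (h′ (suc i)) ⊎ x ≡ a (h′ i)
    fwd′ i {x} x∈ with fwd (s + i) (subst (λ k → x ∈ M (h k)) (+-suc s i) x∈)
    ... | inj₁ p = inj₁ (trans p (cong (λ k → a (h k)) (sym (+-suc s i))))
    ... | inj₂ q = inj₂ q
    Good : ℕ → ℕ → Set
    Good i y = y ∈ N (h′ i) × Move α β (a (h′ i)) y
    outside′ : ¬ Both α β (a (h′ 0))
    outside′ b = outside (subst (λ k → Both α β (a (h k))) (+-identityʳ s) b)
    seq : ∀ i → ∃ (Good i)
    seq-next : ∀ i → ∃ λ y → Good (suc i) y × y ≢ proj₁ (seq i)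
    seq zero = a (h′ 0) , M→N (into 0) outside′ (mem (into 0)) , inj₁ refl
    seq (suc i) = proj₁ (seq-next i) , proj₁ (proj₂ (seq-next i))
    seq-next i with both? α β (a (h′ (suc i)))
    ... | no n = a (h′ (suc i)) , (M→N (into (suc i)) n (mem (into (suc i))) , inj₁ refl) , apart (proj₂ (proj₂ (seq i)))
      where
      apart : Move α β (a (h′ i)) (proj₁ (seq i)) → a (h′ (suc i)) ≢ proj₁ (seq i)
      apart (inj₁ e₁) e₂ = prop (into i) (into (suc i)) (link i) (trans e₁ (sym e₂))
      apart (inj₂ (_ , b)) e₂ = n (subst (Both α β) (sym e₂) b)
    ... | yes bo with avoid₁ (uN (into (suc i))) (N≥2 (into (suc i))) (proj₁ (seq i))
    ... | q , q∈ , q≢ = q , (q∈ , inj₂ (bo , bq)) , q≢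
      where
      bq : Both α β q
      bq with both? α β q
      ... | yes b = b
      -- Were q neither α nor β, it would lie in M too and hence be the predecessor's old colour;
      -- the predecessor would then have kept it, but q differs from the predecessor's new colour.
      ... | no nb with fwd′ i (N→M (into (suc i)) nb q∈)
      ... | inj₁ refl = ⊥-elim (nb bo)
      ... | inj₂ refl with proj₂ (proj₂ (seq i))
      ... | inj₁ e₁ = ⊥-elim (q≢ e₁)
      ... | inj₂ (b , _) = b
    b : ℕ → ℕ
    b i = proj₁ (seq i)
    mem-b : ∀ i → b i ∈ N (h′ i)
    mem-b i = proj₁ (proj₂ (seq i))
    b-step : ∀ i → b i ≢ b (suc i)
    b-step i eq = proj₂ (proj₂ (seq-next i)) (sym eq)
    last : b e ≢ b 0
    last eq with proj₂ (proj₂ (seq e))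
    ... | inj₁ e₁ = prop (into e) (into 0) (close R′) (trans e₁ eq)
    ... | inj₂ (_ , bo) = outside′ (subst (Both α β) eq bo)
    move : ∀ {v} → v ∈ A → Move α β (a v) (b (pos R′ v))
    move v∈ with on-window R′ v∈
    ... | i , i≤ , refl rewrite pos-h R′ i≤ = proj₂ (proj₂ (seq i))

  -- A colour c lost between the neighbouring lists of `h e` and `h 0` opens the cycle: once `h e`
  -- has colour c, a path remains. So it suffices to bring every unfrozen colouring to the colour c
  -- at `h e`.
  module Mismatch {h : ℕ → V} {e : ℕ} (R : Round h e A) (M≤2 : ∀ {v} → v ∈ A → length (M v) ≤ 2)
    {c : ℕ} (c∈ : c ∈ M (h e)) (c∉ : c ∉ M (h 0)) where
    open Round R
    open Cycle cycle

    -- Once h e is coloured c, its neighbour h 0 is unconstrained by it and the rest is a path.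
    fixed-connected : ∀ {a b} → Col M A a → a (h e) ≡ c → Col M A b → b (h e) ≡ c → Equiv M A a b
    fixed-connected {a} {b} pa ea pb eb =
      equiv-mono shrink (Unroll.swappable R extend (narrow pa ea) (narrow pb eb))
      where
      lst : ℕ → V → List ℕ
      lst p v with p ℕ.≟ e
      ... | yes _ = c ∷ []
      ... | no _ = M v
      L : V → List ℕ
      L v = lst (pos R v) v
      L-at : ∀ {i} → i ≤ e → L (h i) ≡ lst i (h i)
      L-at i≤ rewrite pos-h R i≤ = refl
      lst-e : ∀ {v} → lst e v ≡ c ∷ []
      lst-e with e ℕ.≟ e
      ... | yes _ = refl
      ... | no n = ⊥-elim (n refl)
      lst-< : ∀ {i v} → i < e → lst i v ≡ M v
      lst-< {i} lt with i ℕ.≟ e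
      ... | yes refl = ⊥-elim (<-irrefl refl lt)
      ... | no _ = refl
      shrink : ∀ {v x} → v ∈ A → x ∈ L v → x ∈ M v
      shrink {v} {x} v∈ x∈ with on-window R v∈
      ... | i , i≤ , refl with m≤n⇒m<n∨m≡n i≤
      ... | inj₁ lt = subst (x ∈_) (trans (L-at i≤) (lst-< lt)) x∈
      ... | inj₂ refl with subst (x ∈_) (trans (L-at i≤) lst-e) x∈
      ... | here refl = c∈
      narrow : ∀ {a} → Col M A a → a (h e) ≡ c → Col L A a
      narrow {a} (mem , prop) ea = mem′ , prop
        where
        mem′ : ∀ {v} → v ∈ A → a v ∈ L v
        mem′ v∈ with on-window R v∈
        ... | i , i≤ , refl with m≤n⇒m<n∨m≡n i≤
        ... | inj₁ lt = subst (_ ∈_) (sym (trans (L-at i≤) (lst-< lt))) (mem (into i))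
        ... | inj₂ refl = subst (_ ∈_) (sym (trans (L-at i≤) lst-e)) (here ea)
      extend : ∀ {i} → i < e → ∀ {x z} → x ∈ L (h (suc i)) → z ∈ L (h e) →
        ∃ λ y → y ∈ L (h i) × y ≢ x × (i ≡ 0 → y ≢ z)
      extend {i} lt {x} {z} _ z∈ with avoid₁ (uM (into i)) (M≥2 (into i)) x
      ... | y , y∈ , y≢x = y , subst (y ∈_) (sym (trans (L-at (<⇒≤ lt)) (lst-< lt))) y∈ , y≢x , away
        where
        away : i ≡ 0 → y ≢ z
        away refl with subst (z ∈_) (trans (L-at ≤-refl) lst-e) z∈
        ... | here refl = λ { refl → c∉ y∈ }

    -- The violation gives a place q with a spare colour d that differs from the colours of q and of
    -- its predecessor. Fix ψ before q, allow ψ or d at q, everything after q, and ψ or c at `h e`.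
    -- Colouring backwards from c, the forced changes stop at q at the latest, where d absorbs them.
    reaches : ∀ {ψ} → Col M A ψ → ∃ (Violation h ψ) →
      ∃ λ d → Equiv M A ψ d × Col M A d × d (h e) ≡ c
    reaches {ψ} pψ@(mem , prop) (i₀ , d , d∈₀ , d≢₀ , d≢′₀) with ψ (h e) ℕ.≟ c
    ... | yes eq = ψ , ε , pψ , eq
    ... | no ψe≢c = go (position (reduce cycle i₀))
      where
      Spot : ℕ → Set
      -- The predecessor of place 0 is `h e`, so that case has its own clause.
      Spot q = q ≤ e × d ∈ M (h q) × d ≢ ψ (h q) × (q ≡ 0 → d ≢ ψ (h e)) × (∀ {j} → suc j ≡ q → d ≢ ψ (h j))
      position : (∃ λ j → j ≤ e × (∀ t → h (t + i₀) ≡ h (t + j))) → ∃ Spot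
      position (j , j≤ , f) with m≤n⇒m<n∨m≡n j≤
      ... | inj₁ lt = suc j , lt , subst (λ v → d ∈ M v) (f 1) d∈₀ ,
            (λ eq → d≢₀ (trans eq (cong ψ (sym (f 1))))) , (λ ()) ,
            λ { refl eq → d≢′₀ (trans eq (cong ψ (sym (f 0)))) }
      ... | inj₂ refl = 0 , z≤n , subst (λ v → d ∈ M v) (trans (f 1) (period 0)) d∈₀ ,
            (λ eq → d≢₀ (trans eq (cong ψ (sym (trans (f 1) (period 0)))))) ,
            (λ _ eq → d≢′₀ (trans eq (cong ψ (sym (f 0))))) , λ ()
      go : ∃ Spot → ∃ λ d → Equiv M A ψ d × Col M A d × d (h e) ≡ c
      go (q , q≤ , d∈ , d≢ , d≢0 , d≢pred) = proj₁ target ,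
          equiv-mono shrink (Unroll.swappable R extend ψ-col (proj₁ (proj₂ target))) ,
          col-mono shrink (proj₁ (proj₂ target)) , proj₂ (proj₂ target)
        where
        lst : ℕ → V → List ℕ
        lst p v with p ℕ.≟ e | <-cmp p q
        ... | yes _ | _ = ψ v ∷ c ∷ []
        ... | no _ | tri< _ _ _ = ψ v ∷ []
        ... | no _ | tri≈ _ _ _ = ψ v ∷ d ∷ []
        ... | no _ | tri> _ _ _ = M v
        L : V → List ℕ
        L v = lst (pos R v) v
        L-at : ∀ {i} → i ≤ e → L (h i) ≡ lst i (h i)
        L-at i≤ rewrite pos-h R i≤ = refl
        lst-e : ∀ {v} → lst e v ≡ ψ v ∷ c ∷ []
        lst-e with e ℕ.≟ e
        ... | yes _ = refl
        ... | no n = ⊥-elim (n refl)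
        data Kind (i : ℕ) : List ℕ → Set where
          last : i ≡ e → Kind i (ψ (h i) ∷ c ∷ [])
          frozen : i < e → i < q → Kind i (ψ (h i) ∷ [])
          spot : i < e → i ≡ q → Kind i (ψ (h i) ∷ d ∷ [])
          loose : i < e → q < i → Kind i (M (h i))
        kind : ∀ {i} → i ≤ e → Kind i (L (h i))
        kind {i} i≤ rewrite L-at i≤ with i ℕ.≟ e | <-cmp i q
        ... | yes p | _ = last p
        ... | no p | tri< r _ _ = frozen (≤∧≢⇒< i≤ p) r
        ... | no p | tri≈ _ r _ = spot (≤∧≢⇒< i≤ p) r
        ... | no p | tri> _ _ r = loose (≤∧≢⇒< i≤ p) r
        kind-ψ : ∀ {i xs} → Kind i xs → ψ (h i) ∈ xs
        kind-ψ (last _) = here refl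
        kind-ψ (frozen _ _) = here refl
        kind-ψ (spot _ _) = here refl
        kind-ψ (loose _ _) = mem (into _)
        kind-M : ∀ {i xs x} → Kind i xs → x ∈ xs → x ∈ M (h i)
        kind-M (last refl) (here refl) = mem (into _)
        kind-M (last refl) (there (here refl)) = c∈
        kind-M (frozen _ _) (here refl) = mem (into _)
        kind-M (spot _ refl) (here refl) = mem (into _)
        kind-M (spot _ refl) (there (here refl)) = d∈
        kind-M (loose _ _) x∈ = x∈
        shrink : ∀ {v x} → v ∈ A → x ∈ L v → x ∈ M v
        shrink v∈ x∈ with on-window R v∈
        ... | i , i≤ , refl = kind-M (kind i≤) x∈
        ψ-col : Col L A ψ
        ψ-col = mem′ , prop
          where
          mem′ : ∀ {v} → v ∈ A → ψ v ∈ L v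
          mem′ v∈ with on-window R v∈
          ... | i , i≤ , refl = kind-ψ (kind i≤)
        c∈L : c ∈ L (h e)
        c∈L = subst (c ∈_) (sym (trans (L-at ≤-refl) lst-e)) (there (here refl))
        at-e : ∀ {z} → z ∈ L (h e) → z ≡ ψ (h e) ⊎ z ≡ c
        at-e {z} z∈ with subst (z ∈_) (trans (L-at ≤-refl) lst-e) z∈
        ... | here p = inj₁ p
        ... | there (here p) = inj₂ p
        zero-safe : ∀ {y z} → y ∈ M (h 0) → y ≢ ψ (h e) → z ∈ L (h e) → y ≢ z
        zero-safe y∈ n z∈ refl with at-e z∈
        ... | inj₁ p = n p
        ... | inj₂ refl = c∉ y∈
        ψ-link : ∀ i → ψ (h i) ≢ ψ (h (suc i))
        ψ-link i = prop (into i) (into (suc i)) (link i)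
        ψ0 : ∀ {z} → z ∈ L (h e) → ψ (h 0) ≢ z
        ψ0 = zero-safe (mem (into 0)) (λ eq → prop (into e) (into 0) (close R) (sym eq))
        -- If the spare place is `h e` itself, its two-element list leaves only c as second colour.
        d≡c : q ≡ e → d ≡ c
        d≡c refl with two-only (M≤2 (into e)) (mem (into e)) c∈ ψe≢c d∈
        ... | inj₁ p = ⊥-elim (d≢ p)
        ... | inj₂ p = p
        frozen-next : ∀ {i xs x} → i < q → Kind (suc i) xs → x ∈ xs → ψ (h i) ≢ x
        frozen-next lt (last p) (here refl) = ψ-link _
        frozen-next lt (last p) (there (here refl)) eq =
          d≢pred (trans p (sym q≡e)) (trans (d≡c q≡e) (sym eq))
          where
          q≡e : q ≡ e
          q≡e = ≤-antisym q≤ (subst (_≤ q) p lt)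
        frozen-next lt (frozen _ _) (here refl) = ψ-link _
        frozen-next lt (spot _ _) (here refl) = ψ-link _
        frozen-next lt (spot _ p) (there (here refl)) eq = d≢pred p (sym eq)
        frozen-next lt (loose _ r) = ⊥-elim (<⇒≱ r lt)
        extend-kind : ∀ {i xs} → i < e → Kind i xs → ∀ {x z} → x ∈ L (h (suc i)) → z ∈ L (h e) →
          ∃ λ y → y ∈ xs × y ≢ x × (i ≡ 0 → y ≢ z)
        extend-kind lt (last refl) _ _ = ⊥-elim (<-irrefl refl lt)
        extend-kind {i} lt (frozen _ r) x∈ z∈ = ψ (h i) , here refl , frozen-next r (kind lt) x∈ , λ { refl → ψ0 z∈ }
        extend-kind {i} lt (spot _ refl) {x} x∈ z∈ with ψ (h i) ℕ.≟ x
        ... | no n = ψ (h i) , here refl , n , λ { refl → ψ0 z∈ }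
        ... | yes refl = d , there (here refl) , d≢ , λ { refl → zero-safe d∈ (d≢0 refl) z∈ }
        extend-kind {i} lt (loose _ r) {x} x∈ z∈ with avoid₁ (uM (into i)) (M≥2 (into i)) x
        ... | y , y∈ , y≢x = y , y∈ , y≢x , λ { refl → ⊥-elim (n≮0 r) }
        extend : ∀ {i} → i < e → ∀ {x z} → x ∈ L (h (suc i)) → z ∈ L (h e) →
          ∃ λ y → y ∈ L (h i) × y ≢ x × (i ≡ 0 → y ≢ z)
        extend lt = extend-kind lt (kind (<⇒≤ lt))
        target : ∃ λ d → Col L A d × d (h e) ≡ c
        target = Unroll.from-last R extend c∈L

    connected : ∀ {a b} → Col M A a → ∃ (Violation h a) → Col M A b → ∃ (Violation h b) → Equiv M A a b
    connected pa va pb vb with reaches pa va | reaches pb vb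
    ... | a′ , ea , pa′ , ca | b′ , eb , pb′ , cb = ea ◅◅ (fixed-connected pa′ ca pb′ cb ◅◅ equiv-sym eb)

  -- In the backward order only `h 0` sees two coloured neighbours, so it suffices to rotate the
  -- list of three colours to that place.
  large-connected : ∀ {h e} → Round h e A → 3 ≤ length (M (h 0)) → Swappable M A
  large-connected {h} {e} R big = Unroll.swappable R extend
    where
    open Round R
    extend : ∀ {i} → i < e → ∀ {x z} → x ∈ M (h (suc i)) → z ∈ M (h e) →
      ∃ λ y → y ∈ M (h i) × y ≢ x × (i ≡ 0 → y ≢ z)
    extend {zero} lt {x} {z} _ _ with avoid₂ (uM (into 0)) big x z
    ... | y , y∈ , n , n′ = y , y∈ , n , λ _ → n′
    extend {suc i} lt {x} _ _ with avoid₁ (uM (into (suc i))) (M≥2 (into (suc i))) x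
    ... | y , y∈ , n = y , y∈ , n , λ ()

  -- Inclusions that run all the way around a cycle are equalities. With the same two colours
  -- everywhere, any two colourings differ by one exchange.
  constant-connected : ∀ {h e} → Round h e A → (∀ {v} → v ∈ A → length (M v) ≤ 2) →
    (∀ i {x} → x ∈ M (h i) → x ∈ M (h (suc i))) → Swappable M A
  constant-connected {h} {e} R M≤2 up {a} {b} pa pb
    with avoid₁ (uM (into 0)) (M≥2 (into 0)) (a (h 0))
    where open Round R
  ... | q , q∈ , q≢ = mkStep pa pb (a (h 0)) q move ◅ ε
    where
    open Round R
    up* : ∀ k i {x} → x ∈ M (h i) → x ∈ M (h (k + i))
    up* zero i x∈ = x∈
    up* (suc k) i x∈ = up (k + i) (up* k i x∈)
    at-0 : ∀ i {x} → x ∈ M (h i) → x ∈ M (h 0)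
    at-0 i {x} x∈ = subst (λ v → x ∈ M v)
      (trans (cong h (trans (+-comm (i * e) i) (sym (*-suc i e)))) (period* cycle i 0)) (up* (i * e) i x∈)
    two : ∀ {v x} → v ∈ A → x ∈ M v → Both (a (h 0)) q x
    two v∈ x∈ with on v∈
    ... | i , refl = two-only (M≤2 (into 0)) (proj₁ pa (into 0)) q∈ (λ eq → q≢ (sym eq)) (at-0 i x∈)
    move : ∀ {v} → v ∈ A → Move (a (h 0)) q (a v) (b v)
    move v∈ = inj₂ (two v∈ (proj₁ pa v∈) , two v∈ (proj₁ pb v∈))

  -- If b is a rotation colouring, the only colourings are b and b moved one place along the cycle.
  rotation-rigid : ∀ {h e} → Round h e A → ∀ {a b} → Col M A a → Forward h b →
    Forward h a ⊎ Forward (λ i → h (e * i)) a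
  rotation-rigid {h} {e} R {a} {b} (mem , prop) fwd with search< (λ i → a (h i) ℕ.≟ b (h i)) (suc e)
  ... | inj₁ (s , _ , eq) = inj₁ λ i x∈ → case fwd i x∈ of λ
        { (inj₁ p) → inj₁ (trans p (sym (same (suc i)))) ; (inj₂ p) → inj₂ (trans p (sym (same i))) }
    where
    open Round R
    open Cycle cycle
    same-from : ∀ k → a (h (k + s)) ≡ b (h (k + s))
    same-from zero = eq
    same-from (suc k) with fwd (k + s) (mem (into (suc (k + s))))
    ... | inj₁ p = p
    ... | inj₂ p = ⊥-elim (prop (into (k + s)) (into (suc (k + s))) (link (k + s)) (trans (same-from k) (sym p)))
    same : ∀ i → a (h i) ≡ b (h i)
    same i with reindex cycle s i
    ... | j , f = subst (λ v → a v ≡ b v) (trans (cong h (+-comm j s)) (f 0)) (same-from j)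
  ... | inj₂ none = inj₂ back
    where
    open Round R
    open Cycle cycle
    shifted : ∀ i → a (h (suc i)) ≡ b (h i)
    shifted i with fwd i (mem (into (suc i)))
    ... | inj₂ p = p
    ... | inj₁ p with reduce cycle (suc i)
    ... | j , j≤ , f = ⊥-elim (none (s≤s j≤) (subst (λ v → a v ≡ b v) (f 0) p))
    back′ : ∀ i {x} → x ∈ M (h i) → x ≡ a (h i) ⊎ x ≡ a (h (suc i))
    back′ i {x} x∈ with reindex cycle 1 i
    ... | j , f with fwd j (subst (λ v → x ∈ M v) (sym (f 0)) x∈)
    ... | inj₁ p = inj₂ (trans p (trans (cong b (f 0)) (sym (shifted i))))
    ... | inj₂ p = inj₁ (trans p (trans (sym (shifted j)) (cong a (f 0))))
    back : ∀ i {x} → x ∈ M (h (e * suc i)) → x ≡ a (h (e * suc i)) ⊎ x ≡ a (h (e * i))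
    back i x∈ with back′ (e * suc i) x∈
    ... | inj₁ p = inj₁ p
    ... | inj₂ p = inj₂ (trans p (cong a (sym (reverse-next cycle i))))

  -- A frozen colouring lifts as it stands, in either orientation. Any other one is moved to the a′
  -- of `liftable`: were a′ frozen, `rotation-rigid` would make a frozen. The cases of `connect` are
  -- a list of three colours, two different neighbouring lists, and equal lists.
  cycle-lift : ∀ {h e} → Round h e A → ∀ {a} → Col M A a →
    ∃ λ a′ → ∃ λ b → Equiv M A a a′ × Col M A a′ × Lifts a′ b
  cycle-lift {h} {e} R {a} pa with forward? (Round.cycle R) a
  ... | inj₁ fwd = let b , l = forward-lift R pa fwd in a , b , ε , pa , l
  ... | inj₂ va with forward? (reverse-cycle (Round.cycle R)) a
  ... | inj₁ bwd = let b , l = forward-lift (reverse-round R) pa bwd in a , b , ε , pa , l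
  ... | inj₂ (ib , db , db∈ , db≢ , db≢′) with liftable R
  ... | a′ , b , pa′ , l = a′ , b , connect , pa′ , l
    where
    open Round R
    open Cycle cycle
    va′ : ∃ (Violation h a′)
    va′ with forward? cycle a′
    ... | inj₂ v = v
    ... | inj₁ fwd with rotation-rigid R {b = a′} pa fwd
    ... | inj₁ f = let i , d , d∈ , n , n′ = va in ⊥-elim ([ n , n′ ]′ (f i d∈))
    ... | inj₂ f = ⊥-elim ([ db≢ , db≢′ ]′ (f ib db∈))
    connect : Equiv M A a a′
    connect with search< (λ i → 3 ≤? length (M (h i))) (suc e)
    ... | inj₁ (i , _ , big) = large-connected (shift-round R i)
          (subst (λ k → 3 ≤ length (M (h k))) (sym (+-identityʳ i)) big) pa pa′
    ... | inj₂ small with search< dec (suc e)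
      where
      dec : ∀ i → Dec (∃ λ c → c ∈ M (h i) × c ∉ M (h (suc i)))
      dec i with search∈ (λ c → ¬? (c ∈? M (h (suc i)))) (M (h i))
      ... | inj₁ p = yes p
      ... | inj₂ none = no λ { (c , c∈ , c∉) → none c∈ c∉ }
    ... | inj₁ (i , _ , c , c∈ , c∉) = Mismatch.connected (shift-round R (suc i)) M≤2
          (subst (λ v → c ∈ M v) (sym (trans (cong h (sym (+-suc i e))) (period i))) c∈)
          (subst (λ k → c ∉ M (h k)) (sym (+-identityʳ (suc i))) c∉)
          pa (move-violation {a} va) pa′ (move-violation {a′} va′)
      where
      M≤2 : ∀ {v} → v ∈ A → length (M v) ≤ 2
      M≤2 v∈ with on-window R v∈
      ... | j , j≤ , refl = ≤-pred (≰⇒> (small (s≤s j≤)))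
      move-violation : ∀ {ψ} → ∃ (Violation h ψ) → ∃ (Violation (λ j → h (suc i + j)) ψ)
      move-violation {ψ} (j , d , d∈ , n , n′) with reindex cycle (suc i) j
      ... | k , f = k , d , subst (λ v → d ∈ M v) (sym (f 1)) d∈ ,
            (λ eq → n (trans eq (cong ψ (f 1)))) , λ eq → n′ (trans eq (cong ψ (f 0)))
    ... | inj₂ none = constant-connected R M≤2 up pa pa′
      where
      M≤2 : ∀ {v} → v ∈ A → length (M v) ≤ 2
      M≤2 v∈ with on-window R v∈
      ... | j , j≤ , refl = ≤-pred (≰⇒> (small (s≤s j≤)))
      up : ∀ i {x} → x ∈ M (h i) → x ∈ M (h (suc i))
      up i {x} x∈ with x ∈? M (h (suc i))
      ... | yes p = p
      ... | no n with reduce cycle i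
      ... | j , j≤ , f = ⊥-elim (none (s≤s j≤) (x , subst (λ v → x ∈ M v) (f 0) x∈ ,
            λ x∈′ → n (subst (λ v → x ∈ M v) (sym (f 1)) x∈′)))

-- Removing an even cycle from a larger set

module Reduction {V : Set} (_≟_ : DecidableEquality V) (Adj : V → V → Set)
  (adj? : ∀ u v → Dec (Adj u v)) (adj-sym : ∀ {u v} → Adj u v → Adj v u)
  (irr : ∀ {u} → ¬ Adj u u)
  (L : V → List ℕ) (uL : ∀ v → Unique (L v)) where

  open Coloring _≟_ Adj adj? adj-sym irr
  open Cycles _≟_ Adj adj? adj-sym irr

  _∈ᵥ?_ : (v : V) (A : List V) → Dec (v ∈ A)
  v ∈ᵥ? A = any? (v ≟_) A

  nbrs : List V → V → List V
  nbrs A v = filter (λ u → adj? u v) A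

  ∈-nbrs : ∀ {A v u} → u ∈ A → Adj u v → u ∈ nbrs A v
  ∈-nbrs {v = v} = ∈-filter⁺ (λ u → adj? u v)

  nbrs-∈ : ∀ {A v u} → u ∈ nbrs A v → u ∈ A × Adj u v
  nbrs-∈ {A} {v} = ∈-filter⁻ (λ u → adj? u v) {xs = A}

  blocked? : (B : List V) (y : V → ℕ) (v : V) (x : ℕ) → Dec (Any (Blocks y v x) B)
  blocked? B y v x = any? (blocks? y v x) B

  residual : List V → (V → ℕ) → V → List ℕ
  residual B y v = filter (λ x → ¬? (blocked? B y v x)) (L v)

  residual⁺ : ∀ {B y v x} → x ∈ L v → Avail B y v x → x ∈ residual B y v
  residual⁺ {B} {y} {v} x∈ av = ∈-filter⁺ (λ x → ¬? (blocked? B y v x)) x∈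
    λ p → let u , u∈ , a , e = find-any p in av u∈ a e

  residual⁻ : ∀ {B y v x} → x ∈ residual B y v → x ∈ L v × Avail B y v x
  residual⁻ {B} {y} {v} x∈ with ∈-filter⁻ (λ x → ¬? (blocked? B y v x)) {xs = L v} x∈
  ... | m , n = m , λ u∈ a e → n (any-in u∈ (a , e))

  residual-length : ∀ B y v → length (L v) ≤ length (residual B y v) + length (nbrs B v)
  residual-length B y v = ≤-trans (length-⊆ (uL v) cover)
    (≤-reflexive (trans (length-++ (residual B y v)) (cong (length (residual B y v) +_) (length-map y (nbrs B v)))))
    where
    cover : ∀ {x} → x ∈ L v → x ∈ residual B y v ++ map y (nbrs B v)
    cover {x} x∈ with avail? B y v x
    ... | inj₁ av = ∈-++⁺ˡ (residual⁺ {B} x∈ av)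
    ... | inj₂ (u , u∈ , a , e) = ∈-++⁺ʳ (residual B y v) (subst (_∈ map y (nbrs B v)) e (∈-map⁺ y (∈-nbrs u∈ a)))

  module CycleReduction (H B : List V) (disjoint : ∀ {v} → v ∈ H → v ∉ B)
    (slack : ∀ {v} → v ∈ H → 2 + length (nbrs B v) ≤ length (L v))
    {h : ℕ → V} {e : ℕ} (R : Round h e H) where

    residual≥2 : ∀ y {v} → v ∈ H → 2 ≤ length (residual B y v)
    residual≥2 y {v} v∈ = +-cancelʳ-≤ (length (nbrs B v)) 2 _ (≤-trans (slack v∈) (residual-length B y v))

    uR : ∀ y {v} → v ∈ H → Unique (residual B y v)
    uR y {v} _ = Uniq.filter⁺ (λ x → ¬? (blocked? B y v x)) (uL v)

    glue : (V → ℕ) → (V → ℕ) → V → ℕ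
    glue a y v with v ∈ᵥ? H
    ... | yes _ = a v
    ... | no _ = y v

    glue-H : ∀ {a y v} → v ∈ H → glue a y v ≡ a v
    glue-H {v = v} v∈ with v ∈ᵥ? H
    ... | yes _ = refl
    ... | no n = ⊥-elim (n v∈)

    glue-B : ∀ {a y v} → v ∈ B → glue a y v ≡ y v
    glue-B {v = v} v∈ with v ∈ᵥ? H
    ... | yes p = ⊥-elim (disjoint p v∈)
    ... | no _ = refl

    glue-col : ∀ {a y} → Col (residual B y) H a → Col L B y → Col L (H ++ B) (glue a y)
    glue-col {a} {y} (memH , propH) (memB , propB) = mem , prop
      where
      mem : ∀ {v} → v ∈ H ++ B → glue a y v ∈ L v
      mem v∈ with ∈-++⁻ H v∈
      ... | inj₁ p rewrite glue-H {a} {y} p = proj₁ (residual⁻ {B} (memH p))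
      ... | inj₂ p rewrite glue-B {a} {y} p = memB p
      cross : ∀ {u v} → u ∈ B → v ∈ H → Adj u v → y u ≢ a v
      cross u∈ v∈ = proj₂ (residual⁻ {B} (memH v∈)) u∈
      prop : ∀ {u v} → u ∈ H ++ B → v ∈ H ++ B → Adj u v → glue a y u ≢ glue a y v
      prop u∈ v∈ ad with ∈-++⁻ H u∈ | ∈-++⁻ H v∈
      ... | inj₁ p | inj₁ q rewrite glue-H {a} {y} p | glue-H {a} {y} q = propH p q ad
      ... | inj₁ p | inj₂ q rewrite glue-H {a} {y} p | glue-B {a} {y} q = λ eq → cross q p (adj-sym ad) (sym eq)
      ... | inj₂ p | inj₁ q rewrite glue-B {a} {y} p | glue-H {a} {y} q = cross p q ad
      ... | inj₂ p | inj₂ q rewrite glue-B {a} {y} p | glue-B {a} {y} q = propB p q ad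

    glue-step : ∀ {a b y z α β} → Col (residual B y) H a → Col L B y → Col (residual B z) H b → Col L B z →
      (∀ {v} → v ∈ H → Move α β (a v) (b v)) → (∀ {v} → v ∈ B → Move α β (y v) (z v)) →
      Step L (H ++ B) (glue a y) (glue b z)
    glue-step {a} {b} {y} {z} {α} {β} pa py pb pz mH mB = mkStep (glue-col pa py) (glue-col pb pz) α β move
      where
      move : ∀ {v} → v ∈ H ++ B → Move α β (glue a y v) (glue b z v)
      move v∈ with ∈-++⁻ H v∈
      ... | inj₁ p rewrite glue-H {a} {y} p | glue-H {b} {z} p = mH p
      ... | inj₂ p rewrite glue-B {a} {y} p | glue-B {b} {z} p = mB p

    glue-equiv : ∀ {a b y} → Col L B y → Equiv (residual B y) H a b → Equiv L (H ++ B) (glue a y) (glue b y)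
    glue-equiv py ε = ε
    glue-equiv py (mkStep p q α β m ◅ ss) = glue-step p py q py m (λ _ → inj₁ refl) ◅ glue-equiv py ss

    col-residual : ∀ {φ y} → Col L (H ++ B) φ → (∀ {v} → v ∈ B → φ v ≡ y v) → Col (residual B y) H φ
    col-residual (mem , prop) agr =
      (λ v∈ → residual⁺ {B} (mem (∈-++⁺ˡ v∈)) (λ u∈ a e → prop (∈-++⁺ʳ H u∈) (∈-++⁺ˡ v∈) a (trans (agr u∈) e))) ,
      λ u∈ v∈ → prop (∈-++⁺ˡ u∈) (∈-++⁺ˡ v∈)

    -- A colour other than α and β is blocked by the outside after the step exactly when it was
    -- before, which is what `CycleLift` asks of the residual lists. The cycle may first rearrange
    -- itself at the fixed outside y, and then shares the step.
    follow-step : ∀ {y z φ} → Step L B y z → Col L (H ++ B) φ → (∀ {v} → v ∈ B → φ v ≡ y v) →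
      ∃ λ ψ → Col L (H ++ B) ψ × (∀ {v} → v ∈ B → ψ v ≡ z v) × Equiv L (H ++ B) φ ψ
    follow-step {y} {z} {φ} (mkStep py pz α β mv) pφ agr
      with CycleLift.cycle-lift _≟_ Adj adj? adj-sym irr H (residual B y) (residual B z) α β
             (uR y) (uR z) (residual≥2 y) (residual≥2 z) (keep mv) (keep (λ v∈ → move-sym (mv v∈)))
             R (col-residual pφ agr)
      where
      keep : ∀ {y z} → (∀ {v} → v ∈ B → Move α β (y v) (z v)) → ∀ {v x} → v ∈ H → ¬ Both α β x →
        x ∈ residual B y v → x ∈ residual B z v
      keep {y} {z} mv {v} {x} _ nb x∈ with residual⁻ {B} x∈
      ... | m , av = residual⁺ {B} m λ u∈ a e → case mv u∈ of λ
        { (inj₁ eq) → av u∈ a (trans eq e) ; (inj₂ (_ , b)) → nb (subst (Both α β) e b) }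
    ... | a′ , b , eq , pa′ , pb , mb = glue b z , glue-col pb pz , glue-B ,
          step-agree pφ start ◅ glue-equiv py eq ◅◅ (glue-step pa′ py pb pz mb mv ◅ ε)
      where
      start : ∀ {v} → v ∈ H ++ B → φ v ≡ glue φ y v
      start v∈ with ∈-++⁻ H v∈
      ... | inj₁ p = sym (glue-H p)
      ... | inj₂ p = trans (agr p) (sym (glue-B p))

    follow : ∀ {y z φ} → Equiv L B y z → Col L (H ++ B) φ → (∀ {v} → v ∈ B → φ v ≡ y v) →
      ∃ λ ψ → Col L (H ++ B) ψ × (∀ {v} → v ∈ B → ψ v ≡ z v) × Equiv L (H ++ B) φ ψ
    follow ε p agr = _ , p , agr , ε
    follow (s ◅ ss) p agr = let ψ , q , agr′ , e₁ = follow-step s p agr ; χ , r , agr″ , e₂ = follow ss q agr′ in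
      χ , r , agr″ , e₁ ◅◅ e₂

    -- Every colouring can be brought to agree with η outside the cycle, and there the sublists M connect everything.
    cycle-swappable : Swappable L B → (M : V → List ℕ) →
      (∀ {v x} → v ∈ H ++ B → x ∈ M v → x ∈ L v) → (∀ {v x} → v ∈ H → x ∈ L v → x ∈ M v) →
      Swappable M (H ++ B) → ∀ {η} → Col M (H ++ B) η → Swappable L (H ++ B)
    cycle-swappable swB M M⊆L L⊆M swM {η} pη {c} {d} pc pd with to-η pc | to-η pd
      where
      to-η : ∀ {φ} → Col L (H ++ B) φ → ∃ λ ψ → Col M (H ++ B) ψ × Equiv L (H ++ B) φ ψ
      to-η pφ with follow (swB (col-sub (∈-++⁺ʳ H) pφ) (col-sub (∈-++⁺ʳ H) (col-mono M⊆L pη))) pφ (λ _ → refl)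
      ... | ψ , (mem , prop) , agr , eq = ψ , (mem′ , prop) , eq
        where
        mem′ : ∀ {v} → v ∈ H ++ B → ψ v ∈ M v
        mem′ {v} v∈ with ∈-++⁻ H v∈
        ... | inj₁ p = L⊆M p (mem v∈)
        ... | inj₂ p = subst (_∈ M v) (sym (agr p)) (proj₁ pη v∈)
    ... | c′ , pc′ , ec | d′ , pd′ , ed = ec ◅◅ (equiv-mono M⊆L (swM pc′ pd′) ◅◅ equiv-sym ed)

  -- Every entry has a neighbour nearer to the start. Colouring from the far end therefore always
  -- leaves an uncoloured neighbour.
  data Ordered (seen : List V) : List V → Set where
    []  : Ordered seen []
    _∷_ : ∀ {d ds} → (∃ λ u → u ∈ seen × Adj u d) → Ordered (d ∷ seen) ds → Ordered seen (d ∷ ds)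

  -- An even cycle, and a connected set f, d, ds around it in which every vertex has at most as many
  -- neighbours as colours and f has more neighbours inside the set than d.
  record Configuration (k : ℕ) (A : List V) : Set where
    field
      f d      : V
      ds       : List V
      f∈       : f ∈ A
      ds⊆      : ∀ {v} → v ∈ d ∷ ds → v ∈ A
      uds      : Unique (f ∷ d ∷ ds)
      bounded   : ∀ {v} → v ∈ f ∷ d ∷ ds → length (nbrs A v) ≤ k
      f~d      : Adj f d
      ordered  : Ordered (d ∷ []) ds
      fs ns    : List V
      ufs      : Unique fs
      fs⊆      : ∀ {v} → v ∈ fs → v ∈ d ∷ ds × Adj v f
      ns⊇      : ∀ {v} → v ∈ f ∷ d ∷ ds → Adj v d → v ∈ ns
      more     : length ns < length fs
      H        : List V
      h        : ℕ → V
      e        : ℕ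
      round    : Round h e H
      H⊆       : ∀ {v} → v ∈ H → v ∈ d ∷ ds

  avail-fresh : ∀ {Rest v c} → length (nbrs Rest v) < length (L v) → ∃ λ x → x ∈ L v × Avail Rest c v x
  avail-fresh {Rest} {v} {c} lt with fresh {ys = map c (nbrs Rest v)} (uL v) (subst (_< length (L v)) (sym (length-map c (nbrs Rest v))) lt)
  ... | x , x∈ , x∉ = x , x∈ , λ u∈ a e → x∉ (subst (_∈ _) e (∈-map⁺ c (∈-nbrs u∈ a)))

  light-swappable : ∀ {A v} → v ∉ A → length (nbrs A v) < length (L v) → Swappable L A → Swappable L (v ∷ A)
  light-swappable v∉ lt = swappable-∷ v∉ (λ _ → avail-fresh lt)

  without : List V → List V → List V
  without H A = filter (λ v → ¬? (v ∈ᵥ? H)) A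

  without⁺ : ∀ {H A v} → v ∈ A → v ∉ H → v ∈ without H A
  without⁺ {H} = ∈-filter⁺ (λ v → ¬? (v ∈ᵥ? H))

  without⁻ : ∀ {H A v} → v ∈ without H A → v ∈ A × v ∉ H
  without⁻ {H} {A} = ∈-filter⁻ (λ v → ¬? (v ∈ᵥ? H)) {xs = A}

  unique-without : ∀ {H A} → Unique A → Unique (without H A)
  unique-without {H} = Uniq.filter⁺ (λ v → ¬? (v ∈ᵥ? H))

  unique-nbrs : ∀ {A v} → Unique A → Unique (nbrs A v)
  unique-nbrs {v = v} = Uniq.filter⁺ (λ u → adj? u v)

  nbrs-mono : ∀ {A B v} → (∀ {u} → u ∈ A → u ∈ B) → ∀ {u} → u ∈ nbrs A v → u ∈ nbrs B v
  nbrs-mono {A} sub u∈ with nbrs-∈ {A} u∈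
  ... | p , a = ∈-nbrs (sub p) a

  module _ {k : ℕ} {A : List V} (uA : Unique A) (k≤ : ∀ v → k ≤ length (L v)) (C : Configuration k A) where
    open Configuration C

    private
      D S B₀ : List V
      D = d ∷ ds
      S = f ∷ D
      B₀ = without S A

      uB₀ : Unique B₀
      uB₀ = unique-without uA

      fB₀⊆ : ∀ {v} → v ∈ f ∷ B₀ → v ∈ A
      fB₀⊆ (here refl) = f∈
      fB₀⊆ (there p) = proj₁ (without⁻ {S} p)

      f∉D : f ∉ D
      f∉D = ∷-∉ uds

      f∉B₀ : f ∉ B₀
      f∉B₀ p = proj₂ (without⁻ {S} {A} p) (here refl)

      D∉B₀ : ∀ {v} → v ∈ D → v ∉ f ∷ B₀
      D∉B₀ v∈ (here refl) = f∉D v∈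
      D∉B₀ v∈ (there p) = proj₂ (without⁻ {S} {A} p) (there v∈)

      fs-many : length fs + length (nbrs B₀ f) ≤ k
      fs-many = ≤-trans (≤-trans (≤-reflexive (sym (length-++ fs))) (length-⊆ u sub)) (bounded (here refl))
        where
        u : Unique (fs ++ nbrs B₀ f)
        u = Uniq.++⁺ ufs (unique-nbrs uB₀) λ (p , q) →
          D∉B₀ (proj₁ (fs⊆ p)) (there (proj₁ (nbrs-∈ {B₀} q)))
        sub : ∀ {v} → v ∈ fs ++ nbrs B₀ f → v ∈ nbrs A f
        sub v∈ with ∈-++⁻ fs v∈
        ... | inj₁ p = let q , a = fs⊆ p in ∈-nbrs (ds⊆ q) a
        ... | inj₂ p = nbrs-mono {B₀} {A} (λ q → proj₁ (without⁻ {S} q)) p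

    module Frozen {φ : V → ℕ} (pφ : Col L A φ) where

      -- A colour for f that leaves d a free one; after that d, ds can be coloured greedily from the far end.
      Slack : ℕ → Set
      Slack p = p ∈ residual B₀ φ f × (p ∉ residual B₀ φ d ⊎ length ns < length (residual B₀ φ d))

      -- At most k - |fs| neighbours of f lie outside the set, so they block at most that many of
      -- its k or more colours.
      many : length fs ≤ length (residual B₀ φ f)
      many = +-cancelʳ-≤ (length (nbrs B₀ f)) _ _ (≤-trans fs-many (≤-trans (k≤ f) (residual-length B₀ φ f)))

      -- If every colour left at f is also left at d, then d has at least |fs| > |ns| of them, more
      -- than it has neighbours inside the set, and any colour will do for f.
      choose : ∃ Slack
      choose with search∈ (λ p → ¬? (any? (p ℕ.≟_) (residual B₀ φ d))) (residual B₀ φ f)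
      ... | inj₁ (p , p∈ , p∉) = p , p∈ , inj₁ p∉
      ... | inj₂ none with fresh {ys = []} uRf (≤-trans (s≤s z≤n) (≤-trans more many))
        where
        uRf : Unique (residual B₀ φ f)
        uRf = Uniq.filter⁺ (λ x → ¬? (blocked? B₀ φ f x)) (uL f)
      ... | p , p∈ , _ = p , p∈ , inj₂ (≤-trans more (≤-trans many (length-⊆ uRf sub)))
        where
        uRf : Unique (residual B₀ φ f)
        uRf = Uniq.filter⁺ (λ x → ¬? (blocked? B₀ φ f x)) (uL f)
        sub : ∀ {x} → x ∈ residual B₀ φ f → x ∈ residual B₀ φ d
        sub {x} x∈ with any? (x ℕ.≟_) (residual B₀ φ d)
        ... | yes q = q
        ... | no q = ⊥-elim (none x∈ q)

      p : ℕ
      p = proj₁ choose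

      -- Singletons freeze f at p and the outside of the set at φ, while D, which contains the
      -- cycle, keeps its full lists as `cycle-swappable` demands.
      M : V → List ℕ
      M v with v ∈ᵥ? D | v ≟ f
      ... | yes _ | _ = L v
      ... | no _ | yes _ = p ∷ []
      ... | no _ | no _ = φ v ∷ []

      M-D : ∀ {v} → v ∈ D → M v ≡ L v
      M-D {v} v∈ with v ∈ᵥ? D | v ≟ f
      ... | yes _ | _ = refl
      ... | no n | _ = ⊥-elim (n v∈)

      M-f : M f ≡ p ∷ []
      M-f with f ∈ᵥ? D | f ≟ f
      ... | yes q | _ = ⊥-elim (f∉D q)
      ... | no _ | yes _ = refl
      ... | no _ | no n = ⊥-elim (n refl)

      M-B₀ : ∀ {v} → v ∈ B₀ → M v ≡ φ v ∷ []
      M-B₀ {v} v∈ with v ∈ᵥ? D | v ≟ f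
      ... | yes q | _ = ⊥-elim (D∉B₀ q (there v∈))
      ... | no _ | yes refl = ⊥-elim (f∉B₀ v∈)
      ... | no _ | no _ = refl

      singleton : ∀ {x y : ℕ} → x ∈ y ∷ [] → x ≡ y
      singleton (here eq) = eq

      single-f : ∀ {x} → x ∈ M f → x ≡ p
      single-f x∈ = singleton (subst (_ ∈_) M-f x∈)

      single-B₀ : ∀ {v x} → v ∈ B₀ → x ∈ M v → x ≡ φ v
      single-B₀ v∈ x∈ = singleton (subst (_ ∈_) (M-B₀ v∈) x∈)

      base-swappable : Swappable M (f ∷ B₀)
      base-swappable pc pd = step-agree pc agree ◅ ε
        where
        agree : ∀ {v} → v ∈ f ∷ B₀ → _
        agree (here refl) = trans (single-f (proj₁ pc (here refl))) (sym (single-f (proj₁ pd (here refl))))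
        agree (there q) = trans (single-B₀ q (proj₁ pc (there q))) (sym (single-B₀ q (proj₁ pd (there q))))

      base-coloring : Col M (f ∷ B₀) (upd f p φ)
      base-coloring = col-upd f∉B₀ (mem , prop) (subst (p ∈_) (sym M-f) (here refl)) (proj₂ (residual⁻ {B₀} (proj₁ (proj₂ choose))))
        where
        mem : ∀ {v} → v ∈ B₀ → φ v ∈ M v
        mem v∈ = subst (_ ∈_) (sym (M-B₀ v∈)) (here refl)
        prop : ∀ {u v} → u ∈ B₀ → v ∈ B₀ → Adj u v → φ u ≢ φ v
        prop u∈ v∈ = proj₂ pφ (fB₀⊆ (there u∈)) (fB₀⊆ (there v∈))

      -- The neighbour w of v that precedes it in the order is still uncoloured, so at most k - 1
      -- colours are blocked at v.
      suffix : ∀ seen es → (∀ {v} → v ∈ seen → v ∈ D × v ∉ es) → (∀ {v} → v ∈ es → v ∈ D) → Unique es →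
        Ordered seen es → Degenerate M (f ∷ B₀) (es ++ f ∷ B₀)
      suffix seen [] _ _ _ _ = base
      suffix seen (v ∷ es) seen⊆ es⊆ u ((w , w∈ , a) ∷ o) =
        add v∉ free (suffix (v ∷ seen) es seen′ (λ q → es⊆ (there q)) (unique-tail u) o)
        where
        seen′ : ∀ {x} → x ∈ v ∷ seen → x ∈ D × x ∉ es
        seen′ (here refl) = es⊆ (here refl) , ∷-∉ u
        seen′ (there q) = let r , n = seen⊆ q in r , λ s → n (there s)
        Rest : List V
        Rest = es ++ f ∷ B₀
        v∉ : v ∉ Rest
        v∉ q with ∈-++⁻ es q
        ... | inj₁ r = ∷-∉ u r
        ... | inj₂ r = D∉B₀ (es⊆ (here refl)) r
        Rest⊆ : ∀ {x} → x ∈ Rest → x ∈ A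
        Rest⊆ q with ∈-++⁻ es q
        ... | inj₁ r = ds⊆ (es⊆ (there r))
        ... | inj₂ r = fB₀⊆ r
        uT : Unique Rest
        uT = Uniq.++⁺ (unique-tail u) (∷-unique f∉B₀ uB₀) λ (q , r) → D∉B₀ (es⊆ (there q)) r
        w∉ : w ∉ nbrs Rest v
        w∉ q with ∈-++⁻ es (proj₁ (nbrs-∈ {Rest} q))
        ... | inj₁ r = proj₂ (seen⊆ w∈) (there r)
        ... | inj₂ r = D∉B₀ (proj₁ (seen⊆ w∈)) r
        few : length (nbrs Rest v) < length (L v)
        few = ≤-trans (length-⊂ (unique-nbrs uT) (nbrs-mono {Rest} {A} Rest⊆) (∈-nbrs (ds⊆ (proj₁ (seen⊆ w∈))) a) w∉)
          (≤-trans (bounded (there (es⊆ (here refl)))) (k≤ v))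
        free : Free M Rest v
        free _ with avail-fresh {Rest} few
        ... | x , x∈ , av = x , subst (x ∈_) (sym (M-D (es⊆ (here refl)))) x∈ , av

      -- All neighbours of d are coloured by now. Either d had more colours left by B₀ than it has
      -- neighbours inside the set; or p is no colour left at d, so f blocks nothing: a colour that
      -- suits the other neighbours, at most k - 1 of them, cannot equal p, as p would then be left
      -- at d after all.
      free-d : Free M (ds ++ f ∷ B₀) d
      free-d {c} (mem , _) with proj₂ (proj₂ choose)
      ... | inj₂ big with fresh {residual B₀ φ d} {map c ns} (Uniq.filter⁺ (λ x → ¬? (blocked? B₀ φ d x)) (uL d))
              (subst (_< _) (sym (length-map c ns)) big)
      ... | x , x∈ , x∉ = x , subst (x ∈_) (sym (M-D (here refl))) (proj₁ (residual⁻ {B₀} x∈)) , av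
        where
        in-ns : ∀ {u} → u ∈ S → Adj u d → c u ≢ x
        in-ns u∈ a eq = x∉ (subst (_∈ map c ns) eq (∈-map⁺ c (ns⊇ u∈ a)))
        av : Avail (ds ++ f ∷ B₀) c d x
        av u∈ a with ∈-++⁻ ds u∈
        ... | inj₁ q = in-ns (there (there q)) a
        ... | inj₂ (here refl) = in-ns (here refl) a
        ... | inj₂ (there q) = λ eq → proj₂ (residual⁻ {B₀} x∈) q a
              (trans (sym (single-B₀ q (mem u∈))) eq)
      free-d {c} (mem , _) | inj₁ p∉ with avail-fresh {ds ++ B₀} {d} {c} few
        where
        Rest : List V
        Rest = ds ++ B₀
        uT : Unique Rest
        uT = Uniq.++⁺ (unique-tail (unique-tail uds)) uB₀ λ (q , r) → D∉B₀ (there q) (there r)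
        Rest⊆ : ∀ {x} → x ∈ Rest → x ∈ A
        Rest⊆ q with ∈-++⁻ ds q
        ... | inj₁ r = ds⊆ (there r)
        ... | inj₂ r = fB₀⊆ (there r)
        f∉ : f ∉ nbrs Rest d
        f∉ q with ∈-++⁻ ds (proj₁ (nbrs-∈ {Rest} q))
        ... | inj₁ r = f∉D (there r)
        ... | inj₂ r = f∉B₀ r
        few : length (nbrs Rest d) < length (L d)
        few = ≤-trans (length-⊂ (unique-nbrs uT) (nbrs-mono {Rest} {A} Rest⊆) (∈-nbrs f∈ f~d) f∉)
          (≤-trans (bounded (there (here refl))) (k≤ d))
      ... | x , x∈ , av₀ = x , subst (x ∈_) (sym (M-D (here refl))) x∈ , av
        where
        av : Avail (ds ++ f ∷ B₀) c d x
        av u∈ a with ∈-++⁻ ds u∈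
        ... | inj₁ q = av₀ (∈-++⁺ˡ q) a
        ... | inj₂ (there q) = av₀ (∈-++⁺ʳ ds q) a
        ... | inj₂ (here refl) = λ eq → p∉ (residual⁺ {B₀} (subst (_∈ L d) (trans (sym eq) cf) x∈)
              λ w∈ a′ eq′ → av₀ (∈-++⁺ʳ ds w∈) a′
                (trans (single-B₀ w∈ (mem (∈-++⁺ʳ ds (there w∈)))) (trans eq′ (trans (sym cf) eq))))
          where
          cf : c f ≡ p
          cf = single-f (mem u∈)

      degenerate : Degenerate M (f ∷ B₀) (D ++ f ∷ B₀)
      degenerate = add d∉ free-d (suffix (d ∷ []) ds seen (λ q → there q) (unique-tail (unique-tail uds)) ordered)
        where
        d∉ : d ∉ ds ++ f ∷ B₀
        d∉ q with ∈-++⁻ ds q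
        ... | inj₁ r = ∷-∉ (unique-tail uds) r
        ... | inj₂ r = D∉B₀ (here refl) r
        seen : ∀ {v} → v ∈ d ∷ [] → v ∈ D × v ∉ ds
        seen (here refl) = here refl , ∷-∉ (unique-tail uds)

      to-A : ∀ {v} → v ∈ D ++ f ∷ B₀ → v ∈ A
      to-A q with ∈-++⁻ D q
      ... | inj₁ r = ds⊆ r
      ... | inj₂ r = fB₀⊆ r

      from-A : ∀ {v} → v ∈ A → v ∈ D ++ f ∷ B₀
      from-A {v} v∈ with v ∈ᵥ? S
      ... | yes (here refl) = ∈-++⁺ʳ D (here refl)
      ... | yes (there q) = ∈-++⁺ˡ q
      ... | no n = ∈-++⁺ʳ D (there (without⁺ v∈ n))

      M-swappable : Swappable M A
      M-swappable = swappable-≈ to-A from-A (degenerate-swappable degenerate base-swappable)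

      M-coloring : ∃ (Col M A)
      M-coloring = let η , q , _ = degenerate-extend degenerate base-coloring in η , col-sub from-A q

      M⊆L : ∀ {v x} → v ∈ A → x ∈ M v → x ∈ L v
      M⊆L {v} v∈ x∈ with ∈-++⁻ D (from-A v∈)
      ... | inj₁ q = subst (_ ∈_) (M-D q) x∈
      ... | inj₂ (here refl) = subst (_∈ L f) (sym (single-f x∈)) (proj₁ (residual⁻ {B₀} (proj₁ (proj₂ choose))))
      ... | inj₂ (there q) = subst (_∈ L v) (sym (single-B₀ q x∈)) (proj₁ pφ v∈)

    -- Freezing the given colouring c outside D yields the sublists, and a greedy extension the
    -- colouring η, that `cycle-swappable` requires. Each cycle vertex has both cycle neighbours
    -- outside B, which gives residual lists of size 2.
    configuration-swappable : Swappable L (without H A) → Swappable L A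
    configuration-swappable sw {c} {d′} pc pd =
      swappable-≈ to from (cycle-swappable sw M (λ v∈ → M⊆L (to v∈)) (λ v∈ x∈ → subst (_ ∈_) (sym (M-D (H⊆ v∈))) x∈)
        (swappable-≈ from to M-swappable) (col-sub to (proj₂ M-coloring))) pc pd
      where
      open Frozen pc
      open Round round
      open Cycle cycle
      B : List V
      B = without H A
      to : ∀ {v} → v ∈ H ++ B → v ∈ A
      to q with ∈-++⁻ H q
      ... | inj₁ r = ds⊆ (H⊆ r)
      ... | inj₂ r = proj₁ (without⁻ {H} r)
      from : ∀ {v} → v ∈ A → v ∈ H ++ B
      from {v} v∈ with v ∈ᵥ? H
      ... | yes q = ∈-++⁺ˡ q
      ... | no n = ∈-++⁺ʳ H (without⁺ v∈ n)
      uB : Unique B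
      uB = unique-without uA
      disjoint : ∀ {v} → v ∈ H → v ∉ B
      disjoint v∈ q = proj₂ (without⁻ {H} {A} q) v∈
      slack : ∀ {v} → v ∈ H → 2 + length (nbrs B v) ≤ length (L v)
      slack {v} v∈ with on v∈
      ... | i , refl = ≤-trans (length-⊆ u sub) (≤-trans (bounded (there (H⊆ v∈))) (k≤ v))
        where
        prev : Adj (h (i + e)) (h i)
        prev = subst (Adj (h (i + e))) (trans (cong h (sym (+-suc i e))) (period i)) (link (i + e))
        in-A : ∀ j → h j ∈ A
        in-A j = ds⊆ (H⊆ (into j))
        not-B : ∀ j → h j ∉ nbrs B (h i)
        not-B j q = disjoint (into j) (proj₁ (nbrs-∈ {B} q))
        apart : h (suc i) ≢ h (i + e)
        apart eq = inj (suc i) (e ∸ 1) (m<n⇒0<n∸m (<⇒≤ e≥3)) (m∸n≤m e 1)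
          (trans eq (cong h (trans (cong (i +_) (sym (m+[n∸m]≡n (≤-trans (s≤s z≤n) e≥3)))) (+-suc i (e ∸ 1)))))
        u : Unique (h (suc i) ∷ h (i + e) ∷ nbrs B (h i))
        u = ∷-unique (λ { (here eq) → apart eq ; (there q) → not-B (suc i) q })
          (∷-unique (not-B (i + e)) (unique-nbrs uB))
        sub : ∀ {w} → w ∈ h (suc i) ∷ h (i + e) ∷ nbrs B (h i) → w ∈ nbrs A (h i)
        sub (here refl) = ∈-nbrs (in-A (suc i)) (adj-sym (link i))
        sub (there (here refl)) = ∈-nbrs (in-A (i + e)) prev
        sub (there (there q)) = nbrs-mono {B} {A} (λ r → proj₁ (without⁻ {H} r)) q
      open CycleReduction H B disjoint slack round

-- Counting classes of a generated equivalence

unique-map : ∀ {X Y : Set} (f : X → Y) {xs : List X} → Unique xs →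
  (∀ {x x′} → x ∈ xs → x′ ∈ xs → f x ≡ f x′ → x ≡ x′) → Unique (map f xs)
unique-map f {[]} _ _ = []
unique-map f {x ∷ xs} u inj = ∷-unique
  (λ m → let x′ , x′∈ , eq = ∈-map⁻ f m in ∷-∉ u (subst (_∈ xs) (sym (inj (here refl) (there x′∈) eq)) x′∈))
  (unique-map f (unique-tail u) (λ p q → inj (there p) (there q)))

length-inject : ∀ {X Y : Set} (f : X → Y) {xs : List X} {ys : List Y} → Unique xs →
  (∀ {x x′} → x ∈ xs → x′ ∈ xs → f x ≡ f x′ → x ≡ x′) → (∀ {x} → x ∈ xs → f x ∈ ys) →
  length xs ≤ length ys
length-inject f {xs} {ys} u inj into = subst (_≤ length ys) (length-map f xs)
  (length-⊆ (unique-map f u inj) (λ y∈ → let x , x∈ , eq = ∈-map⁻ f y∈ in subst (_∈ ys) (sym eq) (into x∈)))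

module Classes {X : Set} (_≟_ : DecidableEquality X) (enum : List X) (complete : ∀ x → x ∈ enum)
  (unique : Unique enum) where

  Conn : List (X × X) → X → X → Set
  Conn ps = Star (λ x y → (x , y) ∈ ps ⊎ (y , x) ∈ ps)

  conn-sym : ∀ {ps x y} → Conn ps x y → Conn ps y x
  conn-sym ε = ε
  conn-sym (p ◅ ps) = conn-sym ps ◅◅ ([ inj₂ , inj₁ ]′ p ◅ ε)

  conn-pair : ∀ {ps x y} → (x , y) ∈ ps → Conn ps x y
  conn-pair p = inj₁ p ◅ ε

  conn-map : ∀ {ps qs x y} (f : X → X) → (∀ {x y} → (x , y) ∈ ps → Conn qs (f x) (f y)) →
    Conn ps x y → Conn qs (f x) (f y)
  conn-map f g ε = ε
  conn-map f g (inj₁ p ◅ ps) = g p ◅◅ conn-map f g ps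
  conn-map f g (inj₂ p ◅ ps) = conn-sym (g p) ◅◅ conn-map f g ps

  -- As in union-find, a new pair redirects the class of y to the representative of x. Classes are
  -- then counted as fixed points of `rep`.
  rep : List (X × X) → X → X
  rep [] z = z
  rep ((x , y) ∷ ps) z with rep ps z ≟ rep ps y
  ... | yes _ = rep ps x
  ... | no _ = rep ps z

  conn-there : ∀ {p ps x y} → Conn ps x y → Conn (p ∷ ps) x y
  conn-there = conn-map id (λ q → conn-pair (there q))

  rep-sound : ∀ ps z → Conn ps z (rep ps z)
  rep-sound [] z = ε
  rep-sound ((x , y) ∷ ps) z with rep ps z ≟ rep ps y
  ... | yes eq = conn-there (subst (Conn ps z) eq (rep-sound ps z)) ◅◅
        (conn-there (conn-sym (rep-sound ps y)) ◅◅ (inj₂ (here refl) ◅ conn-there (rep-sound ps x)))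
  ... | no _ = conn-there (rep-sound ps z)

  rep-pair : ∀ ps {x y} → (x , y) ∈ ps → rep ps x ≡ rep ps y
  rep-pair ((x , y) ∷ ps) (here refl) with rep ps x ≟ rep ps y | rep ps y ≟ rep ps y
  ... | _ | no n = ⊥-elim (n refl)
  ... | yes _ | yes _ = refl
  ... | no _ | yes _ = refl
  rep-pair ((x , y) ∷ ps) {a} {b} (there p) with rep ps a ≟ rep ps y | rep ps b ≟ rep ps y
  ... | yes _ | yes _ = refl
  ... | no _ | no _ = rep-pair ps p
  ... | yes q | no n = ⊥-elim (n (trans (sym (rep-pair ps p)) q))
  ... | no n | yes q = ⊥-elim (n (trans (rep-pair ps p) q))

  rep-complete : ∀ ps {x y} → Conn ps x y → rep ps x ≡ rep ps y
  rep-complete ps ε = refl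
  rep-complete ps (inj₁ p ◅ c) = trans (rep-pair ps p) (rep-complete ps c)
  rep-complete ps (inj₂ p ◅ c) = trans (sym (rep-pair ps p)) (rep-complete ps c)

  rep-idem : ∀ ps z → rep ps (rep ps z) ≡ rep ps z
  rep-idem ps z = sym (rep-complete ps (rep-sound ps z))

  rep-conn : ∀ ps {x y} → rep ps x ≡ rep ps y → Conn ps x y
  rep-conn ps {x} {y} eq = subst (Conn ps x) eq (rep-sound ps x) ◅◅ conn-sym (rep-sound ps y)

  conn? : ∀ ps x y → Dec (Conn ps x y)
  conn? ps x y with rep ps x ≟ rep ps y
  ... | yes eq = yes (rep-conn ps eq)
  ... | no n = no λ c → n (rep-complete ps c)

  reps : List (X × X) → List X
  reps ps = filter (λ z → rep ps z ≟ z) enum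

  reps⁺ : ∀ ps {z} → rep ps z ≡ z → z ∈ reps ps
  reps⁺ ps {z} = ∈-filter⁺ (λ z → rep ps z ≟ z) (complete z)

  reps⁻ : ∀ ps {z} → z ∈ reps ps → rep ps z ≡ z
  reps⁻ ps z∈ = proj₂ (∈-filter⁻ (λ z → rep ps z ≟ z) {xs = enum} z∈)

  unique-reps : ∀ ps → Unique (reps ps)
  unique-reps ps = Uniq.filter⁺ (λ z → rep ps z ≟ z) unique

  classes : List (X × X) → ℕ
  classes ps = length (reps ps)

  classes-inject : ∀ {Y : Set} ps (f : Y → X) {ys : List Y} → Unique ys →
    (∀ {y y′} → y ∈ ys → y′ ∈ ys → Conn ps (f y) (f y′) → y ≡ y′) → length ys ≤ classes ps
  classes-inject ps f u inj = length-inject (λ y → rep ps (f y)) u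
    (λ p q eq → inj p q (rep-conn ps eq)) (λ {y} _ → reps⁺ ps (rep-idem ps (f y)))

  classes-mono : ∀ ps qs → (∀ {x y} → (x , y) ∈ ps → Conn qs x y) → classes qs ≤ classes ps
  classes-mono ps qs sub = classes-inject ps id (unique-reps qs) λ p q c →
    trans (sym (reps⁻ qs p)) (trans (rep-complete qs (conn-map id sub c)) (reps⁻ qs q))

  -- The representative of y is the only one that can be lost; `classes-split` shows that it is lost
  -- if x and y were not yet connected.
  classes-merge : ∀ ps x y → classes ps ≤ suc (classes ((x , y) ∷ ps))
  classes-merge ps x y = length-⊆ {ys = rep ps y ∷ reps ((x , y) ∷ ps)} (unique-reps ps) sub
    where
    sub : ∀ {z} → z ∈ reps ps → z ∈ rep ps y ∷ reps ((x , y) ∷ ps)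
    sub {z} z∈ with rep ps z ≟ rep ps y in eq
    ... | yes q = here (trans (sym (reps⁻ ps z∈)) q)
    ... | no n = there (reps⁺ ((x , y) ∷ ps) fixed)
      where
      fixed : rep ((x , y) ∷ ps) z ≡ z
      fixed with rep ps z ≟ rep ps y
      ... | yes q = ⊥-elim (n q)
      ... | no _ = reps⁻ ps z∈

  classes-split : ∀ ps x y → ¬ Conn ps x y → suc (classes ((x , y) ∷ ps)) ≤ classes ps
  classes-split ps x y nc = length-⊂ (unique-reps ((x , y) ∷ ps)) sub (reps⁺ ps (rep-idem ps y)) lost
    where
    sub : ∀ {z} → z ∈ reps ((x , y) ∷ ps) → z ∈ reps ps
    sub {z} z∈ with rep ps z ≟ rep ps y | reps⁻ ((x , y) ∷ ps) z∈
    ... | yes q | eq = ⊥-elim (nc (rep-conn ps (trans (sym (rep-idem ps x)) (trans (cong (rep ps) eq) q))))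
    ... | no _ | eq = reps⁺ ps eq
    lost : rep ps y ∉ reps ((x , y) ∷ ps)
    lost m with rep ps (rep ps y) ≟ rep ps y | reps⁻ ((x , y) ∷ ps) m
    ... | yes _ | eq = nc (rep-conn ps eq)
    ... | no n | _ = n (rep-idem ps y)

-- From two-colour steps to valid Kempe swaps

module Kempe {N : ℕ} (Adj : Fin N → Fin N → Set) (adj? : ∀ u v → Dec (Adj u v))
  (adj-sym : ∀ {u v} → Adj u v → Adj v u) (irr : ∀ {u} → ¬ Adj u u) (L : Fin N → List ℕ) where

  open Coloring F._≟_ Adj adj? adj-sym irr
  open Classes F._≟_ (allFin N) ∈-allFin (Uniq.allFin⁺ N)

  differ : (Fin N → ℕ) → (Fin N → ℕ) → List (Fin N)
  differ c d = filter (λ v → ¬? (c v ℕ.≟ d v)) (allFin N)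

  swapCol-fst : ∀ α β → swapCol Adj α β α ≡ β
  swapCol-fst α β with α ℕ.≡ᵇ α | ≡⇒≡ᵇ α α refl
  ... | true | _ = refl

  swapCol-snd : ∀ α β → swapCol Adj α β β ≡ α
  swapCol-snd α β with β ℕ.≡ᵇ α in eq
  ... | true = ≡ᵇ⇒≡ β α (subst Data.Bool.T (sym eq) _)
  ... | false with β ℕ.≡ᵇ β | ≡⇒≡ᵇ β β refl
  ... | true | _ = refl

  swapped : ∀ {α β x y} → Both α β x → Both α β y → x ≢ y → y ≡ swapCol Adj α β x
  swapped {α} {β} (inj₁ refl) (inj₁ refl) n = ⊥-elim (n refl)
  swapped {α} {β} (inj₁ refl) (inj₂ refl) n = sym (swapCol-fst α β)
  swapped {α} {β} (inj₂ refl) (inj₁ refl) n = sym (swapCol-snd α β)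
  swapped {α} {β} (inj₂ refl) (inj₂ refl) n = ⊥-elim (n refl)

  module Swap {c d : Fin N → ℕ} {α β : ℕ} (pc : IsLColoring Adj L c) (pd : IsLColoring Adj L d)
    (mv : ∀ v → Move α β (c v) (d v)) where

    Coloured : Fin N × Fin N → Set
    Coloured (v , w) = Adj v w × Both α β (c v) × Both α β (c w)

    coloured? : ∀ p → Dec (Coloured p)
    coloured? (v , w) = adj? v w ×-dec (both? α β (c v) ×-dec both? α β (c w))

    -- Writing Kempe components as connectivity over a finite list of pairs makes membership in
    -- `KComp` decidable.
    links : List (Fin N × Fin N)
    links = filter coloured? (cartesianProduct (allFin N) (allFin N))

    links⁺ : ∀ {v w} → Coloured (v , w) → (v , w) ∈ links
    links⁺ {v} {w} = ∈-filter⁺ coloured? (∈-cartesianProduct⁺ (∈-allFin v) (∈-allFin w))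

    links⁻ : ∀ {v w} → (v , w) ∈ links → Coloured (v , w)
    links⁻ p = proj₂ (∈-filter⁻ coloured? {xs = cartesianProduct (allFin N) (allFin N)} p)

    comp→conn : ∀ {u v} → KComp Adj c α β u v → Conn links u v × Both α β (c v)
    comp→conn (here b) = ε , b
    comp→conn (step k a b) with comp→conn k
    ... | cn , b′ = cn ◅◅ conn-pair (links⁺ (a , b′ , b)) , b

    conn→comp : ∀ {u v w} → KComp Adj c α β u v → Conn links v w → KComp Adj c α β u w
    conn→comp k ε = k
    conn→comp k (inj₁ p ◅ cn) = let a , _ , b = links⁻ p in conn→comp (step k a b) cn
    conn→comp k (inj₂ p ◅ cn) = let a , b , _ = links⁻ p in conn→comp (step k (adj-sym a) b) cn

    module _ {u : Fin N} (c≢d : c u ≢ d u) where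

      bu : Both α β (c u)
      bu with mv u
      ... | inj₁ e = ⊥-elim (c≢d e)
      ... | inj₂ (b , _) = b

      comp? : ∀ v → Dec (KComp Adj c α β u v)
      comp? v with conn? links u v
      ... | yes cn = yes (conn→comp (here bu) cn)
      ... | no n = no λ k → n (proj₁ (comp→conn k))

      -- Along the component d must keep differing from c, because d is proper.
      moved : ∀ {v} → KComp Adj c α β u v → c v ≢ d v
      moved (here _) = c≢d
      moved (step {v} {w} k a bw) eq with mv v
      ... | inj₁ e = moved k e
      ... | inj₂ (bv , bv′) = proj₂ pd v w a (trans dv (trans eq′ eq))
        where
        dv : d v ≡ swapCol Adj α β (c v)
        dv = swapped bv bv′ (moved k)
        eq′ : swapCol Adj α β (c v) ≡ c w
        eq′ = sym (swapped bv bw (proj₂ pc v w a))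

      c′ : Fin N → ℕ
      c′ v with comp? v
      ... | yes _ = d v
      ... | no _ = c v

      c′-in : ∀ {v} → KComp Adj c α β u v → c′ v ≡ d v
      c′-in {v} k with comp? v
      ... | yes _ = refl
      ... | no n = ⊥-elim (n k)

      c′-out : ∀ {v} → ¬ KComp Adj c α β u v → c′ v ≡ c v
      c′-out {v} n with comp? v
      ... | yes k = ⊥-elim (n k)
      ... | no _ = refl

      d-swapped : ∀ {v} → KComp Adj c α β u v → d v ≡ swapCol Adj α β (c v)
      d-swapped {v} k with mv v
      ... | inj₁ e = ⊥-elim (moved k e)
      ... | inj₂ (b , b′) = swapped b b′ (moved k)

      c′-proper : ∀ v w → Adj v w → c′ v ≢ c′ w
      c′-proper v w a with comp? v | comp? w
      ... | yes _ | yes _ = proj₂ pd v w a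
      ... | no _ | no _ = proj₂ pc v w a
      ... | yes k | no n = λ eq → n (step k a (subst (Both α β) eq (d-both k)))
        where
        d-both : ∀ {v} → KComp Adj c α β u v → Both α β (d v)
        d-both {v} k with mv v
        ... | inj₁ e = ⊥-elim (moved k e)
        ... | inj₂ (_ , b) = b
      ... | no n | yes k = λ eq → n (step k (adj-sym a) (subst (Both α β) (sym eq) (d-both k)))
        where
        d-both : ∀ {v} → KComp Adj c α β u v → Both α β (d v)
        d-both {v} k with mv v
        ... | inj₁ e = ⊥-elim (moved k e)
        ... | inj₂ (_ , b) = b

      c′-list : ∀ v → c′ v ∈ L v
      c′-list v with comp? v
      ... | yes _ = proj₁ pd v
      ... | no _ = proj₁ pc v

      swap : LValidSwap Adj L c c′
      swap = (α , β , u , bu , λ v → (λ k → trans (c′-in k) (d-swapped k)) , c′-out) , c′-list , c′-proper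

      c′-move : ∀ v → Move α β (c′ v) (d v)
      c′-move v with comp? v
      ... | yes _ = inj₁ refl
      ... | no _ = mv v

      fewer : length (differ c′ d) < length (differ c d)
      fewer = length-⊂ (Uniq.filter⁺ (λ v → ¬? (c′ v ℕ.≟ d v)) (Uniq.allFin⁺ N)) sub
        (∈-filter⁺ (λ v → ¬? (c v ℕ.≟ d v)) (∈-allFin u) c≢d)
        λ m → proj₂ (∈-filter⁻ (λ v → ¬? (c′ v ℕ.≟ d v)) {xs = allFin N} m) (c′-in (here bu))
        where
        sub : ∀ {v} → v ∈ differ c′ d → v ∈ differ c d
        sub {v} m = ∈-filter⁺ (λ v → ¬? (c v ℕ.≟ d v)) (∈-allFin v) still
          where
          still : c v ≢ d v
          still eq with ∈-filter⁻ (λ v → ¬? (c′ v ℕ.≟ d v)) {xs = allFin N} m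
          ... | _ , n with comp? v
          ... | yes _ = n refl
          ... | no _ = n eq

  -- Swapping the component of a vertex where c and d differ gives that whole component its colours
  -- in d, so the number of differing vertices falls.
  realise : ∀ fuel {c d α β} → length (differ c d) ≤ fuel → IsLColoring Adj L c → IsLColoring Adj L d →
    (∀ v → Move α β (c v) (d v)) → ∃ λ d′ → Star (LValidSwap Adj L) c d′ × (∀ v → d′ v ≡ d v)
  realise fuel {c} {d} le pc pd mv with search∈ (λ v → ¬? (c v ℕ.≟ d v)) (allFin N)
  ... | inj₂ none = c , ε , λ v → same v
    where
    same : ∀ v → c v ≡ d v
    same v with c v ℕ.≟ d v
    ... | yes e = e
    ... | no n = ⊥-elim (none (∈-allFin v) n)
  realise zero le pc pd mv | inj₁ (u , _ , n) = ⊥-elim (n≮0 (≤-trans (Swap.fewer pc pd mv n) le))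
  realise (suc fuel) le pc pd mv | inj₁ (u , _ , n)
    with realise fuel (≤-pred (≤-trans (fewer n) le)) (c′-list n , c′-proper n) pd (c′-move n)
    where open Swap pc pd mv
  ... | d′ , st , eq = d′ , Swap.swap pc pd mv n ◅ st , eq

  col→coloring : ∀ {c} → Col L (allFin N) c → IsLColoring Adj L c
  col→coloring (mem , prop) = (λ v → mem (∈-allFin v)) , λ u v → prop (∈-allFin u) (∈-allFin v)

  realise-equiv : ∀ {c d c₀} → Equiv L (allFin N) c d → IsLColoring Adj L c₀ → (∀ v → c₀ v ≡ c v) →
    ∃ λ d′ → Star (LValidSwap Adj L) c₀ d′ × (∀ v → d′ v ≡ d v)
  realise-equiv ε _ eq = _ , ε , eq
  realise-equiv {c₀ = c₀} (mkStep _ p α β m ◅ ss) pc₀ eq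
    with realise _ ≤-refl pc₀ (col→coloring p) (λ v → subst (λ x → Move α β x _) (sym (eq v)) (m (∈-allFin v)))
  ... | c₁ , st , eq₁ with realise-equiv ss (agree (col→coloring p) eq₁) eq₁
    where
    agree : ∀ {c d} → IsLColoring Adj L d → (∀ v → c v ≡ d v) → IsLColoring Adj L c
    agree (mem , prop) eq = (λ v → subst (_∈ L v) (sym (eq v)) (mem v)) ,
      λ u v a e → prop u v a (trans (sym (eq u)) (trans e (eq v)))
  ... | d′ , st′ , eq₂ = d′ , st ◅◅ st′ , eq₂

  swappable→LSwappable : Swappable L (allFin N) → LSwappable Adj L
  swappable→LSwappable sw c d pc pd = realise-equiv (sw (col pc) (col pd)) pc (λ _ → refl)
    where
    col : ∀ {c} → IsLColoring Adj L c → Col L (allFin N) c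
    col (mem , prop) = (λ {v} _ → mem v) , λ {u} {v} _ _ → prop u v

-- Permutations, rotation systems and Euler's inequality

iter-shift : ∀ {X : Set} k (π : X → X) x → iter k π (π x) ≡ π (iter k π x)
iter-shift zero π x = refl
iter-shift (suc k) π x = cong π (iter-shift k π x)

iter-+ : ∀ {X : Set} j k (π : X → X) x → iter (j + k) π x ≡ iter j π (iter k π x)
iter-+ zero k π x = refl
iter-+ (suc j) k π x = cong π (iter-+ j k π x)

module Permutations {X : Set} (_≟_ : DecidableEquality X) (enum : List X) (complete : ∀ x → x ∈ enum)
  (unique : Unique enum) where

  open Classes _≟_ enum complete unique

  -- The graph of π as a list of pairs: its classes are the orbits, so vertices, faces and
  -- components are all counted by `classes`.
  gen : (X → X) → List (X × X)
  gen π = map (λ z → z , π z) enum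

  gen⁺ : ∀ π z → (z , π z) ∈ gen π
  gen⁺ π z = ∈-map⁺ (λ z → z , π z) (complete z)

  gen⁻ : ∀ π {x y} → (x , y) ∈ gen π → y ≡ π x
  gen⁻ π p with ∈-map⁻ (λ z → z , π z) p
  ... | z , _ , refl = refl

  conn-next : ∀ π z → Conn (gen π) z (π z)
  conn-next π z = conn-pair (gen⁺ π z)

  conn-iter : ∀ π k z → Conn (gen π) z (iter k π z)
  conn-iter π zero z = ε
  conn-iter π (suc k) z = conn-iter π k z ◅◅ conn-next π (iter k π z)

  Injective : (X → X) → Set
  Injective π = ∀ {x y} → π x ≡ π y → x ≡ y

  iter-cancel : ∀ {π} → Injective π → ∀ i {x y} → iter i π x ≡ iter i π y → x ≡ y
  iter-cancel inj zero eq = eq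
  iter-cancel inj (suc i) eq = iter-cancel inj i (inj eq)

  period : ∀ {π} → Injective π → ∀ x → ∃ λ k → k < length enum × iter (suc k) π x ≡ x
  period {π} inj x with search< (λ k → iter (suc k) π x ≟ x) (length enum)
  ... | inj₁ p = p
  ... | inj₂ none = ⊥-elim (1+n≰n (subst (_≤ length enum) (length-applyUpTo orbit (suc (length enum)))
          (length-⊆ distinct (λ {y} _ → complete y))))
    where
    orbit : ℕ → X
    orbit i = iter i π x
    apart : ∀ {i j} → i < j → j < suc (length enum) → orbit i ≢ orbit j
    apart {i} {j} lt j< eq = none (≤-trans (≤-reflexive suc-k) (≤-trans (m∸n≤m j i) (≤-pred j<)))
      (sym (iter-cancel inj i (trans eq (trans (cong (λ z → iter z π x) (sym split)) (iter-+ i (suc (j ∸ suc i)) π x)))))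
      where
      suc-k : suc (j ∸ suc i) ≡ j ∸ i
      suc-k = sym (+-∸-assoc 1 lt)
      split : i + suc (j ∸ suc i) ≡ j
      split = trans (cong (i +_) suc-k) (m+[n∸m]≡n (<⇒≤ lt))
    distinct : Unique (applyUpTo orbit (suc (length enum)))
    distinct = Uniq.applyUpTo⁺₁ orbit (suc (length enum)) apart

  conn→iter : ∀ {π} → Injective π → ∀ {x y} → Conn (gen π) x y → ∃ λ k → iter k π x ≡ y
  conn→iter inj ε = 0 , refl
  conn→iter {π} inj {x} (inj₁ p ◅ c) with gen⁻ π p | conn→iter inj c
  ... | refl | k , eq = suc k , trans (sym (iter-shift k π x)) eq
  conn→iter {π} inj {x} (inj₂ p ◅ c) with gen⁻ π p | conn→iter inj c | period inj _
  ... | refl | k , eq | p′ , _ , per = k + p′ , trans (iter-+ k p′ π x) (trans (cong (iter k π) (trans (iter-shift p′ π _) per)) eq)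

  -- Matches the definition of `faces`, which inspects only as many iterates as there are darts.
  iter-bounded : ∀ {π} → Injective π → ∀ k x → ∃ λ j → j < length enum × iter j π x ≡ iter k π x
  iter-bounded {π} inj k x with period inj x
  ... | p , p< , per = k % suc p , ≤-trans (m%n<n k (suc p)) p< ,
        sym (trans (cong (λ z → iter z π x) (m≡m%n+[m/n]*n k (suc p)))
          (trans (iter-+ (k % suc p) (k / suc p * suc p) π x) (cong (iter (k % suc p) π) (rounds (k / suc p)))))
    where
    rounds : ∀ r → iter (r * suc p) π x ≡ x
    rounds zero = refl
    rounds (suc r) = trans (iter-+ (suc p) (r * suc p) π x) (trans (cong (iter (suc p) π) (rounds r)) per)

  module Maps (flip : X → X) (flip² : ∀ x → flip (flip x) ≡ x) where

    -- σ turns around a vertex and flip passes to the other end of the edge. The orbits of σ are the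
    -- vertices, those of φ the faces, and `joint` generates the components.
    record Rotation : Set where
      field
        σ σ⁻  : X → X
        left  : ∀ x → σ⁻ (σ x) ≡ x
        right : ∀ x → σ (σ⁻ x) ≡ x
      σ-inj : Injective σ
      σ-inj {x} {y} eq = trans (sym (left x)) (trans (cong σ⁻ eq) (left y))
      φ : X → X
      φ x = σ (flip x)
      φ-inj : Injective φ
      φ-inj {x} {y} eq = trans (sym (flip² x)) (trans (cong flip (σ-inj eq)) (flip² y))
      joint : List (X × X)
      joint = gen σ ++ gen flip

    open Rotation

    -- V - E + F ≥ 2 C, the half of Euler's formula that expresses planarity.
    Planar : ℕ → Rotation → Set
    Planar E r = E + 2 * classes (joint r) ≤ classes (gen (σ r)) + classes (gen (φ r))

    -- The dart a is cut out of its vertex and becomes a vertex of its own. The dart set stays the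
    -- same, so deleting edges never changes the type on which permutations act.
    module Detach (r : Rotation) (a : X) (moves : σ r a ≢ a) where

      τ τ⁻ : X → X
      τ z with z ≟ a | σ r z ≟ a
      ... | yes _ | _ = a
      ... | no _ | yes _ = σ r a
      ... | no _ | no _ = σ r z
      τ⁻ z with z ≟ a | σ⁻ r z ≟ a
      ... | yes _ | _ = a
      ... | no _ | yes _ = σ⁻ r a
      ... | no _ | no _ = σ⁻ r z

      data View (z : X) : X → Set where
        fixed : z ≡ a → View z a
        skip  : z ≢ a → σ r z ≡ a → View z (σ r a)
        same  : z ≢ a → σ r z ≢ a → View z (σ r z)

      view : ∀ z → View z (τ z)
      view z with z ≟ a | σ r z ≟ a
      ... | yes p | _ = fixed p
      ... | no n | yes q = skip n q
      ... | no n | no n′ = same n n′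

      τ-a : τ a ≡ a
      τ-a with a ≟ a
      ... | yes _ = refl
      ... | no n = ⊥-elim (n refl)

      τ⁻-a : τ⁻ a ≡ a
      τ⁻-a with a ≟ a
      ... | yes _ = refl
      ... | no n = ⊥-elim (n refl)

      τ-skip : ∀ {z} → z ≢ a → σ r z ≡ a → τ z ≡ σ r a
      τ-skip {z} n q with z ≟ a | σ r z ≟ a
      ... | yes p | _ = ⊥-elim (n p)
      ... | no _ | yes _ = refl
      ... | no _ | no n′ = ⊥-elim (n′ q)

      τ-same : ∀ {z} → z ≢ a → σ r z ≢ a → τ z ≡ σ r z
      τ-same {z} n q with z ≟ a | σ r z ≟ a
      ... | yes p | _ = ⊥-elim (n p)
      ... | no _ | yes p = ⊥-elim (q p)
      ... | no _ | no _ = refl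

      τ⁻-skip : ∀ {z} → z ≢ a → σ⁻ r z ≡ a → τ⁻ z ≡ σ⁻ r a
      τ⁻-skip {z} n q with z ≟ a | σ⁻ r z ≟ a
      ... | yes p | _ = ⊥-elim (n p)
      ... | no _ | yes _ = refl
      ... | no _ | no n′ = ⊥-elim (n′ q)

      τ⁻-same : ∀ {z} → z ≢ a → σ⁻ r z ≢ a → τ⁻ z ≡ σ⁻ r z
      τ⁻-same {z} n q with z ≟ a | σ⁻ r z ≟ a
      ... | yes p | _ = ⊥-elim (n p)
      ... | no _ | yes p = ⊥-elim (q p)
      ... | no _ | no _ = refl

      σ⁻a≢a : σ⁻ r a ≢ a
      σ⁻a≢a eq = moves (trans (cong (σ r) (sym eq)) (right r a))

      τ-left : ∀ z → τ⁻ (τ z) ≡ z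
      τ-left z with τ z | view z
      ... | _ | fixed p = trans τ⁻-a (sym p)
      ... | _ | skip n q = trans (τ⁻-skip moves (left r a)) (trans (cong (σ⁻ r) (sym q)) (left r z))
      ... | _ | same n q = trans (τ⁻-same q (λ e → n (trans (sym (left r z)) e))) (left r z)

      τ-right : ∀ z → τ (τ⁻ z) ≡ z
      τ-right z with z ≟ a | σ⁻ r z ≟ a
      ... | yes p | _ = trans τ-a (sym p)
      ... | no n | yes q = trans (τ-skip σ⁻a≢a (right r a)) (trans (cong (σ r) (sym q)) (right r z))
      ... | no n | no q = trans (τ-same q (λ e → n (trans (sym (right r z)) e))) (right r z)

      detached : Rotation
      detached = record { σ = τ ; σ⁻ = τ⁻ ; left = τ-left ; right = τ-right }

      alone : ∀ {y} → Conn (gen τ) a y → y ≡ a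
      alone c = go c refl
        where
        go : ∀ {x y} → Conn (gen τ) x y → x ≡ a → y ≡ a
        go ε e = e
        go (inj₁ p ◅ c) refl = go c (trans (gen⁻ τ p) τ-a)
        go (inj₂ p ◅ c) refl = go c (trans (sym (τ-left _)) (trans (cong τ⁻ (sym (gen⁻ τ p))) τ⁻-a))

      -- The classes of τ, with a joined again to its old successor, refine to nothing finer than
      -- those of σ; and a was alone before being joined.
      more-vertices : suc (classes (gen (σ r))) ≤ classes (gen τ)
      more-vertices = ≤-trans (s≤s (classes-mono ((a , σ r a) ∷ gen τ) (gen (σ r)) sub))
        (classes-split (gen τ) a (σ r a) (λ c → moves (alone c)))
        where
        sub : ∀ {x y} → (x , y) ∈ (a , σ r a) ∷ gen τ → Conn (gen (σ r)) x y
        sub (here refl) = conn-next (σ r) a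
        sub {x} (there p) with gen⁻ τ p
        ... | refl with τ x | view x
        ... | _ | fixed refl = ε
        ... | _ | skip n q = conn-next (σ r) x ◅◅ subst (λ z → Conn (gen (σ r)) z (σ r a)) (sym q) (conn-next (σ r) a)
        ... | _ | same n q = conn-next (σ r) x

      -- A walk through a is diverted to the successor of a, where τ continues in the same way.
      keeps-conn : ∀ {x y} → x ≢ a → y ≢ a → Conn (gen (σ r)) x y → Conn (gen τ) x y
      keeps-conn {x} {y} nx ny c = subst (λ z → Conn (gen τ) z y) (jump-≢ nx)
          (subst (Conn (gen τ) (jump x)) (jump-≢ ny) (conn-map jump along c))
        where
        jump : X → X
        jump z with z ≟ a
        ... | yes _ = σ r a
        ... | no _ = z
        jump-≢ : ∀ {z} → z ≢ a → jump z ≡ z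
        jump-≢ {z} n with z ≟ a
        ... | yes p = ⊥-elim (n p)
        ... | no _ = refl
        jump-a : jump a ≡ σ r a
        jump-a with a ≟ a
        ... | yes _ = refl
        ... | no n = ⊥-elim (n refl)
        link : ∀ {u v} z → u ≡ jump z → v ≡ jump (σ r z) → Conn (gen τ) u v → Conn (gen τ) (jump z) (jump (σ r z))
        link z refl refl c = c
        along-dec : ∀ z → Dec (z ≡ a) → Dec (σ r z ≡ a) → Conn (gen τ) (jump z) (jump (σ r z))
        along-dec z (yes p) _ = link z (trans (sym jump-a) (cong jump (sym p)))
          (trans (cong (σ r) (sym p)) (sym (jump-≢ (λ e → moves (trans (cong (σ r) (sym p)) e))))) ε
        along-dec z (no n) (yes q) = link z (sym (jump-≢ n)) (trans (sym jump-a) (cong jump (sym q)))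
          (subst (Conn (gen τ) z) (τ-skip n q) (conn-next τ z))
        along-dec z (no n) (no q) = link z (sym (jump-≢ n)) (sym (jump-≢ q))
          (subst (Conn (gen τ) z) (τ-same n q) (conn-next τ z))
        along : ∀ {x y} → (x , y) ∈ gen (σ r) → Conn (gen τ) (jump x) (jump y)
        along {x} p with gen⁻ (σ r) p
        ... | refl = along-dec x (x ≟ a) (σ r x ≟ a)

      -- The two darts whose images change: φ sends x to `σ r a` and y to a, while ψ sends x to a
      -- and y to `σ r a`.
      x y : X
      x = flip a
      y = flip (σ⁻ r a)

      ψ : X → X
      ψ z = τ (flip z)

      ψ-x : ψ x ≡ a
      ψ-x = trans (cong τ (flip² a)) τ-a

      ψ-y : ψ y ≡ σ r a
      ψ-y = trans (cong τ (flip² (σ⁻ r a))) (τ-skip σ⁻a≢a (right r a))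

      φ-x : φ r x ≡ σ r a
      φ-x = cong (σ r) (flip² a)

      φ-y : φ r y ≡ a
      φ-y = trans (cong (σ r) (flip² (σ⁻ r a))) (right r a)

      data Spot (z : X) : Set where
        at-x  : z ≡ x → Spot z
        at-y  : z ≡ y → Spot z
        other : ψ z ≡ φ r z → Spot z

      spot : ∀ z → Spot z
      spot z with flip z ≟ a | σ r (flip z) ≟ a
      ... | yes p | _ = at-x (trans (sym (flip² z)) (cong flip p))
      ... | no n | yes p = at-y (trans (sym (flip² z)) (cong flip (trans (sym (left r (flip z))) (cong (σ⁻ r) p))))
      ... | no n | no n′ = other (τ-same n n′)

      ψ-via-φ : ∀ z → Conn ((x , y) ∷ gen (φ r)) z (ψ z)
      ψ-via-φ z with spot z
      ... | at-x refl = inj₁ (here refl) ◅ subst (Conn _ y) (trans φ-y (sym ψ-x)) (conn-there (conn-next (φ r) y))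
      ... | at-y refl = inj₂ (here refl) ◅ subst (Conn _ x) (trans φ-x (sym ψ-y)) (conn-there (conn-next (φ r) x))
      ... | other e = subst (Conn _ z) (sym e) (conn-there (conn-next (φ r) z))

      joint′ : List (X × X)
      joint′ = joint detached

      joint-flip : ∀ (r : Rotation) z → Conn (joint r) z (flip z)
      joint-flip r z = conn-pair (∈-++⁺ʳ (gen (σ r)) (gen⁺ flip z))

      joint-σ : ∀ (r : Rotation) z → Conn (joint r) z (σ r z)
      joint-σ r z = conn-pair (∈-++⁺ˡ (gen⁺ (σ r) z))

      φ-in-joint : ∀ (r : Rotation) {u v} → Conn (gen (φ r)) u v → Conn (joint r) u v
      φ-in-joint r = conn-map id λ {u} p → subst (Conn (joint r) u) (sym (gen⁻ (φ r) p))
        (joint-flip r u ◅◅ joint-σ r (flip u))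

      joint-via : ∀ {qs} → Conn qs a (σ r a) → (∀ {u v} → Conn joint′ u v → Conn qs u v) →
        ∀ {u v} → (u , v) ∈ joint r → Conn qs u v
      joint-via key inc {u} p with ∈-++⁻ (gen (σ r)) p
      ... | inj₂ q rewrite gen⁻ flip q = inc (joint-flip detached u)
      ... | inj₁ q with gen⁻ (σ r) q | u ≟ a | σ r u ≟ a
      ... | refl | yes refl | _ = key
      ... | refl | no n | yes e = inc (subst (Conn joint′ u) (τ-skip n e) (joint-σ detached u)) ◅◅
            subst (Conn _ (σ r a)) (sym e) (conn-sym key)
      ... | refl | no n | no n′ = inc (subst (Conn joint′ u) (τ-same n n′) (joint-σ detached u))

      -- φ changes by the transposition of x and y: either two faces merge and nothing is disconnected,
      -- or one face splits.
      faces-or-components :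
        (classes (gen (φ r)) ≤ suc (classes (gen ψ)) × classes joint′ ≤ classes (joint r)) ⊎
        (suc (classes (gen (φ r))) ≤ classes (gen ψ) × classes joint′ ≤ suc (classes (joint r)))
      faces-or-components with conn? (gen ψ) x y
      ... | yes c = inj₁
            ( ≤-trans (classes-merge (gen (φ r)) x y)
                (s≤s (classes-mono (gen ψ) ((x , y) ∷ gen (φ r)) (λ {u} p → subst (Conn _ u) (sym (gen⁻ ψ p)) (ψ-via-φ u))))
            , classes-mono (joint r) joint′ (joint-via key id))
        where
        key : Conn joint′ a (σ r a)
        key = φ-in-joint detached (conn-sym (subst (Conn (gen ψ) x) ψ-x (conn-next ψ x)) ◅◅
          (c ◅◅ subst (Conn (gen ψ) y) ψ-y (conn-next ψ y)))
      ... | no nc with conn? (gen (φ r)) x y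
      ... | yes c = inj₂
            ( ≤-trans (s≤s (classes-mono ((x , y) ∷ gen ψ) (gen (φ r)) sub)) (classes-split (gen ψ) x y nc)
            , ≤-trans (classes-merge joint′ a (σ r a))
                (s≤s (classes-mono (joint r) ((a , σ r a) ∷ joint′) (joint-via (conn-pair (here refl)) conn-there))))
        where
        collapse : ∀ {u v} → Conn ((x , y) ∷ gen (φ r)) u v → Conn (gen (φ r)) u v
        collapse = conn-map id λ { (here refl) → c ; (there p) → conn-pair p }
        sub : ∀ {u v} → (u , v) ∈ (x , y) ∷ gen ψ → Conn (gen (φ r)) u v
        sub (here refl) = c
        sub {u} (there p) = subst (Conn _ u) (sym (gen⁻ ψ p)) (collapse (ψ-via-φ u))
      -- The φ-orbit of x passes through `σ r a` and returns to x without meeting y. On the way ψ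
      -- agrees with φ, and `ψ y` is `σ r a`, so ψ connects y to x after all.
      ... | no nc′ = ⊥-elim (nc (conn-sym (subst (Conn (gen ψ) y) ψ-y (conn-next ψ y) ◅◅ returns)))
        where
        walk : ∀ k → Conn (gen ψ) (σ r a) x ⊎ (Conn (gen ψ) (σ r a) (iter k (φ r) (σ r a)))
        walk zero = inj₂ ε
        walk (suc k) with walk k
        ... | inj₁ c = inj₁ c
        ... | inj₂ c with spot (iter k (φ r) (σ r a))
        ... | at-x e = inj₁ (subst (Conn (gen ψ) (σ r a)) e c)
        ... | at-y e = ⊥-elim (nc′ (subst (Conn (gen (φ r)) x) φ-x (conn-next (φ r) x) ◅◅
              subst (Conn (gen (φ r)) (σ r a)) e (conn-iter (φ r) k (σ r a))))
        ... | other e = inj₂ (c ◅◅ subst (Conn (gen ψ) _) e (conn-next ψ _))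
        returns : Conn (gen ψ) (σ r a) x
        returns with period (φ-inj r) x
        ... | k , _ , per with walk k
        ... | inj₁ c = c
        ... | inj₂ c = subst (Conn (gen ψ) (σ r a))
              (trans (cong (iter k (φ r)) (sym φ-x)) (trans (iter-shift k (φ r) x) per)) c

      -- V rises by at least one. If F drops by one, C does not grow; if C grows by one, F rises as
      -- well, and the two gains pay for 2C.
      detached-planar : ∀ {E} → Planar E r → Planar E detached
      detached-planar {E} pl with faces-or-components
      ... | inj₁ (f , c) = ≤-pred (begin
            suc (E + 2 * classes joint′)            ≤⟨ s≤s (+-monoʳ-≤ E (*-monoʳ-≤ 2 c)) ⟩
            suc (E + 2 * classes (joint r))         ≤⟨ s≤s pl ⟩
            suc (V + F)                             ≤⟨ +-mono-≤ more-vertices f ⟩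
            V′ + suc F′                             ≡⟨ +-suc V′ F′ ⟩
            suc (V′ + F′) ∎)
        where
        open ≤-Reasoning
        V = classes (gen (σ r))
        F = classes (gen (φ r))
        V′ = classes (gen τ)
        F′ = classes (gen ψ)
      ... | inj₂ (f , c) = begin
            E + 2 * classes joint′                  ≤⟨ +-monoʳ-≤ E (*-monoʳ-≤ 2 c) ⟩
            E + 2 * suc C                           ≡⟨ solve 2 (λ e c → e :+ con 2 :* (con 1 :+ c) := con 2 :+ (e :+ con 2 :* c)) refl E C ⟩
            2 + (E + 2 * C)                         ≤⟨ s≤s (s≤s pl) ⟩
            2 + (V + F)                             ≡⟨ cong suc (sym (+-suc V F)) ⟩
            suc V + suc F                           ≤⟨ +-mono-≤ more-vertices f ⟩
            V′ + F′ ∎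
        where
        open ≤-Reasoning
        V = classes (gen (σ r))
        F = classes (gen (φ r))
        V′ = classes (gen τ)
        F′ = classes (gen ψ)
        C = classes (joint r)

-- From the given embedding to Euler's inequality

tally : {X : Set} → (X → Bool) → List X → ℕ
tally p = foldr (λ i acc → (if p i then 1 else 0) + acc) 0

select : {X : Set} → (X → Bool) → List X → List X
select p = filter (λ x → T? (p x))

tally-length : ∀ {X : Set} (p : X → Bool) xs → tally p xs ≡ length (select p xs)
tally-length p [] = refl
tally-length p (x ∷ xs) with p x
... | true = cong suc (tally-length p xs)
... | false = tally-length p xs

∈-select⁺ : ∀ {X : Set} (p : X → Bool) {xs x} → x ∈ xs → T (p x) → x ∈ select p xs
∈-select⁺ p = ∈-filter⁺ (λ x → T? (p x))

∈-select⁻ : ∀ {X : Set} (p : X → Bool) {xs x} → x ∈ select p xs → x ∈ xs × T (p x)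
∈-select⁻ p {xs} = ∈-filter⁻ (λ x → T? (p x)) {xs = xs}

unique-select : ∀ {X : Set} (p : X → Bool) {xs} → Unique xs → Unique (select p xs)
unique-select p = Uniq.filter⁺ (λ x → T? (p x))

T-any : ∀ {X : Set} (p : X → Bool) xs → T (any p xs) → ∃ λ x → x ∈ xs × T (p x)
T-any p xs t = go (any⁻ p xs t)
  where
  go : ∀ {xs} → Any (λ x → T (p x)) xs → ∃ λ x → x ∈ xs × T (p x)
  go (here q) = _ , here refl , q
  go (there q) = let x , x∈ , r = go q in x , there x∈ , r

any-T : ∀ {X : Set} (p : X → Bool) {xs x} → x ∈ xs → T (p x) → T (any p xs)
any-T p x∈ t = any⁺ p (go x∈ t)
  where
  go : ∀ {xs x} → x ∈ xs → T (p x) → Any (λ x → T (p x)) xs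
  go (here refl) t = here t
  go (there x∈) t = there (go x∈ t)

least : ∀ {n} (x : Fin n) xs → ∃ λ y → y ∈ x ∷ xs × (∀ {z} → z ∈ x ∷ xs → toℕ y ≤ toℕ z)
least x [] = x , here refl , λ { (here refl) → ≤-refl }
least x (w ∷ xs) with least w xs
... | y , y∈ , low with toℕ x ≤? toℕ y
... | yes le = x , here refl , λ { (here refl) → ≤-refl ; (there z∈) → ≤-trans le (low z∈) }
... | no gt = y , there y∈ , λ { (here refl) → <⇒≤ (≰⇒> gt) ; (there z∈) → low z∈ }

module Embedded {n m : ℕ} (G : SimpleGraph n m) where
  open SimpleGraph G

  D : Set
  D = Dart G

  _≟ᵈ_ : DecidableEquality D
  _≟ᵈ_ = ≡-dec F._≟_ BP._≟_

  darts : List D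
  darts = concatMap (λ e → (e , false) ∷ (e , true) ∷ []) (allFin m)

  darts≡ : ∀ (es : List (Fin m)) → concatMap (λ e → (e , false) ∷ (e , true) ∷ []) es ≡ cartesianProduct es (false ∷ true ∷ [])
  darts≡ [] = refl
  darts≡ (e ∷ es) = cong (λ zs → (e , false) ∷ (e , true) ∷ zs) (darts≡ es)

  ∈-darts : ∀ d → d ∈ darts
  ∈-darts (e , b) rewrite darts≡ (allFin m) = ∈-cartesianProduct⁺ (∈-allFin e) (bool b)
    where
    bool : ∀ b → b ∈ false ∷ true ∷ []
    bool false = here refl
    bool true = there (here refl)

  unique-darts : Unique darts
  unique-darts rewrite darts≡ (allFin m) = Uniq.cartesianProduct⁺ (Uniq.allFin⁺ m) (((λ ()) ∷ []) ∷ [] ∷ [])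

  length-darts : length darts ≡ m + m
  length-darts = trans (double (allFin m)) (cong₂ _+_ (length-tabulate {n = m} id) (length-tabulate {n = m} id))
    where
    double : ∀ (es : List (Fin m)) → length (concatMap (λ e → (e , false) ∷ (e , true) ∷ []) es) ≡ length es + length es
    double [] = refl
    double (e ∷ es) = cong suc (trans (cong suc (double es)) (sym (+-suc (length es) (length es))))

  flip² : ∀ (d : D) → flipD G (flipD G d) ≡ d
  flip² (e , false) = refl
  flip² (e , true) = refl

  open Classes _≟ᵈ_ darts ∈-darts unique-darts public
  open Permutations _≟ᵈ_ darts ∈-darts unique-darts public
  open Maps (flipD G) flip² public

  dcode-inj : ∀ {d d′ : D} → dcode G d ≡ dcode G d′ → d ≡ d′
  dcode-inj {e , b} {e′ , b′} eq = go b b′ eq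
    where
    half : ∀ x y → x * 2 + 1 ≢ y * 2 + 0
    half zero zero ()
    half zero (suc y) ()
    half (suc x) zero ()
    half (suc x) (suc y) e = half x y (suc-injective (suc-injective e))
    go : ∀ b b′ → dcode G (e , b) ≡ dcode G (e′ , b′) → (e , b) ≡ (e′ , b′)
    go false false q = cong (_, false) (FP.toℕ-injective (*-cancelʳ-≡ (toℕ e) (toℕ e′) 2 (+-cancelʳ-≡ 0 _ _ q)))
    go true true q = cong (_, true) (FP.toℕ-injective (*-cancelʳ-≡ (toℕ e) (toℕ e′) 2 (+-cancelʳ-≡ 1 _ _ q)))
    go true false q = ⊥-elim (half (toℕ e) (toℕ e′) q)
    go false true q = ⊥-elim (half (toℕ e′) (toℕ e) (sym q))

  -- The edge count remains m: an edge with both darts gone survives as a separate component with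
  -- one edge. The remaining darts with a common tail still form one orbit of σ.
  record Shape (gone : List D) (r : Rotation) : Set where
    open Rotation r
    field
      planar : Planar m r
      tails  : ∀ d → tail G (σ d) ≡ tail G d
      fixed  : ∀ {d} → d ∈ gone → σ d ≡ d
      joined : ∀ {d d′} → d ∉ gone → d′ ∉ gone → tail G d ≡ tail G d′ → Conn (gen σ) d d′

  module Whole (P : PlaneEmbedding G) where
    open PlaneEmbedding P
    module ρ = RotationSystem rotation

    rot : Rotation
    rot = record
      { σ = Inverse.to ρ.σ
      ; σ⁻ = Inverse.from ρ.σ
      ; left = λ x → Inverse.strictlyInverseʳ ρ.σ x
      ; right = λ x → Inverse.strictlyInverseˡ ρ.σ x }

    open Rotation rot

    joined-all : ∀ {d d′} → tail G d ≡ tail G d′ → Conn (gen σ) d d′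
    joined-all {d} {d′} eq with ρ.σ-cyclic d d′ eq
    ... | k , e = subst (Conn (gen σ) d) e (conn-iter σ k d)

    tail-conn : ∀ {d d′} → Conn (gen σ) d d′ → tail G d ≡ tail G d′
    tail-conn ε = refl
    tail-conn (inj₁ p ◅ c) = trans (trans (sym (ρ.σ-tail _)) (cong (tail G) (sym (gen⁻ σ p)))) (tail-conn c)
    tail-conn (inj₂ p ◅ c) = trans (trans (cong (tail G) (gen⁻ σ p)) (ρ.σ-tail _)) (tail-conn c)

    tally-classes : ∀ (p : D → Bool) (ps : List (D × D)) →
      (∀ {d d′} → T (p d) → T (p d′) → Conn ps d d′ → d ≡ d′) → tally p darts ≤ classes ps
    tally-classes p ps inj = subst (_≤ classes ps) (sym (tally-length p darts))
      (classes-inject ps id (unique-select p unique-darts)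
        (λ x y c → inj (proj₂ (∈-select⁻ p {darts} x)) (proj₂ (∈-select⁻ p {darts} y)) c))

    -- Two counted darts of one orbit each have the least code in it, and codes are injective.
    faces-bound : ρ.faces ≤ classes (gen φ)
    faces-bound = tally-classes _ (gen φ) λ {d} {d′} t t′ c →
      dcode-inj (≤-antisym (below d d′ t c) (below d′ d t′ (conn-sym c)))
      where
      below : ∀ d d′ → T (all (λ k → dcode G d ℕ.≤ᵇ dcode G (iter k ρ.φ d)) (upTo (m + m))) →
        Conn (gen φ) d d′ → dcode G d ≤ dcode G d′
      below d d′ t c with conn→iter φ-inj c
      ... | k , eq with iter-bounded φ-inj k d
      ... | j , j< , eq′ = subst (λ z → dcode G d ≤ dcode G z) (trans eq′ eq)
            (≤ᵇ⇒≤ _ _ (All.lookup (all⁺ _ (upTo (m + m)) t) (∈-upTo⁺ (subst (j <_) length-darts j<))))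

    Touched : Fin n → Bool
    Touched v = any (λ e → incidentB G e v) (allFin m)

    touched-dart : ∀ {v} → T (Touched v) → ∃ λ d → tail G d ≡ v
    touched-dart {v} t with T-any (λ e → incidentB G e v) (allFin m) t
    ... | e , _ , i with Equivalence.to (T-∨ {⌊ proj₁ (ends e) F.≟ v ⌋}) i
    ... | inj₁ q = (e , false) , toWitness q
    ... | inj₂ q = (e , true) , toWitness q

    dart-touched : ∀ d → T (Touched (tail G d))
    dart-touched (e , false) = any-T (λ e′ → incidentB G e′ (tail G (e , false))) (∈-allFin e)
      (Equivalence.from (T-∨ {⌊ proj₁ (ends e) F.≟ tail G (e , false) ⌋}) (inj₁ (fromWitness refl)))
    dart-touched (e , true) = any-T (λ e′ → incidentB G e′ (tail G (e , true))) (∈-allFin e)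
      (Equivalence.from (T-∨ {⌊ proj₁ (ends e) F.≟ tail G (e , true) ⌋}) (inj₂ (fromWitness refl)))

    isolatedᵇ : Fin n → Bool
    isolatedᵇ v = not (Touched v)

    T-split : ∀ b → T b ⊎ T (not b)
    T-split true = inj₁ _
    T-split false = inj₂ _

    T-contra : ∀ {b} → T b → T (not b) → ⊥
    T-contra {true} _ ()

    vertices-bound : n ≤ classes (gen σ) + isolated G
    vertices-bound = ≤-trans (≤-reflexive (sym (length-tabulate {n = n} id)))
      (≤-trans (length-⊆ {ys = map (tail G) (reps (gen σ)) ++ select isolatedᵇ (allFin n)} (Uniq.allFin⁺ n) cover)
        (≤-reflexive (trans (length-++ (map (tail G) (reps (gen σ))))
          (cong₂ _+_ (length-map (tail G) (reps (gen σ))) (sym (tally-length isolatedᵇ (allFin n)))))))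
      where
      cover : ∀ {v} → v ∈ allFin n → v ∈ map (tail G) (reps (gen σ)) ++ select isolatedᵇ (allFin n)
      cover {v} v∈ with T-split (Touched v)
      ... | inj₂ t = ∈-++⁺ʳ (map (tail G) (reps (gen σ))) (∈-select⁺ isolatedᵇ v∈ t)
      ... | inj₁ t with touched-dart t
      ... | d , refl = ∈-++⁺ˡ (subst (_∈ map (tail G) (reps (gen σ)))
            (sym (tail-conn (rep-sound (gen σ) d))) (∈-map⁺ (tail G) (reps⁺ (gen σ) (rep-idem (gen σ) d))))

    joint-same : ∀ {d d′} → tail G d ≡ tail G d′ → Conn joint d d′
    joint-same eq = conn-map id (λ p → conn-pair (∈-++⁺ˡ p)) (joined-all eq)

    joint-flip : ∀ d → Conn joint d (flipD G d)
    joint-flip d = conn-pair (∈-++⁺ʳ (gen σ) (gen⁺ (flipD G) d))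

    reach-conn : ∀ k {u v} d → tail G d ≡ u → T (reach G k u v) → ∃ λ d′ → tail G d′ ≡ v × Conn joint d d′
    reach-conn zero d refl t = d , toWitness t , ε
    reach-conn (suc k) {u} {v} d refl t with Equivalence.to (T-∨ {reach G k u v}) t
    ... | inj₁ q = reach-conn k d refl q
    ... | inj₂ q with T-any (λ e → (reach G k u (proj₁ (ends e)) ∧ ⌊ proj₂ (ends e) F.≟ v ⌋) ∨
                           (reach G k u (proj₂ (ends e)) ∧ ⌊ proj₁ (ends e) F.≟ v ⌋)) (allFin m) q
    ... | e , _ , s with Equivalence.to (T-∨ {reach G k u (proj₁ (ends e)) ∧ ⌊ proj₂ (ends e) F.≟ v ⌋}) s
    ... | inj₁ w = let a , b = Equivalence.to (T-∧ {reach G k u (proj₁ (ends e))}) w ; d′ , t′ , c = reach-conn k d refl a in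
          (e , true) , toWitness b , c ◅◅ (joint-same t′ ◅◅ joint-flip (e , false))
    ... | inj₂ w = let a , b = Equivalence.to (T-∧ {reach G k u (proj₂ (ends e))}) w ; d′ , t′ , c = reach-conn k d refl a in
          (e , false) , toWitness b , c ◅◅ (joint-same t′ ◅◅ joint-flip (e , true))

    reach-isolated : ∀ k {u v} → T (isolatedᵇ u) → T (reach G k u v) → u ≡ v
    reach-isolated zero i t = toWitness t
    reach-isolated (suc k) {u} {v} i t with Equivalence.to (T-∨ {reach G k u v}) t
    ... | inj₁ q = reach-isolated k i q
    ... | inj₂ q with T-any (λ e → (reach G k u (proj₁ (ends e)) ∧ ⌊ proj₂ (ends e) F.≟ v ⌋) ∨
                           (reach G k u (proj₂ (ends e)) ∧ ⌊ proj₁ (ends e) F.≟ v ⌋)) (allFin m) q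
    ... | e , _ , s with Equivalence.to (T-∨ {reach G k u (proj₁ (ends e)) ∧ ⌊ proj₂ (ends e) F.≟ v ⌋}) s
    ... | inj₁ w = ⊥-elim (T-contra (subst (λ z → T (Touched z))
          (sym (reach-isolated k i (proj₁ (Equivalence.to (T-∧ {reach G k u (proj₁ (ends e))}) w)))) (dart-touched (e , false))) i)
    ... | inj₂ w = ⊥-elim (T-contra (subst (λ z → T (Touched z))
          (sym (reach-isolated k i (proj₁ (Equivalence.to (T-∧ {reach G k u (proj₂ (ends e))}) w)))) (dart-touched (e , true))) i)

    component-of : D → List (Fin n)
    component-of d = map (tail G) (filter (λ d′ → conn? joint d d′) darts)

    -- The vertex at which `components` counts the component of d.
    low : D → Fin n
    low d = proj₁ (least (tail G d) (component-of d))

    low-dart : ∀ d → ∃ λ d′ → tail G d′ ≡ low d × Conn joint d d′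
    low-dart d with proj₁ (proj₂ (least (tail G d) (component-of d)))
    ... | here eq = d , sym eq , ε
    ... | there p with ∈-map⁻ (tail G) p
    ... | d′ , d′∈ , eq = d′ , sym eq , proj₂ (∈-filter⁻ (λ d′ → conn? joint d d′) {xs = darts} d′∈)

    low-least : ∀ d {d′} → Conn joint d d′ → toℕ (low d) ≤ toℕ (tail G d′)
    low-least d {d′} c = proj₂ (proj₂ (least (tail G d) (component-of d)))
      (there (∈-map⁺ (tail G) (∈-filter⁺ (λ d′ → conn? joint d d′) (∈-darts d′) c)))

    firstᵇ : Fin n → Bool
    firstᵇ v = all (λ u → not (reach G n v u) ∨ (toℕ v ℕ.≤ᵇ toℕ u)) (allFin n)

    first : ∀ v → (∀ u → T (reach G n v u) → toℕ v ≤ toℕ u) → T (firstᵇ v)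
    first v f = all⁻ _ (All.tabulate {xs = allFin n} λ {u} _ → case T-split (reach G n v u) of λ
      { (inj₁ t) → Equivalence.from (T-∨ {not (reach G n v u)}) (inj₂ (≤⇒≤ᵇ (f u t)))
      ; (inj₂ t) → Equivalence.from (T-∨ {not (reach G n v u)}) (inj₁ t) })

    -- A vertex that is least in its component is least among those it reaches, because `reach`
    -- never leaves the component. Isolated vertices carry no darts and add one component each.
    components-bound : classes joint + isolated G ≤ components G
    components-bound = ≤-trans (≤-reflexive (trans (cong₂ _+_ (sym (length-map low (reps joint))) (tally-length isolatedᵇ (allFin n)))
        (sym (length-++ (map low (reps joint))))))
      (≤-trans (length-⊆ u sub) (≤-reflexive (sym (tally-length firstᵇ (allFin n)))))
      where
      inj : ∀ {d d′} → d ∈ reps joint → d′ ∈ reps joint → low d ≡ low d′ → d ≡ d′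
      inj {d} {d′} p q eq with low-dart d | low-dart d′
      ... | a , ta , ca | b , tb , cb = trans (sym (reps⁻ joint p)) (trans
            (rep-complete joint (ca ◅◅ (joint-same (trans ta (trans eq (sym tb))) ◅◅ conn-sym cb))) (reps⁻ joint q))
      u : Unique (map low (reps joint) ++ select isolatedᵇ (allFin n))
      u = Uniq.++⁺ (unique-map low (unique-reps joint) inj) (unique-select isolatedᵇ (Uniq.allFin⁺ n)) disjoint
        where
        disjoint : ∀ {v} → v ∈ map low (reps joint) × v ∈ select isolatedᵇ (allFin n) → ⊥
        disjoint (p , q) with ∈-map⁻ low p
        ... | d , _ , refl with low-dart d
        ... | d′ , t , _ = T-contra (subst (λ z → T (Touched z)) t (dart-touched d′)) (proj₂ (∈-select⁻ isolatedᵇ {allFin n} q))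
      sub : ∀ {v} → v ∈ map low (reps joint) ++ select isolatedᵇ (allFin n) → v ∈ select firstᵇ (allFin n)
      sub {v} p with ∈-++⁻ (map low (reps joint)) p
      ... | inj₂ q = ∈-select⁺ firstᵇ (∈-allFin v) (first v λ w t →
            ≤-reflexive (cong toℕ (reach-isolated n (proj₂ (∈-select⁻ isolatedᵇ {allFin n} q)) t)))
      ... | inj₁ q with ∈-map⁻ low q
      ... | d , _ , refl = ∈-select⁺ firstᵇ (∈-allFin v) (first (low d) λ w t → case low-dart d of λ
            { (a , ta , ca) → case reach-conn n a ta t of λ
              { (b , refl , cb) → low-least d (ca ◅◅ cb) } })

    -- An isolated vertex counts twice on both sides: in n and as the extra summand of the Euler
    -- formula, and as a component with factor 2.
    whole-planar : Planar m rot
    whole-planar = +-cancelʳ-≤ (2 * I) _ _ (begin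
      m + 2 * C + 2 * I           ≡⟨ trans (+-assoc m (2 * C) (2 * I)) (cong (m +_) (sym (*-distribˡ-+ 2 C I))) ⟩
      m + 2 * (C + I)             ≤⟨ +-monoʳ-≤ m (*-monoʳ-≤ 2 components-bound) ⟩
      m + 2 * components G        ≡⟨ sym planar ⟩
      n + ρ.faces + I             ≤⟨ +-monoˡ-≤ I (+-mono-≤ vertices-bound faces-bound) ⟩
      V + I + F + I               ≡⟨ solve 3 (λ v i f → v :+ i :+ f :+ i := v :+ f :+ con 2 :* i) refl V I F ⟩
      V + F + 2 * I ∎)
      where
      open ≤-Reasoning
      I = isolated G
      C = classes joint
      V = classes (gen σ)
      F = classes (gen φ)

    delete : ∀ gone → ∃ (Shape gone)
    delete [] = rot , record { planar = whole-planar ; tails = ρ.σ-tail ; fixed = λ () ; joined = λ _ _ → joined-all }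
    delete (a ∷ gone) with delete gone
    ... | r , s with Rotation.σ r a ≟ᵈ a
    ... | yes e = r , record
          { planar = Shape.planar s ; tails = Shape.tails s
          ; fixed = λ { (here refl) → e ; (there p) → Shape.fixed s p }
          ; joined = λ p q → Shape.joined s (λ x → p (there x)) (λ x → q (there x)) }
    ... | no moves = detached , record
          { planar = detached-planar {m} (Shape.planar s) ; tails = tails′ ; fixed = fixed′
          ; joined = λ p q eq → keeps-conn (λ { refl → p (here refl) }) (λ { refl → q (here refl) })
              (Shape.joined s (λ x → p (there x)) (λ x → q (there x)) eq) }
      where
      open Detach r a moves
      tails′ : ∀ d → tail G (τ d) ≡ tail G d
      tails′ d with τ d | view d
      ... | _ | fixed refl = refl
      ... | _ | skip _ q = trans (Shape.tails s a) (trans (cong (tail G) (sym q)) (Shape.tails s d))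
      ... | _ | same _ _ = Shape.tails s d
      fixed′ : ∀ {d} → d ∈ a ∷ gone → τ d ≡ d
      fixed′ (here refl) = τ-a
      fixed′ {d} (there p) = go (d ≟ᵈ a)
        where
        go : Dec (d ≡ a) → τ d ≡ d
        go (yes refl) = τ-a
        go (no n) = trans (τ-same n (λ q → n (trans (sym (Shape.fixed s p)) q))) (Shape.fixed s p)

-- Finite sums and double counting

infix 5 Σ[_]_
Σ[_]_ : {X : Set} → List X → (X → ℕ) → ℕ
Σ[ xs ] f = foldr (λ x acc → f x + acc) 0 xs

Σ-mono : ∀ {X : Set} (xs : List X) {f g : X → ℕ} → (∀ {x} → x ∈ xs → f x ≤ g x) → Σ[ xs ] f ≤ Σ[ xs ] g
Σ-mono [] le = z≤n
Σ-mono (x ∷ xs) le = +-mono-≤ (le (here refl)) (Σ-mono xs (λ p → le (there p)))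

Σ-cong : ∀ {X : Set} (xs : List X) {f g : X → ℕ} → (∀ {x} → x ∈ xs → f x ≡ g x) → Σ[ xs ] f ≡ Σ[ xs ] g
Σ-cong xs eq = ≤-antisym (Σ-mono xs (λ p → ≤-reflexive (eq p))) (Σ-mono xs (λ p → ≤-reflexive (sym (eq p))))

Σ-+ : ∀ {X : Set} (xs : List X) (f g : X → ℕ) → Σ[ xs ] (λ x → f x + g x) ≡ (Σ[ xs ] f) + (Σ[ xs ] g)
Σ-+ [] f g = refl
Σ-+ (x ∷ xs) f g = trans (cong (f x + g x +_) (Σ-+ xs f g))
  (solve 4 (λ a b c d → a :+ b :+ (c :+ d) := a :+ c :+ (b :+ d)) refl (f x) (g x) (Σ[ xs ] f) (Σ[ xs ] g))

Σ-const : ∀ {X : Set} (xs : List X) k → Σ[ xs ] (λ _ → k) ≡ k * length xs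
Σ-const [] k = sym (*-zeroʳ k)
Σ-const (x ∷ xs) k = trans (cong (k +_) (Σ-const xs k)) (sym (*-suc k (length xs)))

Σ-++ : ∀ {X : Set} (xs ys : List X) f → Σ[ xs ++ ys ] f ≡ (Σ[ xs ] f) + (Σ[ ys ] f)
Σ-++ [] ys f = refl
Σ-++ (x ∷ xs) ys f = trans (cong (f x +_) (Σ-++ xs ys f)) (sym (+-assoc (f x) _ _))

Σ-map : ∀ {X Y : Set} (h : X → Y) (xs : List X) f → Σ[ map h xs ] f ≡ Σ[ xs ] (λ x → f (h x))
Σ-map h [] f = refl
Σ-map h (x ∷ xs) f = cong (f (h x) +_) (Σ-map h xs f)

Σ-⊆ : ∀ {X : Set} {xs ys : List X} f → Unique xs → (∀ {x} → x ∈ xs → x ∈ ys) → Σ[ xs ] f ≤ Σ[ ys ] f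
Σ-⊆ {xs = []} f u sub = z≤n
Σ-⊆ {xs = x ∷ xs} f u sub with ∈-∃++ (sub (here refl))
... | as , bs , refl = ≤-trans (+-monoʳ-≤ (f x) (Σ-⊆ {ys = as ++ bs} f (unique-tail u) sub′)) (≤-reflexive (sym move))
  where
  sub′ : ∀ {y} → y ∈ xs → y ∈ as ++ bs
  sub′ y∈ with ∈-++⁻ as (sub (there y∈))
  ... | inj₁ p = ∈-++⁺ˡ p
  ... | inj₂ (here refl) = ⊥-elim (∷-∉ u y∈)
  ... | inj₂ (there p) = ∈-++⁺ʳ as p
  move : Σ[ as ++ x ∷ bs ] f ≡ f x + (Σ[ as ++ bs ] f)
  move = trans (Σ-++ as (x ∷ bs) f) (trans (solve 3 (λ a x b → a :+ (x :+ b) := x :+ (a :+ b)) refl (Σ[ as ] f) (f x) (Σ[ bs ] f))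
    (cong (f x +_) (sym (Σ-++ as bs f))))

Σ-permute : ∀ {X : Set} (h : X → X) {xs : List X} f → Unique xs → (∀ {x y} → h x ≡ h y → x ≡ y) →
  (∀ {x} → x ∈ xs → h x ∈ xs) → Σ[ xs ] (λ x → f (h x)) ≤ Σ[ xs ] f
Σ-permute h {xs} f u inj into = subst (_≤ Σ[ xs ] f) (Σ-map h xs f)
  (Σ-⊆ f (Uniq.map⁺ inj u) (λ p → let x , x∈ , eq = ∈-map⁻ h p in subst (_∈ xs) (sym eq) (into x∈)))

module Fibres {X Y : Set} (_≟_ : DecidableEquality Y) (ρ : X → Y) where

  fibre : Y → List X → List X
  fibre y = filter (λ x → ρ x ≟ y)

  fibre⁺ : ∀ {y xs x} → x ∈ xs → ρ x ≡ y → x ∈ fibre y xs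
  fibre⁺ {y} = ∈-filter⁺ (λ x → ρ x ≟ y)

  fibre⁻ : ∀ {y xs x} → x ∈ fibre y xs → x ∈ xs × ρ x ≡ y
  fibre⁻ {y} {xs} = ∈-filter⁻ (λ x → ρ x ≟ y) {xs = xs}

  unique-fibre : ∀ {y xs} → Unique xs → Unique (fibre y xs)
  unique-fibre {y} = Uniq.filter⁺ (λ x → ρ x ≟ y)

  private
    ind : Y → ℕ → Y → ℕ
    ind z k y with z ≟ y
    ... | yes _ = k
    ... | no _ = 0

    ind-out : ∀ z k ys → z ∉ ys → Σ[ ys ] (ind z k) ≡ 0
    ind-out z k [] _ = refl
    ind-out z k (y ∷ ys) n with z ≟ y
    ... | yes p = ⊥-elim (n (here p))
    ... | no _ = ind-out z k ys (λ q → n (there q))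

    ind-in : ∀ z k ys → Unique ys → z ∈ ys → Σ[ ys ] (ind z k) ≡ k
    ind-in z k (y ∷ ys) u z∈ with z ≟ y | z∈
    ... | yes refl | _ = trans (cong (k +_) (ind-out z k ys (∷-∉ u))) (+-identityʳ k)
    ... | no n | here p = ⊥-elim (n p)
    ... | no n | there p = ind-in z k ys (unique-tail u) p

    fibre-∷ : ∀ f x xs y → Σ[ fibre y (x ∷ xs) ] f ≡ ind (ρ x) (f x) y + (Σ[ fibre y xs ] f)
    fibre-∷ f x xs y with ρ x ≟ y
    ... | yes _ = refl
    ... | no _ = refl

  Σ-fibres : ∀ f {ys} → Unique ys → ∀ xs → (∀ {x} → x ∈ xs → ρ x ∈ ys) →
    Σ[ ys ] (λ y → Σ[ fibre y xs ] f) ≡ Σ[ xs ] f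
  Σ-fibres f {ys} u [] into = Σ-const ys 0
  Σ-fibres f {ys} u (x ∷ xs) into = trans (Σ-cong ys (λ {y} _ → fibre-∷ f x xs y))
    (trans (Σ-+ ys (ind (ρ x) (f x)) (λ y → Σ[ fibre y xs ] f))
      (cong₂ _+_ (ind-in (ρ x) (f x) ys u (into (here refl))) (Σ-fibres f u xs (λ p → into (there p)))))

-- Discharging in the subgraph with edge set A

module Discharge {n m : ℕ} (G : SimpleGraph n m) (A : List (Fin m)) (uA : Unique A) where
  open SimpleGraph G
  open Embedded G

  _∈ᵉ?_ : (e : Fin m) (B : List (Fin m)) → Dec (e ∈ B)
  e ∈ᵉ? B = any? (e F.≟_) B

  tl hd : D → Fin n
  tl = tail G
  hd d = tail G (flipD G d)

  act : List D
  act = filter (λ d → proj₁ d ∈ᵉ? A) darts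

  act⁺ : ∀ {d} → proj₁ d ∈ A → d ∈ act
  act⁺ {d} = ∈-filter⁺ (λ d → proj₁ d ∈ᵉ? A) (∈-darts d)

  act⁻ : ∀ {d} → d ∈ act → proj₁ d ∈ A
  act⁻ p = proj₂ (∈-filter⁻ (λ d → proj₁ d ∈ᵉ? A) {xs = darts} p)

  unique-act : Unique act
  unique-act = Uniq.filter⁺ (λ d → proj₁ d ∈ᵉ? A) unique-darts

  length-act : length act ≡ length A + length A
  length-act = trans (≤-antisym le ge) (trans (length-++ (map (_, false) A)) (cong₂ _+_ (length-map _ A) (length-map _ A)))
    where
    both : List D
    both = map (_, false) A ++ map (_, true) A
    u : Unique both
    u = Uniq.++⁺ (Uniq.map⁺ (cong proj₁) uA) (Uniq.map⁺ (cong proj₁) uA) λ (p , q) →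
      case ∈-map⁻ (_, false) p of λ { (_ , _ , refl) → case ∈-map⁻ (_, true) q of λ { (_ , _ , ()) } }
    le : length act ≤ length both
    le = length-⊆ unique-act λ
      { {e , false} p → ∈-++⁺ˡ (∈-map⁺ (_, false) (act⁻ p)) ; {e , true} p → ∈-++⁺ʳ (map (_, false) A) (∈-map⁺ (_, true) (act⁻ p)) }
    ge : length both ≤ length act
    ge = length-⊆ u λ p → case ∈-++⁻ (map (_, false) A) p of λ
      { (inj₁ q) → case ∈-map⁻ (_, false) q of λ { (_ , e∈ , refl) → act⁺ e∈ }
      ; (inj₂ q) → case ∈-map⁻ (_, true) q of λ { (_ , e∈ , refl) → act⁺ e∈ } }

  flip-act : ∀ {d} → d ∈ act → flipD G d ∈ act
  flip-act p = act⁺ (act⁻ p)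

  open Fibres F._≟_ tl

  at : Fin n → List D
  at v = fibre v act

  dg : Fin n → ℕ
  dg v = length (at v)

  unique-at : ∀ v → Unique (at v)
  unique-at v = unique-fibre unique-act

  in-at : ∀ {d} → d ∈ act → d ∈ at (tl d)
  in-at p = fibre⁺ p refl

  gone-edges : List (Fin m)
  gone-edges = filter (λ e → ¬? (e ∈ᵉ? A)) (allFin m)

  gone : List D
  gone = map (_, false) gone-edges ++ map (_, true) gone-edges

  gone-edge⁺ : ∀ {e} → e ∉ A → e ∈ gone-edges
  gone-edge⁺ {e} = ∈-filter⁺ (λ e → ¬? (e ∈ᵉ? A)) (∈-allFin e)

  gone-edge⁻ : ∀ {e} → e ∈ gone-edges → e ∉ A
  gone-edge⁻ p = proj₂ (∈-filter⁻ (λ e → ¬? (e ∈ᵉ? A)) {xs = allFin m} p)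

  gone⁺ : ∀ {d} → proj₁ d ∉ A → d ∈ gone
  gone⁺ {e , false} n = ∈-++⁺ˡ (∈-map⁺ (_, false) (gone-edge⁺ n))
  gone⁺ {e , true} n = ∈-++⁺ʳ (map (_, false) gone-edges) (∈-map⁺ (_, true) (gone-edge⁺ n))

  gone⁻ : ∀ {d} → d ∈ gone → proj₁ d ∉ A
  gone⁻ p with ∈-++⁻ (map (_, false) gone-edges) p
  ... | inj₁ q with ∈-map⁻ (_, false) q
  ... | e , e∈ , refl = gone-edge⁻ e∈
  gone⁻ p | inj₂ q with ∈-map⁻ (_, true) q
  ... | e , e∈ , refl = gone-edge⁻ e∈

  unique-gone-edges : Unique gone-edges
  unique-gone-edges = Uniq.filter⁺ (λ e → ¬? (e ∈ᵉ? A)) (Uniq.allFin⁺ m)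

  vertices : List (Fin n)
  vertices = filter (λ v → 0 <? dg v) (allFin n)

  vertices⁺ : ∀ {d} → d ∈ act → tl d ∈ vertices
  vertices⁺ {d} p = ∈-filter⁺ (λ v → 0 <? dg v) (∈-allFin (tl d)) (nonempty (in-at p))
    where
    nonempty : ∀ {X : Set} {x : X} {xs} → x ∈ xs → 0 < length xs
    nonempty (here _) = s≤s z≤n
    nonempty (there _) = s≤s z≤n

  vertices⁻ : ∀ {v} → v ∈ vertices → ∃ λ d → d ∈ act × tl d ≡ v
  vertices⁻ {v} p = go (at v) (λ q → fibre⁻ {v} {act} q) (proj₂ (∈-filter⁻ (λ v → 0 <? dg v) {xs = allFin n} p))
    where
    go : ∀ ds → (∀ {d} → d ∈ ds → d ∈ act × tl d ≡ v) → 0 < length ds → ∃ λ d → d ∈ act × tl d ≡ v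
    go (d ∷ _) f _ = d , f (here refl)

  unique-vertices : Unique vertices
  unique-vertices = Uniq.filter⁺ (λ v → 0 <? dg v) (Uniq.allFin⁺ n)

  tl≢hd : ∀ d → tl d ≢ hd d
  tl≢hd (e , false) = noLoop e
  tl≢hd (e , true) eq = noLoop e (sym eq)

  same-edge : ∀ {d d′} → tl d ≡ tl d′ → hd d ≡ hd d′ → d ≡ d′
  same-edge {e , b} {e′ , b′} p q with edge b b′ p q
    where
    edge : ∀ b b′ → tl (e , b) ≡ tl (e′ , b′) → hd (e , b) ≡ hd (e′ , b′) → e ≡ e′
    edge false false p q = noMulti e e′ (inj₁ (p , q))
    edge true true p q = noMulti e e′ (inj₁ (q , p))
    edge false true p q = noMulti e e′ (inj₂ (p , q))
    edge true false p q = noMulti e e′ (inj₂ (q , p))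
  same-edge {e , false} {e , false} p q | refl = refl
  same-edge {e , true} {e , true} p q | refl = refl
  same-edge {e , false} {e , true} p q | refl = ⊥-elim (noLoop e p)
  same-edge {e , true} {e , false} p q | refl = ⊥-elim (noLoop e (sym p))

  module Count {r : Rotation} (s : Shape gone r) where
    open Rotation r
    open Shape s

    active : ∀ {d} → d ∈ act → d ∉ gone
    active p q = gone⁻ q (act⁻ p)

    σ-act : ∀ {d} → d ∈ act → σ d ∈ act
    σ-act {d} p with proj₁ (σ d) ∈ᵉ? A
    ... | yes q = act⁺ q
    ... | no q = subst (_∈ act) (sym (σ-inj (fixed (gone⁺ q)))) p

    φ-act : ∀ {d} → d ∈ act → φ d ∈ act
    φ-act p = σ-act (flip-act p)

    -- A deleted edge contributes two vertices, one face, one edge and one component.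
    euler : ∀ {e₀} → e₀ ∈ A →
      2 + length A ≤ length (filter (λ d → proj₁ d ∈ᵉ? A) (reps (gen σ))) + length (filter (λ d → proj₁ d ∈ᵉ? A) (reps (gen φ)))
    euler {e₀} e₀∈ = +-cancelʳ-≤ (3 * Q) _ _ (begin
      2 + length A + 3 * Q            ≡⟨ solve 2 (λ a q → con 2 :+ a :+ con 3 :* q := (a :+ q) :+ con 2 :* (con 1 :+ q)) refl (length A) Q ⟩
      (length A + Q) + 2 * suc Q      ≤⟨ +-mono-≤ edges (*-monoʳ-≤ 2 components′) ⟩
      m + 2 * classes joint           ≤⟨ planar ⟩
      classes (gen σ) + classes (gen φ) ≤⟨ +-mono-≤ vertices′ faces′ ⟩
      (VA + (Q + Q)) + (FA + Q)       ≡⟨ solve 3 (λ v f q → v :+ (q :+ q) :+ (f :+ q) := v :+ f :+ con 3 :* q) refl VA FA Q ⟩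
      VA + FA + 3 * Q ∎)
      where
      open ≤-Reasoning
      Q = length gone-edges
      VA = length (filter (λ d → proj₁ d ∈ᵉ? A) (reps (gen σ)))
      FA = length (filter (λ d → proj₁ d ∈ᵉ? A) (reps (gen φ)))
      edges : length A + Q ≤ m
      edges = ≤-trans (≤-reflexive (sym (length-++ A))) (≤-trans
        (length-⊆ (Uniq.++⁺ uA unique-gone-edges (λ (p , q) → gone-edge⁻ q p)) (λ {e} _ → ∈-allFin e))
        (≤-reflexive (length-tabulate {n = m} id)))
      stuck : ∀ {d d′} → Conn joint d d′ → proj₁ d ∉ A → proj₁ d′ ≡ proj₁ d
      stuck ε _ = refl
      stuck (inj₁ p ◅ c) n with ∈-++⁻ (gen σ) p
      ... | inj₁ q with trans (gen⁻ σ q) (fixed (gone⁺ n))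
      ... | refl = stuck c n
      stuck (inj₁ p ◅ c) n | inj₂ q with gen⁻ (flipD G) q
      ... | refl = stuck c n
      stuck {d} (_◅_ {j = d″} (inj₂ p) c) n with ∈-++⁻ (gen σ) p
      ... | inj₂ q with gen⁻ (flipD G) q
      ... | refl = stuck c n
      stuck {d} (_◅_ {j = d″} (inj₂ p) c) n | inj₁ q with σ-inj (trans (sym (gen⁻ σ q)) (sym (fixed (gone⁺ n))))
      ... | refl = stuck c n
      components′ : suc Q ≤ classes joint
      components′ = classes-inject joint (_, false) {e₀ ∷ gone-edges}
        (∷-unique (λ p → gone-edge⁻ p e₀∈) unique-gone-edges) inj
        where
        inj : ∀ {e e′} → e ∈ e₀ ∷ gone-edges → e′ ∈ e₀ ∷ gone-edges → Conn joint (e , false) (e′ , false) → e ≡ e′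
        inj (there p) _ c = sym (stuck c (gone-edge⁻ p))
        inj (here refl) (here refl) c = refl
        inj (here refl) (there q) c = stuck (conn-sym c) (gone-edge⁻ q)
      split : ∀ ps {k} → length (filter (λ d → ¬? (proj₁ d ∈ᵉ? A)) (reps ps)) ≤ k →
        classes ps ≤ length (filter (λ d → proj₁ d ∈ᵉ? A) (reps ps)) + k
      split ps {k} le = ≤-trans (length-⊆ (unique-reps ps) cover) (≤-trans (≤-reflexive (length-++ as)) (+-monoʳ-≤ (length as) le))
        where
        as = filter (λ d → proj₁ d ∈ᵉ? A) (reps ps)
        bs = filter (λ d → ¬? (proj₁ d ∈ᵉ? A)) (reps ps)
        cover : ∀ {d} → d ∈ reps ps → d ∈ as ++ bs
        cover {d} p with proj₁ d ∈ᵉ? A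
        ... | yes q = ∈-++⁺ˡ (∈-filter⁺ (λ d → proj₁ d ∈ᵉ? A) p q)
        ... | no q = ∈-++⁺ʳ as (∈-filter⁺ (λ d → ¬? (proj₁ d ∈ᵉ? A)) p q)
      lost : ∀ ps {d} → d ∈ filter (λ d → ¬? (proj₁ d ∈ᵉ? A)) (reps ps) → d ∈ reps ps × proj₁ d ∉ A
      lost ps = ∈-filter⁻ (λ d → ¬? (proj₁ d ∈ᵉ? A)) {xs = reps ps}
      unique-lost : ∀ ps → Unique (filter (λ d → ¬? (proj₁ d ∈ᵉ? A)) (reps ps))
      unique-lost ps = Uniq.filter⁺ (λ d → ¬? (proj₁ d ∈ᵉ? A)) (unique-reps ps)
      vertices′ : classes (gen σ) ≤ VA + (Q + Q)
      vertices′ = split (gen σ) (≤-trans (length-⊆ {ys = gone} (unique-lost (gen σ)) (λ p → gone⁺ (proj₂ (lost (gen σ) p))))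
        (≤-reflexive (trans (length-++ (map (_, false) gone-edges)) (cong₂ _+_ (length-map _ gone-edges) (length-map _ gone-edges)))))
      faces′ : classes (gen φ) ≤ FA + Q
      faces′ = split (gen φ) (length-inject proj₁ (unique-lost (gen φ)) inj (λ p → gone-edge⁺ (proj₂ (lost (gen φ) p))))
        where
        pair : ∀ {e} → e ∉ A → ∀ b b′ → Conn (gen φ) (e , b) (e , b′)
        pair n false false = ε
        pair n true true = ε
        pair {e} n false true = subst (Conn (gen φ) (e , false)) (fixed (gone⁺ n)) (conn-next φ (e , false))
        pair {e} n true false = subst (Conn (gen φ) (e , true)) (fixed (gone⁺ n)) (conn-next φ (e , true))
        inj : ∀ {d d′} → d ∈ filter (λ d → ¬? (proj₁ d ∈ᵉ? A)) (reps (gen φ)) →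
          d′ ∈ filter (λ d → ¬? (proj₁ d ∈ᵉ? A)) (reps (gen φ)) → proj₁ d ≡ proj₁ d′ → d ≡ d′
        inj {e , b} {_ , b′} p q refl = trans (sym (reps⁻ (gen φ) (proj₁ (lost (gen φ) p))))
          (trans (rep-complete (gen φ) (pair (proj₂ (lost (gen φ) p)) b b′)) (reps⁻ (gen φ) (proj₁ (lost (gen φ) q))))

    vertex-count : length (filter (λ d → proj₁ d ∈ᵉ? A) (reps (gen σ))) ≤ length vertices
    vertex-count = length-inject tl (Uniq.filter⁺ (λ d → proj₁ d ∈ᵉ? A) (unique-reps (gen σ))) inj (λ {d} p → vertices⁺ {d} (act⁺ (proj₂ (kept p))))
      where
      kept : ∀ {d} → d ∈ filter (λ d → proj₁ d ∈ᵉ? A) (reps (gen σ)) → d ∈ reps (gen σ) × proj₁ d ∈ A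
      kept = ∈-filter⁻ (λ d → proj₁ d ∈ᵉ? A) {xs = reps (gen σ)}
      inj : ∀ {d d′} → d ∈ filter (λ d → proj₁ d ∈ᵉ? A) (reps (gen σ)) →
        d′ ∈ filter (λ d → proj₁ d ∈ᵉ? A) (reps (gen σ)) → tl d ≡ tl d′ → d ≡ d′
      inj p q eq = trans (sym (reps⁻ (gen σ) (proj₁ (kept p))))
        (trans (rep-complete (gen σ) (joined (active (act⁺ (proj₂ (kept p)))) (active (act⁺ (proj₂ (kept q)))) eq))
          (reps⁻ (gen σ) (proj₁ (kept q))))

    tl-φ : ∀ d → tl (φ d) ≡ hd d
    tl-φ d = tails (flipD G d)

    -- Degree sum 12 makes the low vertices, of degree at most 5, pairwise non-adjacent; minimum
    -- degree 3 makes every face have length at least 3.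
    module Charges
      (heavy : ∀ {d} → d ∈ act → 12 ≤ dg (tl d) + dg (hd d))
      (deg≥3 : ∀ {d} → d ∈ act → 3 ≤ dg (tl d)) where

      Tri : D → Set
      Tri d = φ (φ (φ d)) ≡ d

      tri? : ∀ d → Dec (Tri d)
      tri? d = φ (φ (φ d)) ≟ᵈ d

      tri-φ⁻ : ∀ {d} → Tri (φ d) → Tri d
      tri-φ⁻ = φ-inj

      tri-φ⁺ : ∀ {d} → Tri d → Tri (φ d)
      tri-φ⁺ = cong φ

      Low : D → Set
      Low d = dg (tl d) ≤ 5

      low? : ∀ d → Dec (Low d)
      low? d = dg (tl d) ≤? 5

      not-both-low : ∀ {d} → d ∈ act → Low d → dg (hd d) ≤ 5 → ⊥
      not-both-low p q q′ = 1+n≰n (≤-trans (≤-trans (heavy p) (+-mono-≤ q q′)) (n≤1+n 10))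

      -- With charges 2ℓ - 6 for faces and d - 6 for vertices, all times 4, a face that is not a triangle
      -- pays 4 to each of its low corners, which are pairwise non-consecutive.
      abstract
        gain : D → ℕ
        gain d with tri? d | low? d
        ... | yes _ | _ = 8
        ... | no _ | yes _ = 4
        ... | no _ | no _ = 8

        gain-tri : ∀ {d} → Tri d → gain d ≡ 8
        gain-tri {d} t with tri? d | low? d
        ... | yes _ | _ = refl
        ... | no n | _ = ⊥-elim (n t)

        gain-high : ∀ {d} → ¬ Low d → gain d ≡ 8
        gain-high {d} h with tri? d | low? d
        ... | yes _ | _ = refl
        ... | no _ | yes l = ⊥-elim (h l)
        ... | no _ | no _ = refl

        gain-low : ∀ {d} → ¬ Tri d → Low d → gain d ≡ 4
        gain-low {d} n l with tri? d | low? d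
        ... | yes t | _ = ⊥-elim (n t)
        ... | no _ | yes _ = refl
        ... | no _ | no h = ⊥-elim (h l)

        gain≥4 : ∀ d → 4 ≤ gain d
        gain≥4 d with tri? d | low? d
        ... | yes _ | _ = s≤s (s≤s (s≤s (s≤s z≤n)))
        ... | no _ | yes _ = ≤-refl
        ... | no _ | no _ = s≤s (s≤s (s≤s (s≤s z≤n)))

        gain≤8 : ∀ d → gain d ≤ 8
        gain≤8 d with tri? d | low? d
        ... | yes _ | _ = ≤-refl
        ... | no _ | yes _ = s≤s (s≤s (s≤s (s≤s z≤n)))
        ... | no _ | no _ = ≤-refl

      gain-pair : ∀ {d} → d ∈ act → 12 ≤ gain d + gain (φ d)
      gain-pair {d} p with low? d
      ... | no h rewrite gain-high {d} h = +-monoʳ-≤ 8 (gain≥4 (φ d))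
      ... | yes l rewrite gain-high {φ d} (λ q → not-both-low p l (subst (λ v → dg v ≤ 5) (tl-φ d) q)) =
            +-monoˡ-≤ 8 (gain≥4 d)

      fixed-degree : ∀ {d} → d ∈ act → σ d ≢ d
      fixed-degree {d} p e = 1+n≰n (≤-trans (deg≥3 p) (≤-trans (length-⊆ {ys = d ∷ []} (unique-at (tl d)) only) (n≤1+n 1)))
        where
        stay : ∀ {x y} → Conn (gen σ) x y → x ≡ d → y ≡ d
        stay ε q = q
        stay (inj₁ a ◅ c) refl = stay c (trans (gen⁻ σ a) e)
        stay (inj₂ a ◅ c) refl = stay c (σ-inj (trans (sym (gen⁻ σ a)) (sym e)))
        only : ∀ {d′} → d′ ∈ at (tl d) → d′ ∈ d ∷ []
        only q = let a , t = fibre⁻ {xs = act} q in here (stay (joined (active p) (active a) (sym t)) refl)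

      φ≢ : ∀ d → φ d ≢ d
      φ≢ d e = tl≢hd d (trans (cong tl (sym e)) (tl-φ d))

      -- In a simple graph a face of length two runs along one edge and back, so the far end would
      -- have degree 1.
      φ²≢ : ∀ {d} → d ∈ act → φ (φ d) ≢ d
      φ²≢ {d} p e = fixed-degree (flip-act p) (same-edge (tl-φ d)
        (trans (sym (tl-φ (φ d))) (trans (cong tl e) (cong tl (sym (flip² d))))))

      -- Here 24 is 4 times 6, the constant of a face. A triangle retains 8 at each of its three
      -- corners; a longer face has four corners in two consecutive pairs, and each pair retains 12.
      face-charge : ∀ {d} → d ∈ act → 24 ≤ Σ[ filter (λ x → rep (gen φ) x ≟ᵈ rep (gen φ) d) act ] gain
      face-charge {d} p with tri? d
      ... | yes t = ≤-trans (≤-reflexive (sym sum)) (Σ-⊆ gain u mem)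
        where
        zs = d ∷ φ d ∷ φ (φ d) ∷ []
        sum : Σ[ zs ] gain ≡ 24
        sum rewrite gain-tri t | gain-tri (tri-φ⁺ t) | gain-tri (tri-φ⁺ (tri-φ⁺ t)) = refl
        u : Unique zs
        u = ((λ e → φ≢ d (sym e)) ∷ (λ e → φ²≢ p (sym e)) ∷ []) ∷ ((λ e → φ≢ (φ d) (sym e)) ∷ []) ∷ [] ∷ []
        keep : ∀ k → iter k φ d ∈ act → iter k φ d ∈ filter (λ x → rep (gen φ) x ≟ᵈ rep (gen φ) d) act
        keep k q = ∈-filter⁺ (λ x → rep (gen φ) x ≟ᵈ rep (gen φ) d) q (sym (rep-complete (gen φ) (conn-iter φ k d)))
        mem : ∀ {x} → x ∈ zs → x ∈ filter (λ x → rep (gen φ) x ≟ᵈ rep (gen φ) d) act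
        mem (here refl) = keep 0 p
        mem (there (here refl)) = keep 1 (φ-act p)
        mem (there (there (here refl))) = keep 2 (φ-act (φ-act p))
      ... | no nt = ≤-trans sum (Σ-⊆ gain u mem)
        where
        zs = d ∷ φ d ∷ φ (φ d) ∷ φ (φ (φ d)) ∷ []
        p₂ = φ-act (φ-act p)
        sum : 24 ≤ Σ[ zs ] gain
        sum = ≤-trans (+-mono-≤ (gain-pair p) (gain-pair p₂)) (≤-reflexive
          (solve 4 (λ a b c d → (a :+ b) :+ (c :+ d) := a :+ (b :+ (c :+ (d :+ con 0)))) refl
            (gain d) (gain (φ d)) (gain (φ (φ d))) (gain (φ (φ (φ d))))))
        u : Unique zs
        u = ((λ e → φ≢ d (sym e)) ∷ (λ e → φ²≢ p (sym e)) ∷ (λ e → nt (sym e)) ∷ []) ∷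
            ((λ e → φ≢ (φ d) (sym e)) ∷ (λ e → φ²≢ (φ-act p) (sym e)) ∷ []) ∷ ((λ e → φ≢ (φ (φ d)) (sym e)) ∷ []) ∷ [] ∷ []
        keep : ∀ k → iter k φ d ∈ act → iter k φ d ∈ filter (λ x → rep (gen φ) x ≟ᵈ rep (gen φ) d) act
        keep k q = ∈-filter⁺ (λ x → rep (gen φ) x ≟ᵈ rep (gen φ) d) q (sym (rep-complete (gen φ) (conn-iter φ k d)))
        mem : ∀ {x} → x ∈ zs → x ∈ filter (λ x → rep (gen φ) x ≟ᵈ rep (gen φ) d) act
        mem (here refl) = keep 0 p
        mem (there (here refl)) = keep 1 (φ-act p)
        mem (there (there (here refl))) = keep 2 p₂
        mem (there (there (there (here refl)))) = keep 3 (φ-act p₂)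

      face-reps : List D
      face-reps = filter (λ d → proj₁ d ∈ᵉ? A) (reps (gen φ))

      module FF = Fibres _≟ᵈ_ (rep (gen φ))

      faces-charge : 24 * length face-reps ≤ Σ[ act ] gain
      faces-charge = begin
        24 * length face-reps                              ≡⟨ sym (Σ-const face-reps 24) ⟩
        Σ[ face-reps ] (λ _ → 24)                          ≤⟨ Σ-mono face-reps each ⟩
        Σ[ face-reps ] (λ d → Σ[ FF.fibre d act ] gain)    ≡⟨ FF.Σ-fibres gain u act into ⟩
        Σ[ act ] gain ∎
        where
        open ≤-Reasoning
        u : Unique face-reps
        u = Uniq.filter⁺ (λ d → proj₁ d ∈ᵉ? A) (unique-reps (gen φ))
        each : ∀ {d} → d ∈ face-reps → 24 ≤ Σ[ FF.fibre d act ] gain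
        each {d} p with ∈-filter⁻ (λ d → proj₁ d ∈ᵉ? A) {xs = reps (gen φ)} p
        ... | q , a = subst (λ z → 24 ≤ Σ[ FF.fibre z act ] gain) (reps⁻ (gen φ) q) (face-charge (act⁺ a))
        stay-act : ∀ {x y} → Conn (gen φ) x y → x ∈ act → y ∈ act
        stay-act c p with conn→iter φ-inj c
        ... | k , refl = go k
          where
          go : ∀ k → iter k φ _ ∈ act
          go zero = p
          go (suc k) = φ-act (go k)
        into : ∀ {d} → d ∈ act → rep (gen φ) d ∈ face-reps
        into {d} p = ∈-filter⁺ (λ d → proj₁ d ∈ᵉ? A) (reps⁺ (gen φ) (rep-idem (gen φ) d))
          (act⁻ (stay-act (rep-sound (gen φ) d) p))

      BothTri : D → Set
      BothTri d = Tri d × Tri (flipD G d)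

      bothTri? : ∀ d → Dec (BothTri d)
      bothTri? d = tri? d ×-dec tri? (flipD G d)

      -- What a low vertex of degree k must obtain per edge. The deficit 4(6 - k) is 8 for k = 4 and
      -- 4 for k = 5, within 4 · 2 and 5 · 1. For k = 3 it is 12, of which 3 · 2 is obtained here
      -- and 6 comes from the pot.
      cost : ℕ → ℕ
      cost k with k ≤? 4
      ... | yes _ = 2
      ... | no _ = 1

      cost≤2 : ∀ k → cost k ≤ 2
      cost≤2 k with k ≤? 4
      ... | yes _ = ≤-refl
      ... | no _ = s≤s z≤n

      abstract
        -- The amount `tl d` receives along d from its neighbour. It is positive only when both
        -- faces at the edge are triangles, which pay nothing.
        give : D → ℕ
        give d with low? d | bothTri? d
        ... | yes _ | yes _ = cost (dg (tl d))
        ... | yes _ | no _ = 0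
        ... | no _ | _ = 0

        give-high : ∀ {d} → ¬ Low d → give d ≡ 0
        give-high {d} h with low? d | bothTri? d
        ... | yes l | _ = ⊥-elim (h l)
        ... | no _ | _ = refl

        give-yes : ∀ {d} → Low d → BothTri d → give d ≡ cost (dg (tl d))
        give-yes {d} l b with low? d | bothTri? d
        ... | yes _ | yes _ = refl
        ... | yes _ | no n = ⊥-elim (n b)
        ... | no n | _ = ⊥-elim (n l)

        give-no : ∀ {d} → ¬ (Low d × BothTri d) → give d ≡ 0
        give-no {d} n with low? d | bothTri? d
        ... | yes l | yes b = ⊥-elim (n (l , b))
        ... | yes _ | no _ = refl
        ... | no _ | _ = refl

      -- d and `σ d` are the corners of `tl d` on the two sides of one edge. A non-triangular corner
      -- pays 4, shared equally by its two edges, so one such side credits the edge with 2, at least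
      -- its cost. With triangles on both sides the neighbour pays the cost. Everything is doubled
      -- to avoid halves.
      corner : ∀ {d} k → d ∈ act → dg (tl d) ≡ k → k ≤ 5 → gain d + gain (σ d) ≤ 16 ∸ 2 * cost k + 2 * give d
      corner {d} k p refl l with bothTri? d
      ... | yes bt = subst (λ z → gain d + gain (σ d) ≤ 16 ∸ 2 * cost k + 2 * z) (sym (give-yes l bt))
            (≤-trans (+-mono-≤ (gain≤8 d) (gain≤8 (σ d)))
            (≤-reflexive (sym (m∸n+n≡m (≤-trans (*-monoʳ-≤ 2 (cost≤2 k)) (s≤s (s≤s (s≤s (s≤s z≤n)))))))))
      ... | no nb = ≤-trans (bound (tri? d) (tri? (flipD G d)))
            (≤-trans (∸-monoʳ-≤ 16 (*-monoʳ-≤ 2 (cost≤2 k))) (m≤m+n _ _))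
        where
        bound : Dec (Tri d) → Dec (Tri (flipD G d)) → gain d + gain (σ d) ≤ 12
        bound (no n) _ rewrite gain-low n l = +-monoʳ-≤ 4 (gain≤8 (σ d))
        bound (yes t) (yes t′) = ⊥-elim (nb (t , t′))
        bound (yes _) (no n) rewrite gain-low {σ d}
          (λ t → n (tri-φ⁻ (subst Tri (cong σ (sym (flip² d))) t))) (subst (λ v → dg v ≤ 5) (sym (tails d)) l) =
          +-monoˡ-≤ 4 (gain≤8 d)

      at⁻ : ∀ {v d} → d ∈ at v → d ∈ act × tl d ≡ v
      at⁻ {v} = fibre⁻ {v} {act}

      σ-at : ∀ {v d} → d ∈ at v → σ d ∈ at v
      σ-at {v} {d} q = let a , t = at⁻ q in fibre⁺ (σ-act a) (trans (tails d) t)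

      -- Around v every corner occurs twice, once as d and once as the successor of the preceding
      -- dart.
      low-corners : ∀ v → dg v ≤ 5 → 2 * (Σ[ at v ] gain) ≤ (16 ∸ 2 * cost (dg v)) * dg v + 2 * (Σ[ at v ] give)
      low-corners v l = begin
        2 * (Σ[ at v ] gain)
          ≡⟨ cong ((Σ[ at v ] gain) +_) (+-identityʳ _) ⟩
        (Σ[ at v ] gain) + (Σ[ at v ] gain)
          ≤⟨ +-monoʳ-≤ (Σ[ at v ] gain) rotate ⟩
        (Σ[ at v ] gain) + (Σ[ at v ] (λ d → gain (σ d)))
          ≡⟨ sym (Σ-+ (at v) gain (λ d → gain (σ d))) ⟩
        Σ[ at v ] (λ d → gain d + gain (σ d))
          ≤⟨ Σ-mono (at v) (λ q → let a , t = at⁻ q in corner (dg v) a (cong dg t) l) ⟩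
        Σ[ at v ] (λ d → K + 2 * give d)
          ≡⟨ Σ-+ (at v) (λ _ → K) (λ d → 2 * give d) ⟩
        (Σ[ at v ] (λ _ → K)) + (Σ[ at v ] (λ d → 2 * give d))
          ≡⟨ cong₂ _+_ (Σ-const (at v) K) (Σ-double (at v)) ⟩
        K * dg v + 2 * (Σ[ at v ] give) ∎
        where
        open ≤-Reasoning
        K = 16 ∸ 2 * cost (dg v)
        Σ-double : ∀ xs → Σ[ xs ] (λ d → 2 * give d) ≡ 2 * (Σ[ xs ] give)
        Σ-double [] = refl
        Σ-double (x ∷ xs) = trans (cong (2 * give x +_) (Σ-double xs)) (sym (*-distribˡ-+ 2 (give x) _))
        rotate : Σ[ at v ] gain ≤ Σ[ at v ] (λ d → gain (σ d))
        rotate = ≤-trans (Σ-⊆ gain (unique-at v) sub) (≤-reflexive (Σ-map σ (at v) gain))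
          where
          sub : ∀ {d} → d ∈ at v → d ∈ map σ (at v)
          sub {d} q = let a , t = at⁻ q in subst (_∈ map σ (at v)) (right d)
            (∈-map⁺ σ (fibre⁺ (back a) (trans (sym (tails (σ⁻ d))) (trans (cong tl (right d)) t))))
            where
            back : d ∈ act → σ⁻ d ∈ act
            back a with proj₁ (σ⁻ d) ∈ᵉ? A
            ... | yes q = act⁺ q
            ... | no q = subst (_∈ act) (trans (sym (right d)) (fixed (gone⁺ q))) a

      Taking : D → Set
      Taking d = dg (hd d) ≤ 5 × BothTri d

      taking? : ∀ d → Dec (Taking d)
      taking? d = (dg (hd d) ≤? 5) ×-dec bothTri? d

      takers : Fin n → List D
      takers v = filter taking? (at v)

      -- The third side of a triangle after a low neighbour ends in a high one.
      takers-half : ∀ v → length (takers v) + length (takers v) ≤ dg v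
      takers-half v = ≤-trans (≤-reflexive (trans (cong (length (takers v) +_) (sym (length-map σ (takers v)))) (sym (length-++ (takers v)))))
        (length-⊆ u sub)
        where
        taker⁻ : ∀ {d} → d ∈ takers v → d ∈ at v × Taking d
        taker⁻ = ∈-filter⁻ taking? {xs = at v}
        ut : Unique (takers v)
        ut = Uniq.filter⁺ taking? (unique-at v)
        apart : ∀ {d} → d ∈ act → Taking d → Taking (σ d) → ⊥
        apart {d} a (l , _ , t) (l′ , _) = not-both-low (φ-act (σ-act a)) (subst (λ v → dg v ≤ 5) (sym (tl-φ (σ d))) l′)
          (subst (λ v → dg v ≤ 5) (sym eq) l)
          where
          eq : hd (φ (σ d)) ≡ hd d
          eq = trans (sym (tl-φ (φ (σ d)))) (cong tl (subst (λ z → φ (φ (σ z)) ≡ flipD G d) (flip² d) t))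
        u : Unique (takers v ++ map σ (takers v))
        u = Uniq.++⁺ ut (Uniq.map⁺ σ-inj ut) λ (p , q) → case ∈-map⁻ σ q of λ
          { (d , d∈ , refl) → apart (proj₁ (at⁻ (proj₁ (taker⁻ d∈)))) (proj₂ (taker⁻ d∈)) (proj₂ (taker⁻ p)) }
        sub : ∀ {d} → d ∈ takers v ++ map σ (takers v) → d ∈ at v
        sub p with ∈-++⁻ (takers v) p
        ... | inj₁ q = proj₁ (taker⁻ q)
        ... | inj₂ q with ∈-map⁻ σ q
        ... | d , d∈ , refl = σ-at (proj₁ (taker⁻ d∈))

      paid : ∀ v k → (∀ {d} → d ∈ at v → dg (hd d) ≤ 5 → cost (dg (hd d)) ≤ k) →
        Σ[ at v ] (λ d → give (flipD G d)) ≤ k * length (takers v)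
      paid v k le = go (at v) le
        where
        go : ∀ xs → (∀ {d} → d ∈ xs → dg (hd d) ≤ 5 → cost (dg (hd d)) ≤ k) →
          Σ[ xs ] (λ d → give (flipD G d)) ≤ k * length (filter taking? xs)
        go [] le = z≤n
        go (d ∷ xs) le = settle (taking? d)
          where
          ih : Σ[ xs ] (λ d → give (flipD G d)) ≤ k * length (filter taking? xs)
          ih = go xs (λ p → le (there p))
          give≤ : dg (hd d) ≤ 5 → give (flipD G d) ≤ cost (dg (hd d))
          give≤ l with bothTri? (flipD G d)
          ... | yes b = ≤-reflexive (give-yes {flipD G d} l b)
          ... | no nb = subst (_≤ cost (dg (hd d))) (sym (give-no {flipD G d} (λ z → nb (proj₂ z)))) z≤n
          settle : Dec (Taking d) → give (flipD G d) + (Σ[ xs ] (λ d → give (flipD G d))) ≤ k * length (filter taking? (d ∷ xs))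
          settle (yes t) = ≤-trans (+-mono-≤ (≤-trans (give≤ (proj₁ t)) (le (here refl) (proj₁ t))) ih)
            (≤-reflexive (trans (sym (*-suc k _)) (cong (λ z → k * length z) (sym (filter-accept taking? {xs = xs} t)))))
          settle (no n) = subst₂ (λ z ys → z + (Σ[ xs ] (λ d → give (flipD G d))) ≤ k * length ys)
            (sym (give-no {flipD G d} λ { (l , t , t′) → n (l , subst Tri (flip² d) t′ , t) }))
            (sym (filter-reject taking? {xs = xs} n)) ih

      degree-3 : ∀ v → Dec (dg v ≡ 3)
      degree-3 v = dg v ℕ.≟ 3

      Feeds : Fin n → D → Set
      Feeds v d = tl d ≡ v × dg (hd d) ≡ 3

      feeds? : ∀ v → Dec (Any (Feeds v) act)
      feeds? v = any? (λ d → (tl d F.≟ v) ×-dec (dg (hd d) ℕ.≟ 3)) act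

      [_]· : {P : Set} → Dec P → ℕ → ℕ
      [ yes _ ]· k = k
      [ no _ ]· k = 0

      feeds-high : ∀ {v} → Any (Feeds v) act → 9 ≤ dg v
      feeds-high {v} q = go act (λ p → p) q
        where
        go : ∀ ds → (∀ {d} → d ∈ ds → d ∈ act) → Any (Feeds v) ds → 9 ≤ dg v
        go (d ∷ ds) sub (here (refl , e)) = +-cancelʳ-≤ 3 9 (dg (tl d)) (subst (λ z → 12 ≤ dg (tl d) + z) e (heavy (sub (here refl))))
        go (d ∷ ds) sub (there q) = go ds (λ p → sub (there p)) q

      -- Every 3-vertex draws 6 from a pot to which each vertex with a neighbour of degree 3 pays 4.
      vertex-charge : ∀ {v} → v ∈ vertices →
        24 + (Σ[ at v ] gain) + (Σ[ at v ] (λ d → give (flipD G d))) + [ feeds? v ]· 4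
          ≤ 12 * dg v + (Σ[ at v ] give) + [ degree-3 v ]· 6
      vertex-charge {v} v∈ with dg v ≤? 5
      ... | yes low = low-case (feeds? v)
        where
        open ≤-Reasoning
        nothing : Σ[ at v ] (λ d → give (flipD G d)) ≡ 0
        nothing = trans (Σ-cong (at v) (λ {d} q → let a , t = at⁻ q in
          give-high {flipD G d} (λ l → not-both-low a (subst (λ z → dg z ≤ 5) (sym t) low) l))) (Σ-const (at v) 0)
        3≤ : 3 ≤ dg v
        3≤ = let d , a , t = vertices⁻ v∈ in subst (λ z → 3 ≤ dg z) t (deg≥3 a)
        -- Degree 3, with the 6 from the pot, and degree 4 balance exactly; degree 5 has 1 to spare.
        arith : ∀ k → dg v ≡ k → 3 ≤ k → k ≤ 5 → ∀ g t → 2 * g ≤ (16 ∸ 2 * cost k) * k + 2 * t → (q : Dec (k ≡ 3)) →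
          24 + g ≤ 12 * k + t + [ q ]· 6
        arith zero _ () _ g t le q
        arith (suc zero) _ (s≤s ()) _ g t le q
        arith (suc (suc zero)) _ (s≤s (s≤s ())) _ g t le q
        arith 3 _ _ _ g t le (yes _) = *-cancelˡ-≤ 2 (≤-trans (≤-reflexive (*-distribˡ-+ 2 24 g)) (≤-trans (+-monoʳ-≤ 48 le)
          (≤-reflexive (solve 1 (λ t → con 48 :+ (con 36 :+ con 2 :* t) := con 2 :* (con 36 :+ t :+ con 6)) refl t))))
        arith 3 _ _ _ g t le (no n) = ⊥-elim (n refl)
        arith 4 _ _ _ g t le (no _) = *-cancelˡ-≤ 2 (≤-trans (≤-reflexive (*-distribˡ-+ 2 24 g)) (≤-trans (+-monoʳ-≤ 48 le)
          (≤-reflexive (solve 1 (λ t → con 48 :+ (con 48 :+ con 2 :* t) := con 2 :* (con 48 :+ t :+ con 0)) refl t))))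
        arith 5 _ _ _ g t le (no _) = *-cancelˡ-≤ 2 (≤-trans (≤-reflexive (*-distribˡ-+ 2 24 g)) (≤-trans (+-monoʳ-≤ 48 le)
          (≤-trans (m≤n+m (48 + (70 + 2 * t)) 2) (≤-reflexive (solve 1 (λ t → con 2 :+ (con 48 :+ (con 70 :+ con 2 :* t)) := con 2 :* (con 60 :+ t :+ con 0)) refl t)))))
        arith (suc (suc (suc (suc (suc (suc k)))))) _ _ (s≤s (s≤s (s≤s (s≤s (s≤s ()))))) g t le q
        low-case : (w : Dec (Any (Feeds v) act)) →
          24 + (Σ[ at v ] gain) + (Σ[ at v ] (λ d → give (flipD G d))) + [ w ]· 4
            ≤ 12 * dg v + (Σ[ at v ] give) + [ degree-3 v ]· 6
        low-case (yes w) = ⊥-elim (1+n≰n (≤-trans (feeds-high w) (≤-trans low (s≤s (s≤s (s≤s (s≤s (s≤s z≤n))))))))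
        low-case (no _) = begin
          24 + (Σ[ at v ] gain) + (Σ[ at v ] (λ d → give (flipD G d))) + 0
            ≡⟨ trans (+-identityʳ _) (trans (cong (24 + (Σ[ at v ] gain) +_) nothing) (+-identityʳ _)) ⟩
          24 + (Σ[ at v ] gain)
            ≤⟨ arith (dg v) refl 3≤ low (Σ[ at v ] gain) (Σ[ at v ] give) (low-corners v low) (degree-3 v) ⟩
          12 * dg v + (Σ[ at v ] give) + [ degree-3 v ]· 6 ∎
      ... | no high = ≤-trans (high-case (feeds? v)) (≤-trans (m≤m+n (12 * dg v) (Σ[ at v ] give)) (m≤m+n _ _))
        where
        high-gain : Σ[ at v ] gain ≡ 8 * dg v
        high-gain = trans (Σ-cong (at v) (λ {d} q → gain-high {d} (λ l → high (subst (λ z → dg z ≤ 5) (proj₂ (at⁻ q)) l)))) (Σ-const (at v) 8)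
        τᵥ = length (takers v)
        half : τᵥ + τᵥ ≤ dg v
        half = takers-half v
        P = Σ[ at v ] (λ d → give (flipD G d))
        P≤2τ : P ≤ 2 * τᵥ
        P≤2τ = paid v 2 (λ {d} _ _ → cost≤2 (dg (hd d)))
        head-bound : ∀ {d} → d ∈ at v → 12 ≤ dg v + dg (hd d)
        head-bound q = let a , t = at⁻ q in subst (λ z → 12 ≤ dg z + _) t (heavy a)
        cost-5 : ∀ {k} → 5 ≤ k → cost k ≤ 1
        cost-5 {k} le with k ≤? 4
        ... | yes p = ⊥-elim (1+n≰n (≤-trans le p))
        ... | no _ = ≤-refl
        7-bound : dg v ≡ 7 → P ≤ τᵥ
        7-bound eq = ≤-trans (paid v 1 (λ q _ → cost-5 (+-cancelˡ-≤ 7 5 _ (subst (λ z → 12 ≤ z + _) eq (head-bound q)))))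
          (≤-reflexive (*-identityˡ τᵥ))
        6-bound : dg v ≡ 6 → P ≤ 0
        6-bound eq = ≤-trans (paid v 0 (λ q l → ⊥-elim (1+n≰n (≤-trans (+-cancelˡ-≤ 6 6 _ (subst (λ z → 12 ≤ z + _) eq (head-bound q))) l)))) ≤-refl
        finish : ∀ {w} → 24 + P + w ≤ 4 * dg v → 24 + (Σ[ at v ] gain) + P + w ≤ 12 * dg v
        finish {w} le = ≤-trans (≤-reflexive (trans (cong (λ z → 24 + z + P + w) high-gain)
            (solve 3 (λ d p w → con 24 :+ con 8 :* d :+ p :+ w := con 8 :* d :+ (con 24 :+ p :+ w)) refl (dg v) P w)))
          (≤-trans (+-monoʳ-≤ (8 * dg v) le) (≤-reflexive (solve 1 (λ d → con 8 :* d :+ con 4 :* d := con 12 :* d) refl (dg v))))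
        halve : ∀ {k} t → t + t ≤ suc (k + k) → t ≤ k
        halve {k} t le with t ≤? k
        ... | yes p = p
        ... | no n = ⊥-elim (1+n≰n (≤-trans (≤-trans (≤-reflexive (cong suc (sym (+-suc k k)))) (+-mono-≤ (≰⇒> n) (≰⇒> n))) le))
        -- Degree 9 has 12 to spend: 4 for the pot and 2 for each of at most 4 takers. From degree
        -- 10 on, takers cost at most the degree d in total, and 28 + d ≤ 4d.
        nine : 9 ≤ dg v → 24 + P + 4 ≤ 4 * dg v
        nine le with m≤n⇒m<n∨m≡n le
        ... | inj₂ eq = subst (λ z → 24 + P + 4 ≤ 4 * z) eq (+-monoˡ-≤ 4 (+-monoʳ-≤ 24
              (≤-trans P≤2τ (*-monoʳ-≤ 2 (halve {4} τᵥ (≤-trans half (≤-reflexive (sym eq))))))))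
        ... | inj₁ gt = ≤-trans (≤-reflexive (solve 1 (λ p → con 24 :+ p :+ con 4 := con 28 :+ p) refl P))
              (≤-trans (+-monoʳ-≤ 28 (≤-trans P≤2τ (≤-trans (≤-reflexive (cong (τᵥ +_) (+-identityʳ τᵥ))) half)))
                (≤-trans (+-monoˡ-≤ (dg v) (≤-trans (m≤m+n 28 2) (*-monoʳ-≤ 3 gt))) (≤-reflexive (solve 1 (λ d → con 3 :* d :+ d := con 4 :* d) refl (dg v)))))
        high-case : (w : Dec (Any (Feeds v) act)) → 24 + (Σ[ at v ] gain) + P + [ w ]· 4 ≤ 12 * dg v
        high-case (yes w) = finish (nine (feeds-high w))
        high-case (no _) = finish (≤-trans (≤-reflexive (+-identityʳ (24 + P))) (small (dg v) refl (≰⇒> high)))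
          where
          -- Degree 6 has nothing to spend and no low neighbour. Degree 7 has 4, and its at most 3
          -- takers have degree 5 and cost 1 each. Degree 8 has 8 for at most 4 takers.
          small : ∀ k → dg v ≡ k → 6 ≤ k → 24 + P ≤ 4 * k
          small 0 _ ()
          small 1 _ (s≤s ())
          small 2 _ (s≤s (s≤s ()))
          small 3 _ (s≤s (s≤s (s≤s ())))
          small 4 _ (s≤s (s≤s (s≤s (s≤s ()))))
          small 5 _ (s≤s (s≤s (s≤s (s≤s (s≤s ())))))
          small 6 eq _ = +-monoʳ-≤ 24 (6-bound eq)
          small 7 eq _ = ≤-trans (+-monoʳ-≤ 24 (≤-trans (7-bound eq) (halve {3} τᵥ (≤-trans half (≤-reflexive eq))))) (n≤1+n 27)
          small 8 eq _ = +-monoʳ-≤ 24 (≤-trans P≤2τ (≤-trans (≤-reflexive (cong (τᵥ +_) (+-identityʳ τᵥ))) (≤-trans half (≤-reflexive eq))))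
          small (suc (suc (suc (suc (suc (suc (suc (suc (suc k))))))))) eq _ =
            ≤-trans (m≤m+n (24 + P) 4) (subst (λ z → 24 + P + 4 ≤ 4 * z) eq (nine (≤-trans (m≤m+n 9 k) (≤-reflexive (sym eq)))))

      Σ-when : ∀ {X : Set} {Q : X → Set} (Q? : ∀ x → Dec (Q x)) xs k → Σ[ xs ] (λ x → [ Q? x ]· k) ≡ k * length (filter Q? xs)
      Σ-when Q? [] k = sym (*-zeroʳ k)
      Σ-when Q? (x ∷ xs) k with Q? x
      ... | yes _ = trans (cong (k +_) (Σ-when Q? xs k)) (sym (*-suc k _))
      ... | no _ = Σ-when Q? xs k

      -- Summed over all vertices, what is given along darts cancels, since flip permutes them, and
      -- the hypothesis covers the pot. What remains is V + F ≤ E, against 2 + E ≤ V + F from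
      -- `euler`.
      discharge : ∀ {e₀} → e₀ ∈ A →
        6 * length (filter degree-3 vertices) ≤ 4 * length (filter feeds? vertices) → ⊥
      discharge e₀∈ pot = 1+n≰n (≤-trans (n≤1+n _) (≤-trans (euler e₀∈) (≤-trans (+-monoˡ-≤ FA vertex-count) few)))
        where
        open ≤-Reasoning
        FA = length face-reps
        Vn = length vertices
        gains = Σ[ act ] gain
        gives = Σ[ act ] give
        back = Σ[ act ] (λ d → give (flipD G d))
        w = 4 * length (filter feeds? vertices)
        u = 6 * length (filter degree-3 vertices)
        spread : ∀ f → Σ[ vertices ] (λ v → Σ[ at v ] f) ≡ Σ[ act ] f
        spread f = Σ-fibres f unique-vertices act (λ {d} → vertices⁺ {d})
        flips : gives ≤ back
        flips = ≤-trans (≤-reflexive (Σ-cong act (λ {d} _ → cong give (sym (flip² d)))))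
          (Σ-permute (flipD G) (λ d → give (flipD G d)) unique-act
            (λ {x} {y} eq → trans (sym (flip² x)) (trans (cong (flipD G) eq) (flip² y))) flip-act)
        left-sum : Σ[ vertices ] (λ v → 24 + (Σ[ at v ] gain) + (Σ[ at v ] (λ d → give (flipD G d))) + [ feeds? v ]· 4)
          ≡ 24 * Vn + gains + back + w
        left-sum = trans (Σ-+ vertices (λ v → 24 + (Σ[ at v ] gain) + (Σ[ at v ] (λ d → give (flipD G d)))) (λ v → [ feeds? v ]· 4))
          (cong₂ _+_ (trans (Σ-+ vertices (λ v → 24 + (Σ[ at v ] gain)) (λ v → Σ[ at v ] (λ d → give (flipD G d))))
            (cong₂ _+_ (trans (Σ-+ vertices (λ _ → 24) (λ v → Σ[ at v ] gain)) (cong₂ _+_ (Σ-const vertices 24) (spread gain)))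
              (spread (λ d → give (flipD G d))))) (Σ-when feeds? vertices 4))
        right-sum : Σ[ vertices ] (λ v → 12 * dg v + (Σ[ at v ] give) + [ degree-3 v ]· 6) ≡ 12 * length act + gives + u
        right-sum = trans (Σ-+ vertices (λ v → 12 * dg v + (Σ[ at v ] give)) (λ v → [ degree-3 v ]· 6))
          (cong₂ _+_ (trans (Σ-+ vertices (λ v → 12 * dg v) (λ v → Σ[ at v ] give))
            (cong₂ _+_ (trans (Σ-cong vertices (λ {v} _ → sym (Σ-const (at v) 12))) (trans (spread (λ _ → 12)) (Σ-const act 12)))
              (spread give))) (Σ-when degree-3 vertices 6))
        total : 24 * Vn + gains + back + w ≤ 12 * length act + gives + u
        total = subst₂ _≤_ left-sum right-sum (Σ-mono vertices (λ p → vertex-charge p))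
        balance : 24 * Vn + gains ≤ 12 * length act
        balance = +-cancelʳ-≤ (back + w) _ _ (begin
          24 * Vn + gains + (back + w)        ≡⟨ sym (+-assoc (24 * Vn + gains) back w) ⟩
          24 * Vn + gains + back + w          ≤⟨ total ⟩
          12 * length act + gives + u         ≡⟨ +-assoc (12 * length act) gives u ⟩
          12 * length act + (gives + u)       ≤⟨ +-monoʳ-≤ (12 * length act) (+-mono-≤ flips pot) ⟩
          12 * length act + (back + w) ∎)
        few : Vn + FA ≤ length A
        few = *-cancelˡ-≤ 24 (begin
          24 * (Vn + FA)                  ≡⟨ *-distribˡ-+ 24 Vn FA ⟩
          24 * Vn + 24 * FA               ≤⟨ +-monoʳ-≤ (24 * Vn) faces-charge ⟩
          24 * Vn + gains                 ≤⟨ balance ⟩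
          12 * length act                 ≡⟨ cong (12 *_) length-act ⟩
          12 * (length A + length A)      ≡⟨ solve 1 (λ a → con 12 :* (a :+ a) := con 24 :* a) refl (length A) ⟩
          24 * length A ∎)

-- Even circuits of G as cycles of the line graph

module LineGraph {n m : ℕ} (G : SimpleGraph n m) where
  open SimpleGraph G

  Inc : Fin m → Fin n → Set
  Inc e v = proj₁ (ends e) ≡ v ⊎ proj₂ (ends e) ≡ v

  inc? : ∀ e v → Dec (Inc e v)
  inc? e v = (proj₁ (ends e) F.≟ v) ⊎-dec (proj₂ (ends e) F.≟ v)

  Joins : Fin m → Fin n → Fin n → Set
  Joins e p q = (proj₁ (ends e) ≡ p × proj₂ (ends e) ≡ q) ⊎ (proj₁ (ends e) ≡ q × proj₂ (ends e) ≡ p)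

  joins-sym : ∀ {e p q} → Joins e p q → Joins e q p
  joins-sym (inj₁ x) = inj₂ x
  joins-sym (inj₂ x) = inj₁ x

  joins-inc : ∀ {e p q} → Joins e p q → Inc e p
  joins-inc (inj₁ (x , _)) = inj₁ x
  joins-inc (inj₂ (_ , x)) = inj₂ x

  inc-joins : ∀ {e p q v} → Joins e p q → Inc e v → v ≡ p ⊎ v ≡ q
  inc-joins (inj₁ (refl , refl)) (inj₁ x) = inj₁ (sym x)
  inc-joins (inj₁ (refl , refl)) (inj₂ x) = inj₂ (sym x)
  inc-joins (inj₂ (refl , refl)) (inj₁ x) = inj₂ (sym x)
  inc-joins (inj₂ (refl , refl)) (inj₂ x) = inj₁ (sym x)

  other-end : ∀ {e p} → Inc e p → ∃ λ q → Joins e p q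
  other-end {e} (inj₁ x) = proj₂ (ends e) , inj₁ (x , refl)
  other-end {e} (inj₂ x) = proj₁ (ends e) , inj₂ (refl , x)

  joins-≢ : ∀ {e p q} → Joins e p q → p ≢ q
  joins-≢ {e} (inj₁ (refl , refl)) = noLoop e
  joins-≢ {e} (inj₂ (refl , refl)) eq = noLoop e (sym eq)

  joins-unique : ∀ {e f p q} → Joins e p q → Joins f p q → e ≡ f
  joins-unique (inj₁ (refl , refl)) (inj₁ (x , y)) = noMulti _ _ (inj₁ (sym x , sym y))
  joins-unique (inj₁ (refl , refl)) (inj₂ (x , y)) = noMulti _ _ (inj₂ (sym y , sym x))
  joins-unique (inj₂ (refl , refl)) (inj₁ (x , y)) = noMulti _ _ (inj₂ (sym y , sym x))
  joins-unique (inj₂ (refl , refl)) (inj₂ (x , y)) = noMulti _ _ (inj₁ (sym x , sym y))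

  Adj : Fin m → Fin m → Set
  Adj = LineAdj G

  adj-sym : ∀ {e f} → Adj e f → Adj f e
  adj-sym (n , v , x , y) = (λ eq → n (sym eq)) , v , y , x

  irr : ∀ {e} → ¬ Adj e e
  irr (n , _) = n refl

  adj? : ∀ e f → Dec (Adj e f)
  adj? e f with e F.≟ f
  ... | yes eq = no λ (n , _) → n eq
  ... | no ne with inc? f (proj₁ (ends e)) | inc? f (proj₂ (ends e))
  ... | yes q | _ = yes (ne , _ , inj₁ refl , q)
  ... | no _ | yes q = yes (ne , _ , inj₂ refl , q)
  ... | no q₁ | no q₂ = no λ { (_ , v , inj₁ refl , y) → q₁ y ; (_ , v , inj₂ refl , y) → q₂ y }

  meet : ∀ {e f v} → e ≢ f → Inc e v → Inc f v → Adj e f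
  meet ne x y = ne , _ , x , y

  not-adj : ∀ {e f p q p′ q′} → Joins e p q → Joins f p′ q′ → p ≢ p′ → p ≢ q′ → q ≢ p′ → q ≢ q′ → ¬ Adj e f
  not-adj j j′ a b c d (_ , v , x , y) with inc-joins j x | inc-joins j′ y
  ... | inj₁ refl | inj₁ r = a r
  ... | inj₁ refl | inj₂ r = b r
  ... | inj₂ refl | inj₁ r = c r
  ... | inj₂ refl | inj₂ r = d r

  open Cycles F._≟_ Adj adj? adj-sym irr public

  record Circuit (p : ℕ → Fin n) (h : ℕ → Fin m) (e : ℕ) : Set where
    field
      e≥3   : 3 ≤ e
      per-p : ∀ i → p (i + suc e) ≡ p i
      per-h : ∀ i → h (i + suc e) ≡ h i
      apart : ∀ i t → 0 < t → t ≤ e → p i ≢ p (i + t)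
      joins : ∀ i → Joins (h i) (p i) (p (suc i))
      even  : even? (suc e) ≡ true

  module _ {p : ℕ → Fin n} {h : ℕ → Fin m} {e : ℕ} (C : Circuit p h e) where
    open Circuit C

    shift-circuit : ∀ s → Circuit (λ i → p (s + i)) (λ i → h (s + i)) e
    shift-circuit s = record
      { e≥3 = e≥3
      ; per-p = λ i → trans (cong p (sym (+-assoc s i (suc e)))) (per-p (s + i))
      ; per-h = λ i → trans (cong h (sym (+-assoc s i (suc e)))) (per-h (s + i))
      ; apart = λ i t a b eq → apart (s + i) t a b (trans eq (cong p (sym (+-assoc s i t))))
      ; joins = λ i → subst (Joins (h (s + i)) (p (s + i))) (cong p (sym (+-suc s i))) (joins (s + i))
      ; even = even }

    distinct : ∀ {i j} → i < j → j ≤ i + e → p i ≢ p j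
    distinct {i} {j} lt le eq = apart i (j ∸ i) (m<n⇒0<n∸m lt) (m≤n+o⇒m∸n≤o j i le)
      (trans eq (cong p (sym (m+[n∸m]≡n (<⇒≤ lt)))))

    private
      far : ∀ i t → 1 ≤ t → suc t ≤ e → p i ≢ p (i + t) × p i ≢ p (suc (i + t)) × p (suc i) ≢ p (suc (i + t))
      far i t a b = apart i t a (<⇒≤ b) , (λ eq → apart i (suc t) (s≤s z≤n) b (trans eq (cong p (sym (+-suc i t))))) ,
        apart (suc i) t a (<⇒≤ b)

      step-back : ∀ i t → 2 ≤ t → t ≤ e → p (suc i) ≢ p (i + t)
      step-back i (suc t) (s≤s a) b eq = apart (suc i) t a (<⇒≤ b) (trans eq (cong p (+-suc i t)))

    -- Edges of a circuit meet only when consecutive, so its edges form an induced cycle of the line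
    -- graph, whatever chords the circuit has in G.
    circuit-cycle : Cycle h e
    circuit-cycle = record
      { e≥3 = e≥3 ; period = per-h ; inj = inj′ ; link = link′ ; chord = chord′ ; even = even }
      where
      inj′ : ∀ i t → 0 < t → t ≤ e → h i ≢ h (i + t)
      inj′ i t a b eq with inc-joins (joins (i + t)) (subst (λ z → Inc z (p i)) eq (joins-inc (joins i)))
      ... | inj₁ q = apart i t a b q
      ... | inj₂ q with inc-joins (joins (i + t)) (subst (λ z → Inc z (p (suc i))) eq (joins-inc (joins-sym (joins i))))
      ... | inj₂ q′ = apart (suc i) t a b q′
      ... | inj₁ q′ with m≤n⇒m<n∨m≡n a
      ... | inj₁ lt = step-back i t lt b q′
      ... | inj₂ refl = apart i 2 (s≤s z≤n) (<⇒≤ e≥3) (trans q (cong p (sym (+-suc i 1))))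
      link′ : ∀ i → Adj (h i) (h (suc i))
      link′ i = meet (λ eq → inj′ i 1 (s≤s z≤n) (≤-trans (s≤s z≤n) e≥3) (trans eq (cong h (+-comm 1 i))))
        (joins-inc (joins-sym (joins i))) (joins-inc (joins (suc i)))
      chord′ : ∀ i t → 2 ≤ t → t < e → ¬ Adj (h i) (h (i + t))
      chord′ i t a b = let x , y , z = far i t (<⇒≤ a) b in
        not-adj (joins i) (joins (i + t)) x y (step-back i t a (<⇒≤ b)) z

    edges : List (Fin m)
    edges = applyUpTo h (suc e)

    round : Round h e edges
    round = record
      { cycle = circuit-cycle
      ; on = λ v∈ → let i , _ , eq = ∈-applyUpTo⁻ h v∈ in i , eq
      ; into = λ i → let j , j≤ , f = reduce circuit-cycle i in subst (_∈ edges) (sym (f 0)) (∈-applyUpTo⁺ h (s≤s j≤)) }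

    reduce-p : ∀ i → ∃ λ j → j ≤ e × p i ≡ p j
    reduce-p i = i % suc e , ≤-pred (m%n<n i (suc e)) ,
        trans (cong p (m≡m%n+[m/n]*n i (suc e))) (go (i / suc e) (i % suc e))
      where
      go : ∀ k i → p (i + k * suc e) ≡ p i
      go zero i = cong p (+-identityʳ i)
      go (suc k) i = trans (cong p (trans (cong (i +_) (+-comm (suc e) (k * suc e))) (sym (+-assoc i (k * suc e) (suc e)))))
        (trans (per-p (i + k * suc e)) (go k i))

    on-circuit? : ∀ v → Dec (∃ λ i → i ≤ e × v ≡ p i)
    on-circuit? v with search< (λ i → v F.≟ p i) (suc e)
    ... | inj₁ (i , lt , eq) = yes (i , ≤-pred lt , eq)
    ... | inj₂ none = no λ (i , le , eq) → none (s≤s le) eq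

    prev : ∀ i → Joins (h (i + e)) (p (i + e)) (p i)
    prev i = subst (Joins (h (i + e)) (p (i + e))) (trans (cong p (sym (+-suc i e))) (per-p i)) (joins (i + e))

  -- Closing a path: positions are read modulo suc e.
  module Close (e : ℕ) (q : ℕ → Fin n) (y : ℕ → Fin m) (g : Fin m) (e≥2 : 2 ≤ e)
    (distinct-q : ∀ {i j} → i < j → j ≤ e → q i ≢ q j)
    (joins-y : ∀ {i} → i < e → Joins (y i) (q i) (q (suc i))) (joins-g : Joins g (q e) (q 0))
    (side : Fin n → Bool) (crosses : ∀ {i} → i < e → side (q (suc i)) ≡ not (side (q i))) (crosses-g : side (q 0) ≡ not (side (q e))) where

    -- The remainder modulo `suc e`, defined along successors so that each step shows whether the
    -- index wraps around.
    res : ℕ → ℕ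
    res zero = zero
    res (suc j) with res j ℕ.≟ e
    ... | yes _ = zero
    ... | no _ = suc (res j)

    res≤ : ∀ j → res j ≤ e
    res≤ zero = z≤n
    res≤ (suc j) with res j ℕ.≟ e
    ... | yes _ = z≤n
    ... | no n = ≤∧≢⇒< (res≤ j) n

    res-next : ∀ {i j} → res i ≡ res j → res (suc i) ≡ res (suc j)
    res-next {i} {j} eq with res i ℕ.≟ e | res j ℕ.≟ e
    ... | yes _ | yes _ = refl
    ... | no _ | no _ = cong suc eq
    ... | yes x | no n = ⊥-elim (n (trans (sym eq) x))
    ... | no n | yes x = ⊥-elim (n (trans eq x))

    res-from : ∀ k t → res k ≡ 0 → t ≤ e → res (t + k) ≡ t
    res-from k zero z _ = z
    res-from k (suc t) z le with res (t + k) ℕ.≟ e | res-from k t z (<⇒≤ le)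
    ... | yes x | r = ⊥-elim (<-irrefl (trans (sym r) x) le)
    ... | no _ | r = cong suc r

    res-wrap : ∀ k → res k ≡ 0 → res (suc e + k) ≡ 0
    res-wrap k z with res (e + k) ℕ.≟ e
    ... | yes _ = refl
    ... | no n = ⊥-elim (n (res-from k e z ≤-refl))

    res-period : ∀ i → res (i + suc e) ≡ res i
    res-period zero = trans (cong res (sym (+-identityʳ (suc e)))) (res-wrap 0 refl)
    res-period (suc i) = res-next {i + suc e} {i} (res-period i)

    res-zero : ∀ k → res (k * suc e) ≡ 0
    res-zero zero = refl
    res-zero (suc k) = res-wrap (k * suc e) (res-zero k)

    res-same : ∀ s {i j} → res i ≡ res j → res (s + i) ≡ res (s + j)
    res-same zero eq = eq
    res-same (suc s) {i} {j} eq = res-next {s + i} {s + j} (res-same s eq)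

    -- Adding `i * e` carries i to a multiple of the length, after which the residue of the second
    -- index is t itself.
    res-apart : ∀ i t → 0 < t → t ≤ e → res i ≢ res (i + t)
    res-apart i t a b eq = <-irrefl (sym (trans (sym (trans (cong res reorder) (res-from (i * suc e) t (res-zero i) b)))
        (trans (sym (res-same (i * e) eq)) (trans (cong res whole) (res-zero i))))) a
      where
      whole : i * e + i ≡ i * suc e
      whole = trans (+-comm (i * e) i) (sym (*-suc i e))
      reorder : i * e + (i + t) ≡ t + i * suc e
      reorder = trans (sym (+-assoc (i * e) i t)) (trans (+-comm (i * e + i) t) (cong (t +_) whole))

    p : ℕ → Fin n
    p i = q (res i)

    edge : ℕ → Fin m
    edge j with j ℕ.≟ e
    ... | yes _ = g
    ... | no _ = y j

    h : ℕ → Fin m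
    h i = edge (res i)

    edge-joins : ∀ i → Joins (h i) (p i) (p (suc i))
    edge-joins i with res i ℕ.≟ e
    ... | yes x = subst (λ z → Joins g (q z) (q 0)) (sym x) joins-g
    ... | no ne = joins-y (≤∧≢⇒< (res≤ i) ne)

    crosses-p : ∀ i → side (p (suc i)) ≡ not (side (p i))
    crosses-p i with res i ℕ.≟ e
    ... | yes x = trans crosses-g (cong (λ z → not (side (q z))) (sym x))
    ... | no ne = crosses (≤∧≢⇒< (res≤ i) ne)

    parity : ∀ i → side (p i) ≡ (if even? i then side (p 0) else not (side (p 0)))
    parity zero = refl
    parity (suc i) rewrite crosses-p i | parity i with even? i | side (p 0)
    ... | true | _ = refl
    ... | false | true = refl
    ... | false | false = refl

    -- Every edge changes sides, and after `suc e` edges the closed path is on its first side again.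
    even-length : even? (suc e) ≡ true
    even-length with even? (suc e) | parity (suc e) | trans (cong res (sym (+-identityʳ (suc e)))) (res-wrap 0 refl)
    ... | true | _ | _ = refl
    ... | false | s | z = ⊥-elim (not-fixed _ (trans (cong (λ k → side (q k)) (sym z)) s))
      where
      not-fixed : ∀ b → b ≢ not b
      not-fixed true ()
      not-fixed false ()

    three : ∀ e → 2 ≤ e → even? (suc e) ≡ true → 3 ≤ e
    three (suc (suc zero)) _ ()
    three (suc (suc (suc e))) _ _ = s≤s (s≤s (s≤s z≤n))
    three (suc zero) (s≤s ()) _

    q-apart : ∀ {a b} → a ≤ e → b ≤ e → a ≢ b → q a ≢ q b
    q-apart {a} {b} la lb ne with <-cmp a b
    ... | tri< lt _ _ = distinct-q lt lb
    ... | tri≈ _ eq _ = ⊥-elim (ne eq)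
    ... | tri> _ _ gt = λ eq → distinct-q gt la (sym eq)

    circuit : Circuit p h e
    circuit = record
      { e≥3 = three e e≥2 even-length
      ; per-p = λ i → cong q (res-period i)
      ; per-h = λ i → cong edge (res-period i)
      ; apart = λ i t a b → q-apart (res≤ i) (res≤ (i + t)) (res-apart i t a b)
      ; joins = edge-joins
      ; even = even-length }

    p-window : ∀ {i} → i ≤ e → p i ≡ q i
    p-window {i} le = cong q (trans (cong res (sym (+-identityʳ i))) (res-from 0 i refl le))

    edge-∈ : ∀ {P : Fin m → Set} → (∀ {i} → i < e → P (y i)) → P g → ∀ i → P (h i)
    edge-∈ py pg i with res i ℕ.≟ e
    ... | yes _ = pg
    ... | no ne = py (≤∧≢⇒< (res≤ i) ne)

-- Finding a configuration or bounding the number of edges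

module Extraction {n m : ℕ} (G : SimpleGraph n m) (L : Fin m → List ℕ) (uL : ∀ v → Unique (L v)) where
  open LineGraph G
  open Reduction F._≟_ Adj adj? adj-sym irr L uL

  module Within (k : ℕ) (A S : List (Fin m)) (S⊆A : ∀ {e} → e ∈ S → e ∈ A)
    (bounded : ∀ {e} → e ∈ S → length (nbrs A e) ≤ k)
    (side : Fin n → Bool) (crosses : ∀ {e p q} → e ∈ S → Joins e p q → side q ≡ not (side p)) where

    ordered-along : ∀ (h : ℕ → Fin m) count seen → (∃ λ u → u ∈ seen × Adj u (h 0)) →
      (∀ i → Adj (h i) (h (suc i))) → Ordered seen (applyUpTo h count)
    ordered-along h zero seen _ _ = []
    ordered-along h (suc count) seen first next =
      first ∷ ordered-along (λ i → h (suc i)) count (h 0 ∷ seen) (h 0 , here refl , next 0) (λ i → next (suc i))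

    -- A path leaving the circuit at p 0 whose last vertex q (suc l) is joined by g back to the circuit or to the path.
    module Lollipop {p : ℕ → Fin n} {h : ℕ → Fin m} {e : ℕ} (C : Circuit p h e) (h∈ : ∀ i → h i ∈ S)
      (l : ℕ) (l≥1 : 1 ≤ l) (q : ℕ → Fin n) (y : ℕ → Fin m) (start : q 0 ≡ p 0)
      (distinct-q : ∀ {i j} → i < j → j ≤ suc l → q i ≢ q j)
      (off : ∀ {i} → 1 ≤ i → i ≤ suc l → ∀ j → q i ≢ p j)
      (joins-y : ∀ {i} → i ≤ l → Joins (y i) (q i) (q (suc i))) (y∈ : ∀ {i} → i ≤ l → y i ∈ S)
      {g : Fin m} {r : Fin n} (g∈ : g ∈ S) (joins-g : Joins g (q (suc l)) r)
      (lands : (∃ λ j → r ≡ p j) ⊎ (∃ λ i → suc i < l × r ≡ q (suc i))) where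

      open Circuit C

      ys : ℕ → List (Fin m)
      ys zero = []
      ys (suc i) = y i ∷ ys i

      ∈-ys⁻ : ∀ i {v} → v ∈ ys i → ∃ λ j → j < i × v ≡ y j
      ∈-ys⁻ (suc i) (here refl) = i , ≤-refl , refl
      ∈-ys⁻ (suc i) (there v∈) = let j , lt , eq = ∈-ys⁻ i v∈ in j , m≤n⇒m≤1+n lt , eq

      ∈-ys⁺ : ∀ {i j} → j < i → y j ∈ ys i
      ∈-ys⁺ {suc i} {j} lt with m≤n⇒m<n∨m≡n (≤-pred lt)
      ... | inj₁ lt′ = there (∈-ys⁺ lt′)
      ... | inj₂ refl = here refl

      y-inj : ∀ {i j} → i < j → j ≤ l → y i ≢ y j
      y-inj {i} {j} lt le eq with inc-joins (joins-y (≤-trans (<⇒≤ lt) le)) (subst (λ z → Inc z (q (suc j))) (sym eq) (joins-inc (joins-sym (joins-y le))))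
      ... | inj₁ x = distinct-q (≤-trans lt (n≤1+n j)) (s≤s le) (sym x)
      ... | inj₂ x = distinct-q (s≤s lt) (s≤s le) (sym x)

      y≢h : ∀ {i} → i ≤ l → ∀ j → y i ≢ h j
      y≢h {i} le j eq with inc-joins (joins j) (subst (λ z → Inc z (q (suc i))) eq (joins-inc (joins-sym (joins-y le))))
      ... | inj₁ x = off (s≤s z≤n) (s≤s le) j x
      ... | inj₂ x = off (s≤s z≤n) (s≤s le) (suc j) x

      g≢h : ∀ j → g ≢ h j
      g≢h j eq with inc-joins (joins j) (subst (λ z → Inc z (q (suc l))) eq (joins-inc joins-g))
      ... | inj₁ x = off (s≤s z≤n) ≤-refl j x
      ... | inj₂ x = off (s≤s z≤n) ≤-refl (suc j) x

      r≢last : r ≢ q l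
      r≢last = [ (λ (j , r≡) eq → off l≥1 (n≤1+n l) j (trans (sym eq) r≡)) ,
                 (λ (i , lt , r≡) eq → distinct-q lt (n≤1+n l) (trans (sym r≡) eq)) ]′ lands

      g≢y : ∀ {i} → i ≤ l → g ≢ y i
      g≢y {i} le eq with inc-joins (joins-y le) (subst (λ z → Inc z (q (suc l))) eq (joins-inc joins-g))
      ... | inj₁ x = distinct-q (s≤s le) ≤-refl (sym x)
      ... | inj₂ x with m≤n⇒m<n∨m≡n le
      ... | inj₁ lt = distinct-q (s≤s lt) ≤-refl (sym x)
      ... | inj₂ refl with inc-joins (joins-y le) (subst (λ z → Inc z r) eq (joins-inc (joins-sym joins-g)))
      ... | inj₁ z = r≢last z
      ... | inj₂ z = joins-≢ joins-g (sym z)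

      unique-ys : ∀ {i} → i ≤ suc l → Unique (ys i)
      unique-ys {zero} _ = []
      unique-ys {suc i} le = ∷-unique (λ v∈ → let j , lt , eq = ∈-ys⁻ i v∈ in y-inj lt (≤-pred le) (sym eq)) (unique-ys (<⇒≤ le))

      unique-edges : Unique (edges C)
      unique-edges = Uniq.applyUpTo⁺₁ h (suc e) λ {i} {j} lt le eq →
        <-irrefl (inj-window (round C) (≤-trans (<⇒≤ lt) (≤-pred le)) (≤-pred le) eq) lt

      D : List (Fin m)
      D = ys (suc l) ++ edges C

      ∈-D⁻ : ∀ {v} → v ∈ D → (∃ λ i → i ≤ l × v ≡ y i) ⊎ (∃ λ i → v ≡ h i)
      ∈-D⁻ v∈ with ∈-++⁻ (ys (suc l)) v∈
      ... | inj₁ x = let j , lt , eq = ∈-ys⁻ (suc l) x in inj₁ (j , ≤-pred lt , eq)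
      ... | inj₂ x = let j , _ , eq = ∈-applyUpTo⁻ h x in inj₂ (j , eq)

      y-D : ∀ {i} → i ≤ l → y i ∈ D
      y-D le = ∈-++⁺ˡ (∈-ys⁺ (s≤s le))

      h-D : ∀ i → h i ∈ D
      h-D i = ∈-++⁺ʳ (ys (suc l)) (Round.into (round C) i)

      D⊆S : ∀ {v} → v ∈ D → v ∈ S
      D⊆S v∈ with ∈-D⁻ v∈
      ... | inj₁ (i , le , refl) = y∈ le
      ... | inj₂ (i , refl) = h∈ i

      unique-D : Unique (g ∷ D)
      unique-D = ∷-unique g∉ (Uniq.++⁺ (unique-ys ≤-refl) unique-edges cross)
        where
        g∉ : g ∉ D
        g∉ v∈ with ∈-D⁻ v∈
        ... | inj₁ (i , le , eq) = g≢y le eq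
        ... | inj₂ (i , eq) = g≢h i eq
        cross : ∀ {v} → v ∈ ys (suc l) × v ∈ edges C → ⊥
        cross (a , b) with ∈-ys⁻ (suc l) a | ∈-applyUpTo⁻ h b
        ... | i , lt , refl | j , _ , eq = y≢h (≤-pred lt) j eq

      adj-y : ∀ {i} → suc i ≤ l → Adj (y (suc i)) (y i)
      adj-y le = meet (λ eq → y-inj ≤-refl le (sym eq)) (joins-inc (joins-y le)) (joins-inc (joins-sym (joins-y (<⇒≤ le))))

      ordered-down : ∀ i seen → i ≤ l → y i ∈ seen → Ordered seen (ys i ++ edges C)
      ordered-down zero seen le y∈seen = ordered-along h (suc e) seen
        (y 0 , y∈seen , meet (y≢h z≤n 0) (subst (Inc (y 0)) start (joins-inc (joins-y z≤n))) (joins-inc (joins 0)))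
        (Cycle.link (circuit-cycle C))
      ordered-down (suc i) seen le y∈seen = (y (suc i) , y∈seen , adj-y le) ∷ ordered-down i (y i ∷ seen) (<⇒≤ le) (here refl)

      configuration : Configuration k A
      configuration = record
        { f = g ; d = y l ; ds = ys l ++ edges C
        ; f∈ = S⊆A g∈ ; ds⊆ = λ v∈ → S⊆A (D⊆S v∈)
        ; uds = unique-D
        ; bounded = λ { (here refl) → bounded g∈ ; (there v∈) → bounded (D⊆S v∈) }
        ; f~d = g~y
        ; ordered = ordered-down l (y l ∷ []) ≤-refl (here refl)
        -- Inside the set g sees `y l` and two edges at its landing vertex. Both ends of `y l` lie
        -- off the circuit because l ≥ 1, so it sees only g and the edge before it.
        ; fs = y l ∷ proj₁ two ∷ proj₁ (proj₂ two) ∷ [] ; ns = g ∷ y (l ∸ 1) ∷ []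
        ; ufs = ufs ; fs⊆ = fs⊆ ; ns⊇ = ns⊇ ; more = ≤-refl
        ; H = edges C ; h = h ; e = e ; round = round C ; H⊆ = ∈-++⁺ʳ (ys (suc l)) }
        where
        g~y : Adj g (y l)
        g~y = meet (g≢y ≤-refl) (joins-inc joins-g) (joins-inc (joins-sym (joins-y ≤-refl)))
        Two : Fin n → Fin m → Fin m → Set
        Two r a b = a ≢ b × (a ∈ D × Inc a r × a ≢ y l × g ≢ a) × (b ∈ D × Inc b r × b ≢ y l × g ≢ b)
        two : ∃ λ a → ∃ λ b → Two r a b
        two = find lands
          where
          find : ∀ {r} → ((∃ λ j → r ≡ p j) ⊎ (∃ λ i → suc i < l × r ≡ q (suc i))) → ∃ λ a → ∃ λ b → Two r a b
          find (inj₁ (j , refl)) = h j , h (j + e) , Cycle.inj (circuit-cycle C) j e (≤-trans (s≤s z≤n) e≥3) ≤-refl ,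
              (h-D j , joins-inc (joins j) , (λ eq → y≢h ≤-refl j (sym eq)) , g≢h j) ,
              (h-D (j + e) , joins-inc (joins-sym (prev C j)) , (λ eq → y≢h ≤-refl (j + e) (sym eq)) , g≢h (j + e))
          find (inj₂ (i , lt , refl)) = y i , y (suc i) , y-inj ≤-refl (<⇒≤ lt) ,
              (y-D (<⇒≤ (<⇒≤ lt)) , joins-inc (joins-sym (joins-y (<⇒≤ (<⇒≤ lt)))) , y-inj (<⇒≤ lt) ≤-refl , g≢y (<⇒≤ (<⇒≤ lt))) ,
              (y-D (<⇒≤ lt) , joins-inc (joins-y (<⇒≤ lt)) , y-inj lt ≤-refl , g≢y (<⇒≤ lt))
        ufs : Unique (y l ∷ proj₁ two ∷ proj₁ (proj₂ two) ∷ [])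
        ufs with two
        ... | a , b , ne , (_ , _ , a≢ , _) , (_ , _ , b≢ , _) =
          ((λ eq → a≢ (sym eq)) ∷ (λ eq → b≢ (sym eq)) ∷ []) ∷ (ne ∷ []) ∷ [] ∷ []
        fs⊆ : ∀ {v} → v ∈ y l ∷ proj₁ two ∷ proj₁ (proj₂ two) ∷ [] → v ∈ D × Adj v g
        fs⊆ v∈ with two | v∈
        ... | _ | here refl = y-D ≤-refl , adj-sym g~y
        ... | a , b , ne , (a∈ , ia , _ , g≢a) , _ | there (here refl) = a∈ , adj-sym (meet g≢a (joins-inc (joins-sym joins-g)) ia)
        ... | a , b , ne , _ , (b∈ , ib , _ , g≢b) | there (there (here refl)) = b∈ , adj-sym (meet g≢b (joins-inc (joins-sym joins-g)) ib)
        ns⊇ : ∀ {v} → v ∈ g ∷ D → Adj v (y l) → v ∈ g ∷ y (l ∸ 1) ∷ []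
        ns⊇ (here refl) _ = here refl
        ns⊇ (there v∈) a with ∈-D⁻ v∈
        ... | inj₂ (j , refl) = ⊥-elim (not-adj (joins j) (joins-y ≤-refl)
              (λ eq → off l≥1 (n≤1+n l) j (sym eq)) (λ eq → off (s≤s z≤n) ≤-refl j (sym eq))
              (λ eq → off l≥1 (n≤1+n l) (suc j) (sym eq)) (λ eq → off (s≤s z≤n) ≤-refl (suc j) (sym eq)) a)
        ... | inj₁ (i , le , refl) with m≤n⇒m<n∨m≡n le
        ... | inj₂ refl = ⊥-elim (irr a)
        ... | inj₁ lt with m≤n⇒m<n∨m≡n lt
        ... | inj₂ eq = there (here (cong (λ z → y (z ∸ 1)) eq))
        ... | inj₁ lt′ = ⊥-elim (not-adj (joins-y le) (joins-y ≤-refl) (distinct-q lt (n≤1+n l)) (distinct-q (m≤n⇒m≤1+n lt) ≤-refl)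
              (distinct-q lt′ (n≤1+n l)) (distinct-q (s≤s lt) ≤-refl) a)

    -- Two paths of a theta graph form a circuit through Q; the third, p 0 … p b, hangs off it.
    theta : ∀ {p : ℕ → Fin n} {h : ℕ → Fin m} {e} (C : Circuit p h e) → (∀ i → h i ∈ S) →
      ∀ b → 3 ≤ b → b ≤ e → ∀ e′ (Q : ℕ → Fin n) (Y : ℕ → Fin m) (g : Fin m) → 2 ≤ e′ →
      (∀ {i j} → i < j → j ≤ e′ → Q i ≢ Q j) → (∀ {i} → i < e′ → Joins (Y i) (Q i) (Q (suc i))) →
      Joins g (Q e′) (Q 0) → (∀ {i} → i < e′ → Y i ∈ S) → g ∈ S →
      ∀ s → s ≤ e′ → Q s ≡ p 0 → Q 0 ≡ p b → (∀ {i t} → 1 ≤ i → i < b → t ≤ e′ → p i ≢ Q t) →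
      Configuration k A
    theta {p} {h} {e} C h∈ (suc (suc (suc b))) _ b≤ e′ Q Y g e′≥2 distinct-Q joins-Y joins-g Y∈ g∈ s s≤ Qs Q0 away =
      Lollipop.configuration (shift-circuit K.circuit s) (λ i → K.edge-∈ {_∈ S} Y∈ g∈ (s + i))
        -- The third path has b + 3 edges: all but the last form the tail, and the last one is g. It
        -- lands at `Q 0`, which the shifted circuit meets `suc e′ ∸ s` places after its start.
        (suc b) (s≤s z≤n) p h start
        (λ lt le → distinct C lt (≤-trans le (≤-trans (≤-trans (n≤1+n _) b≤) (m≤n+m e _))))
        (λ a le j → away a (s≤s le) (K.res≤ (s + j)))
        (λ _ → Circuit.joins C _) (λ _ → h∈ _) (h∈ (suc (suc b))) (Circuit.joins C (suc (suc b)))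
        (inj₁ (landing , sym (trans (cong Q wrapped) Q0)))
      where
      module K = Close e′ Q Y g e′≥2 distinct-Q joins-Y joins-g side
        (λ lt → crosses (Y∈ lt) (joins-Y lt)) (crosses g∈ joins-g)
      start : p 0 ≡ K.p (s + 0)
      start = sym (trans (cong K.p (+-identityʳ s)) (trans (K.p-window s≤) Qs))
      landing : ℕ
      landing = suc e′ ∸ s
      wrapped : K.res (s + landing) ≡ 0
      wrapped = trans (cong K.res (trans (m+[n∸m]≡n (≤-trans s≤ (n≤1+n e′))) (sym (+-identityʳ (suc e′))))) (K.res-wrap 0 refl)
    theta C h∈ zero () _
    theta C h∈ (suc zero) (s≤s ()) _
    theta C h∈ (suc (suc zero)) (s≤s (s≤s ())) _

    module OnCircuit {p : ℕ → Fin n} {h : ℕ → Fin m} {e : ℕ} (C : Circuit p h e) (h∈ : ∀ i → h i ∈ S) where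
      open Circuit C

      parity : ∀ i → side (p i) ≡ (if even? i then side (p 0) else not (side (p 0)))
      parity zero = refl
      parity (suc i) rewrite crosses (h∈ i) (joins i) | parity i with even? i | side (p 0)
      ... | true | _ = refl
      ... | false | true = refl
      ... | false | false = refl

      not-fixed : ∀ b → b ≢ not b
      not-fixed true ()
      not-fixed false ()

      odd : ∀ {i} → side (p i) ≡ not (side (p 0)) → even? i ≡ false
      odd {i} eq with even? i | parity i
      ... | false | _ = refl
      ... | true | q = ⊥-elim (not-fixed _ (trans (sym q) eq))

      even-index : ∀ {i} → side (p i) ≡ side (p 0) → even? i ≡ true
      even-index {i} eq with even? i | parity i
      ... | true | _ = refl
      ... | false | q = ⊥-elim (not-fixed _ (trans (sym eq) q))

      wrap : ∀ b → b ≤ suc e → p (b + (suc e ∸ b)) ≡ p 0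
      wrap b le = trans (cong p (m+[n∸m]≡n le)) (per-p 0)

      -- The chord closes the arc from `p b` on to `p 0` into the new circuit, and the other arc is
      -- the tail. Its length b is odd by bipartiteness and is not 1, since G is simple, so it is at
      -- least 3.
      chord-configuration : ∀ {x b} → x ∈ S → b ≤ e → Joins x (p 0) (p b) → (∀ i → x ≢ h i) → Configuration k A
      chord-configuration {x} {b} x∈ b≤ jx x∉ = theta C h∈ b (b≥3 b b≢0 b≢1 (odd {b} (crosses x∈ jx))) b≤
          e′ (λ j → p (b + j)) (λ j → h (b + j)) x e′≥2
          (λ {i} {j} lt le → distinct C (+-monoʳ-< b lt) (≤-trans (+-monoʳ-≤ b (≤-trans le e′≤)) (≤-trans (+-monoˡ-≤ e (m≤m+n b i)) ≤-refl)))
          (λ {i} _ → subst (Joins (h (b + i)) (p (b + i))) (cong p (sym (+-suc b i))) (joins (b + i)))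
          (subst (λ v → Joins x v (p (b + 0))) (sym (wrap b (≤-trans b≤ (n≤1+n e)))) (subst (λ i → Joins x (p 0) (p i)) (sym (+-identityʳ b)) jx))
          (λ _ → h∈ _) x∈ e′ ≤-refl (wrap b (≤-trans b≤ (n≤1+n e))) (cong p (+-identityʳ b)) away
        where
        e′ = suc e ∸ b
        b≢0 : b ≢ 0
        b≢0 refl = joins-≢ jx refl
        b≢1 : b ≢ 1
        b≢1 refl = x∉ 0 (joins-unique jx (joins 0))
        b≢e : b ≢ e
        b≢e refl = x∉ e (joins-unique (joins-sym jx) (prev C 0))
        b≥3 : ∀ b → b ≢ 0 → b ≢ 1 → even? b ≡ false → 3 ≤ b
        b≥3 0 n _ _ = ⊥-elim (n refl)
        b≥3 1 _ n _ = ⊥-elim (n refl)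
        b≥3 2 _ _ ()
        b≥3 (suc (suc (suc b))) _ _ _ = s≤s (s≤s (s≤s z≤n))
        e′≥2 : 2 ≤ e′
        e′≥2 = m+n≤o⇒m≤o∸n 2 (s≤s (≤∧≢⇒< b≤ b≢e))
        e′≤ : e′ ≤ e
        e′≤ = m≤n+o⇒m∸n≤o (suc e) b (+-monoˡ-≤ e (≤-trans (s≤s z≤n) (b≥3 b b≢0 b≢1 (odd {b} (crosses x∈ jx)))))
        away : ∀ {i t} → 1 ≤ i → i < b → t ≤ e′ → p i ≢ p (b + t)
        away {i} {t} a lt le = distinct C (≤-trans lt (m≤m+n b t)) (≤-trans (+-monoʳ-≤ b le)
          (≤-trans (≤-reflexive (m+[n∸m]≡n (≤-trans b≤ (n≤1+n e)))) (+-monoˡ-≤ e a)))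

      -- The ear through z replaces the arc from `p 0` to `p b` in the circuit, and that arc, of
      -- length at least 4, becomes the tail.
      ear-configuration : ∀ {x g z b} → x ∈ S → g ∈ S → 4 ≤ b → b ≤ e → Joins x (p 0) z → Joins g z (p b) →
        (∀ i → z ≢ p i) → Configuration k A
      ear-configuration {x} {g} {z} {b} x∈ g∈ b≥4 b≤ jx jg z∉ = theta C h∈ b (<⇒≤ b≥4) b≤
          (suc e₀) Q Y g (s≤s e₀≥1) distinct-Q joins-Y
          (subst₂ (Joins g) (sym Q-last) (sym Q-0) jg) Y∈ g∈ e₀ (n≤1+n e₀) (trans (Q-in ≤-refl) wrapped) Q-0 away
        where
        e₀ = suc e ∸ b
        e₀≥1 : 1 ≤ e₀
        e₀≥1 = m+n≤o⇒m≤o∸n 1 (s≤s b≤)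
        e₀≤ : e₀ ≤ e
        e₀≤ = m≤n+o⇒m∸n≤o (suc e) b (+-monoˡ-≤ e (≤-trans (s≤s z≤n) b≥4))
        wrapped : p (b + e₀) ≡ p 0
        wrapped = wrap b (≤-trans b≤ (n≤1+n e))
        Q : ℕ → Fin n
        Q j with j ≤? e₀
        ... | yes _ = p (b + j)
        ... | no _ = z
        Y : ℕ → Fin m
        Y j with suc j ≤? e₀
        ... | yes _ = h (b + j)
        ... | no _ = x
        Q-in : ∀ {j} → j ≤ e₀ → Q j ≡ p (b + j)
        Q-in {j} le with j ≤? e₀
        ... | yes _ = refl
        ... | no n = ⊥-elim (n le)
        Q-out : ∀ {j} → e₀ < j → Q j ≡ z
        Q-out {j} lt with j ≤? e₀
        ... | yes le = ⊥-elim (<⇒≱ lt le)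
        ... | no _ = refl
        Q-last : Q (suc e₀) ≡ z
        Q-last = Q-out ≤-refl
        Q-0 : Q 0 ≡ p b
        Q-0 = trans (Q-in z≤n) (cong p (+-identityʳ b))
        distinct-Q : ∀ {i j} → i < j → j ≤ suc e₀ → Q i ≢ Q j
        distinct-Q {i} {j} lt le eq with m≤n⇒m<n∨m≡n le
        ... | inj₂ refl = z∉ (b + i) (trans (sym Q-last) (trans (sym eq) (Q-in (≤-pred lt))))
        ... | inj₁ lt′ = distinct C (+-monoʳ-< b lt) (≤-trans (+-monoʳ-≤ b (≤-trans (≤-pred lt′) e₀≤)) (+-monoˡ-≤ e (m≤m+n b i)))
              (trans (sym (Q-in (≤-trans (<⇒≤ lt) (≤-pred lt′)))) (trans eq (Q-in (≤-pred lt′))))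
        joins-Y : ∀ {i} → i < suc e₀ → Joins (Y i) (Q i) (Q (suc i))
        joins-Y {i} lt with suc i ≤? e₀
        ... | yes le = subst₂ (Joins (h (b + i))) (sym (Q-in (<⇒≤ le))) (trans (cong p (sym (+-suc b i))) refl) (joins (b + i))
        ... | no n = subst (λ v → Joins x v z) (sym (trans (Q-in (≤-pred lt)) (trans (cong (λ t → p (b + t)) i≡) wrapped))) jx
          where
          i≡ : i ≡ e₀
          i≡ = ≤-antisym (≤-pred lt) (≤-pred (≰⇒> n))
        Y∈ : ∀ {i} → i < suc e₀ → Y i ∈ S
        Y∈ {i} lt with suc i ≤? e₀
        ... | yes _ = h∈ (b + i)
        ... | no _ = x∈
        away : ∀ {i t} → 1 ≤ i → i < b → t ≤ suc e₀ → p i ≢ Q t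
        away {i} {t} a lt le eq with m≤n⇒m<n∨m≡n le
        ... | inj₂ refl = z∉ i (trans (sym Q-last) (sym eq))
        ... | inj₁ lt′ = distinct C (≤-trans lt (m≤m+n b t)) (≤-trans (+-monoʳ-≤ b (≤-pred lt′))
              (≤-trans (≤-reflexive (m+[n∸m]≡n (≤-trans b≤ (n≤1+n e)))) (+-monoˡ-≤ e a))) (trans eq (Q-in (≤-pred lt′)))

    off-end : ∀ {e f p q p′ q′} → Joins e p q → Joins f p′ q′ → p ≢ p′ → p ≢ q′ → e ≢ f
    off-end j j′ a b refl with inc-joins j′ (joins-inc j)
    ... | inj₁ x = a x
    ... | inj₂ x = b x

    same-side : ∀ {e f p q v} → e ∈ S → f ∈ S → Joins e v p → Joins f v q → side p ≡ side q
    same-side e∈ f∈ j j′ = trans (crosses e∈ j) (sym (crosses f∈ j′))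

    other-side : ∀ {e p q} → e ∈ S → Joins e p q → side p ≢ side q
    other-side {p = p} e∈ j eq with side p | crosses e∈ j
    ... | true | x = case trans eq x of λ ()
    ... | false | x = case trans eq x of λ ()

    record K₂₃ (t r a b c : Fin n) (ta ar rb bt tc cr : Fin m) : Set where
      field
        t≢r : t ≢ r
        a≢b : a ≢ b
        a≢c : a ≢ c
        b≢c : b ≢ c
        jta : Joins ta t a
        jar : Joins ar a r
        jrb : Joins rb r b
        jbt : Joins bt b t
        jtc : Joins tc t c
        jcr : Joins cr c r
        ta∈ : ta ∈ S
        ar∈ : ar ∈ S
        rb∈ : rb ∈ S
        bt∈ : bt ∈ S
        tc∈ : tc ∈ S
        cr∈ : cr ∈ S

      t≢a : t ≢ a
      t≢a = joins-≢ jta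
      r≢a : r ≢ a
      r≢a = joins-≢ (joins-sym jar)
      r≢b : r ≢ b
      r≢b = joins-≢ jrb
      t≢b : t ≢ b
      t≢b = joins-≢ (joins-sym jbt)
      t≢c : t ≢ c
      t≢c = joins-≢ jtc
      r≢c : r ≢ c
      r≢c = joins-≢ (joins-sym jcr)

    private
      flip≢ : ∀ {X : Set} {x y : X} → x ≢ y → y ≢ x
      flip≢ n eq = n (sym eq)

    module K₂₃-plus {t r a b c : Fin n} {ta ar rb bt tc cr : Fin m} (K : K₂₃ t r a b c ta ar rb bt tc cr) where
      open K₂₃ K

      qs : ℕ → Fin n
      qs 0 = t
      qs 1 = a
      qs 2 = r
      qs (suc (suc (suc _))) = b

      es : ℕ → Fin m
      es 0 = ta
      es 1 = ar
      es (suc (suc _)) = rb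

      distinct-qs : ∀ {i j} → i < j → j ≤ 3 → qs i ≢ qs j
      distinct-qs {0} {1} _ _ = t≢a
      distinct-qs {0} {2} _ _ = t≢r
      distinct-qs {0} {3} _ _ = t≢b
      distinct-qs {1} {2} _ _ = flip≢ r≢a
      distinct-qs {1} {3} _ _ = a≢b
      distinct-qs {2} {3} _ _ = r≢b
      distinct-qs {_} {0} () _
      distinct-qs {1} {1} (s≤s ()) _
      distinct-qs {2} {1} (s≤s ()) _
      distinct-qs {suc (suc (suc i))} {1} (s≤s ()) _
      distinct-qs {2} {2} (s≤s (s≤s ())) _
      distinct-qs {suc (suc (suc i))} {2} (s≤s (s≤s ())) _
      distinct-qs {suc (suc (suc i))} {3} (s≤s (s≤s (s≤s ()))) _
      distinct-qs {_} {suc (suc (suc (suc j)))} _ (s≤s (s≤s (s≤s ())))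

      joins-es : ∀ {i} → i < 3 → Joins (es i) (qs i) (qs (suc i))
      joins-es {0} _ = jta
      joins-es {1} _ = jar
      joins-es {2} _ = jrb
      joins-es {suc (suc (suc i))} (s≤s (s≤s (s≤s ())))

      es∈ : ∀ {i} → i < 3 → es i ∈ S
      es∈ {0} _ = ta∈
      es∈ {1} _ = ar∈
      es∈ {suc (suc i)} _ = rb∈

      module Q = Close 3 qs es bt (s≤s (s≤s z≤n)) distinct-qs joins-es jbt side
        (λ lt → crosses (es∈ lt) (joins-es lt)) (crosses bt∈ jbt)

      H : List (Fin m)
      H = edges Q.circuit

      -- The edge x breaks the regularity of K₂₃: tc now has the neighbours ta, bt, cr, x, while ta
      -- still has only three.
      extra-middle : ∀ {x w} → x ∈ S → Joins x c w → w ≢ t → w ≢ r → Configuration k A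
      extra-middle {x} {w} x∈ jx w≢t w≢r = record
        { f = tc ; d = ta ; ds = ar ∷ rb ∷ bt ∷ cr ∷ x ∷ []
        ; f∈ = S⊆A tc∈ ; ds⊆ = λ v∈ → S⊆A (inS v∈)
        ; uds = ( off-end (joins-sym jtc) jta (flip≢ t≢c) (flip≢ a≢c) ∷ off-end jtc jar t≢a t≢r ∷ off-end jtc jrb t≢r t≢b ∷
                  off-end (joins-sym jtc) jbt (flip≢ b≢c) (flip≢ t≢c) ∷ off-end jtc jcr t≢c t≢r ∷ off-end jtc jx t≢c (flip≢ w≢t) ∷ []) ∷
                ( off-end jta jar t≢a t≢r ∷ off-end jta jrb t≢r t≢b ∷ off-end (joins-sym jta) jbt a≢b (flip≢ t≢a) ∷
                  off-end jta jcr t≢c t≢r ∷ off-end jta jx t≢c (flip≢ w≢t) ∷ []) ∷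
                ( off-end jar jrb (flip≢ r≢a) a≢b ∷ off-end jar jbt a≢b (flip≢ t≢a) ∷ off-end jar jcr a≢c (flip≢ r≢a) ∷
                  off-end (joins-sym jar) jx r≢c (flip≢ w≢r) ∷ []) ∷
                ( off-end jrb jbt r≢b (flip≢ t≢r) ∷ off-end (joins-sym jrb) jcr b≢c (flip≢ r≢b) ∷ off-end jrb jx r≢c (flip≢ w≢r) ∷ []) ∷
                ( off-end jbt jcr b≢c (flip≢ r≢b) ∷ off-end (joins-sym jbt) jx t≢c (flip≢ w≢t) ∷ []) ∷
                ( off-end (joins-sym jcr) jx r≢c (flip≢ w≢r) ∷ []) ∷ [] ∷ []
        ; bounded = λ { (here refl) → bounded tc∈ ; (there v∈) → bounded (inS v∈) }
        ; f~d = meet (off-end (joins-sym jtc) jta (flip≢ t≢c) (flip≢ a≢c)) (joins-inc jtc) (joins-inc jta)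
        ; ordered =
            (ta , here refl , meet (off-end jta jar t≢a t≢r) (joins-inc (joins-sym jta)) (joins-inc jar)) ∷
            (ar , here refl , meet (off-end jar jrb (flip≢ r≢a) a≢b) (joins-inc (joins-sym jar)) (joins-inc jrb)) ∷
            (rb , here refl , meet (off-end jrb jbt r≢b (flip≢ t≢r)) (joins-inc (joins-sym jrb)) (joins-inc jbt)) ∷
            (rb , there (here refl) , meet (off-end (joins-sym jrb) jcr b≢c (flip≢ r≢b)) (joins-inc jrb) (joins-inc (joins-sym jcr))) ∷
            (cr , here refl , meet cr≢x (joins-inc jcr) (joins-inc jx)) ∷ []
        ; fs = ta ∷ bt ∷ cr ∷ x ∷ [] ; ns = bt ∷ tc ∷ ar ∷ []
        ; ufs = ( off-end (joins-sym jta) jbt a≢b (flip≢ t≢a) ∷ off-end jta jcr t≢c t≢r ∷ off-end jta jx t≢c (flip≢ w≢t) ∷ []) ∷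
                ( off-end jbt jcr b≢c (flip≢ r≢b) ∷ off-end (joins-sym jbt) jx t≢c (flip≢ w≢t) ∷ []) ∷
                ( cr≢x ∷ []) ∷ [] ∷ []
        ; fs⊆ = λ
            { (here refl) → here refl , meet (flip≢ (off-end (joins-sym jtc) jta (flip≢ t≢c) (flip≢ a≢c))) (joins-inc jta) (joins-inc jtc)
            ; (there (here refl)) → there (there (there (here refl))) ,
                meet (off-end jbt jtc (flip≢ t≢b) b≢c) (joins-inc (joins-sym jbt)) (joins-inc jtc)
            ; (there (there (here refl))) → there (there (there (there (here refl)))) ,
                meet (off-end (joins-sym jcr) jtc (flip≢ t≢r) r≢c) (joins-inc jcr) (joins-inc (joins-sym jtc))
            ; (there (there (there (here refl)))) → there (there (there (there (there (here refl))))) ,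
                meet (flip≢ (off-end jtc jx t≢c (flip≢ w≢t))) (joins-inc jx) (joins-inc (joins-sym jtc)) }
        ; ns⊇ = λ
            { (here refl) _ → there (here refl)
            ; (there (here refl)) ad → ⊥-elim (irr ad)
            ; (there (there (here refl))) _ → there (there (here refl))
            ; (there (there (there (here refl)))) ad → ⊥-elim (not-adj jrb jta (flip≢ t≢r) r≢a (flip≢ t≢b) (flip≢ a≢b) ad)
            ; (there (there (there (there (here refl))))) _ → here refl
            ; (there (there (there (there (there (here refl)))))) ad → ⊥-elim (not-adj jcr jta (flip≢ t≢c) (flip≢ a≢c) (flip≢ t≢r) r≢a ad)
            ; (there (there (there (there (there (there (here refl))))))) ad →
                ⊥-elim (not-adj jx jta (flip≢ t≢c) (flip≢ a≢c) w≢t w≢a ad) }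
        ; more = ≤-refl
        ; H = H ; h = Q.h ; e = 3 ; round = round Q.circuit
        ; H⊆ = λ { (here refl) → here refl ; (there (here refl)) → there (here refl) ; (there (there (here refl))) → there (there (here refl))
                 ; (there (there (there (here refl)))) → there (there (there (here refl))) }
        }
        where
        cr≢x : cr ≢ x
        cr≢x = off-end (joins-sym jcr) jx r≢c (flip≢ w≢r)
        w≢a : w ≢ a
        w≢a refl = other-side x∈ jx (same-side tc∈ ta∈ jtc jta)
        inS : ∀ {v} → v ∈ ta ∷ ar ∷ rb ∷ bt ∷ cr ∷ x ∷ [] → v ∈ S
        inS (here refl) = ta∈
        inS (there (here refl)) = ar∈
        inS (there (there (here refl))) = rb∈
        inS (there (there (there (here refl)))) = bt∈
        inS (there (there (there (there (here refl))))) = cr∈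
        inS (there (there (there (there (there (here refl)))))) = x∈

      -- Here x meets tc at t and leaves cr, at the opposite vertex r, with its three neighbours.
      extra-end : ∀ {x w} → x ∈ S → Joins x t w → w ≢ a → w ≢ b → w ≢ c → Configuration k A
      extra-end {x} {w} x∈ jx w≢a w≢b w≢c = record
        { f = tc ; d = cr ; ds = ar ∷ ta ∷ bt ∷ rb ∷ x ∷ []
        ; f∈ = S⊆A tc∈ ; ds⊆ = λ v∈ → S⊆A (inS v∈)
        ; uds = ( off-end jtc jcr t≢c t≢r ∷ off-end jtc jar t≢a t≢r ∷ off-end (joins-sym jtc) jta (flip≢ t≢c) (flip≢ a≢c) ∷
                  off-end (joins-sym jtc) jbt (flip≢ b≢c) (flip≢ t≢c) ∷ off-end jtc jrb t≢r t≢b ∷ off-end (joins-sym jtc) jx (flip≢ t≢c) (flip≢ w≢c) ∷ []) ∷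
                ( off-end jcr jar (flip≢ a≢c) (flip≢ r≢c) ∷ off-end jcr jta (flip≢ t≢c) (flip≢ a≢c) ∷ off-end jcr jbt (flip≢ b≢c) (flip≢ t≢c) ∷
                  off-end jcr jrb (flip≢ r≢c) (flip≢ b≢c) ∷ off-end jcr jx (flip≢ t≢c) (flip≢ w≢c) ∷ []) ∷
                ( off-end (joins-sym jar) jta (flip≢ t≢r) r≢a ∷ off-end jar jbt a≢b (flip≢ t≢a) ∷ off-end jar jrb (flip≢ r≢a) a≢b ∷
                  off-end jar jx (flip≢ t≢a) (flip≢ w≢a) ∷ []) ∷
                ( off-end (joins-sym jta) jbt a≢b (flip≢ t≢a) ∷ off-end jta jrb t≢r t≢b ∷ off-end (joins-sym jta) jx (flip≢ t≢a) (flip≢ w≢a) ∷ []) ∷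
                ( off-end (joins-sym jbt) jrb t≢r t≢b ∷ off-end jbt jx (flip≢ t≢b) (flip≢ w≢b) ∷ []) ∷
                ( off-end (joins-sym jrb) jx (flip≢ t≢b) (flip≢ w≢b) ∷ []) ∷ [] ∷ []
        ; bounded = λ { (here refl) → bounded tc∈ ; (there v∈) → bounded (inS v∈) }
        ; f~d = meet (off-end jtc jcr t≢c t≢r) (joins-inc (joins-sym jtc)) (joins-inc jcr)
        ; ordered =
            (cr , here refl , meet (off-end jcr jar (flip≢ a≢c) (flip≢ r≢c)) (joins-inc (joins-sym jcr)) (joins-inc (joins-sym jar))) ∷
            (ar , here refl , meet (off-end (joins-sym jar) jta (flip≢ t≢r) r≢a) (joins-inc jar) (joins-inc (joins-sym jta))) ∷
            (ta , here refl , meet (off-end (joins-sym jta) jbt a≢b (flip≢ t≢a)) (joins-inc jta) (joins-inc (joins-sym jbt))) ∷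
            (bt , here refl , meet (off-end (joins-sym jbt) jrb t≢r t≢b) (joins-inc jbt) (joins-inc (joins-sym jrb))) ∷
            (ta , there (there (here refl)) , meet ta≢x (joins-inc jta) (joins-inc jx)) ∷ []
        ; fs = cr ∷ ta ∷ bt ∷ x ∷ [] ; ns = tc ∷ ar ∷ rb ∷ []
        ; ufs = ( off-end jcr jta (flip≢ t≢c) (flip≢ a≢c) ∷ off-end jcr jbt (flip≢ b≢c) (flip≢ t≢c) ∷ off-end jcr jx (flip≢ t≢c) (flip≢ w≢c) ∷ []) ∷
                ( off-end (joins-sym jta) jbt a≢b (flip≢ t≢a) ∷ ta≢x ∷ []) ∷
                ( off-end jbt jx (flip≢ t≢b) (flip≢ w≢b) ∷ []) ∷ [] ∷ []
        ; fs⊆ = λ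
            { (here refl) → here refl , meet (flip≢ (off-end jtc jcr t≢c t≢r)) (joins-inc jcr) (joins-inc (joins-sym jtc))
            ; (there (here refl)) → there (there (here refl)) ,
                meet (off-end (joins-sym jta) jtc (flip≢ t≢a) a≢c) (joins-inc jta) (joins-inc jtc)
            ; (there (there (here refl))) → there (there (there (here refl))) ,
                meet (off-end jbt jtc (flip≢ t≢b) b≢c) (joins-inc (joins-sym jbt)) (joins-inc jtc)
            ; (there (there (there (here refl)))) → there (there (there (there (there (here refl))))) ,
                meet (flip≢ (off-end (joins-sym jtc) jx (flip≢ t≢c) (flip≢ w≢c))) (joins-inc jx) (joins-inc jtc) }
        ; ns⊇ = λ
            { (here refl) _ → here refl
            ; (there (here refl)) ad → ⊥-elim (irr ad)
            ; (there (there (here refl))) _ → there (here refl)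
            ; (there (there (there (here refl)))) ad → ⊥-elim (not-adj jta jcr t≢c t≢r a≢c (flip≢ r≢a) ad)
            ; (there (there (there (there (here refl))))) ad → ⊥-elim (not-adj jbt jcr b≢c (flip≢ r≢b) t≢c t≢r ad)
            ; (there (there (there (there (there (here refl)))))) _ → there (there (here refl))
            ; (there (there (there (there (there (there (here refl))))))) ad →
                ⊥-elim (not-adj jx jcr t≢c t≢r w≢c w≢r ad) }
        ; more = ≤-refl
        ; H = H ; h = Q.h ; e = 3 ; round = round Q.circuit
        ; H⊆ = λ { (here refl) → there (there (here refl)) ; (there (here refl)) → there (here refl)
                 ; (there (there (here refl))) → there (there (there (there (here refl))))
                 ; (there (there (there (here refl)))) → there (there (there (here refl))) }
        }
        where
        ta≢x : ta ≢ x
        ta≢x = off-end (joins-sym jta) jx (flip≢ t≢a) (flip≢ w≢a)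
        w≢r : w ≢ r
        w≢r refl = other-side x∈ jx (same-side ta∈ ar∈ (joins-sym jta) jar)
        inS : ∀ {v} → v ∈ cr ∷ ar ∷ ta ∷ bt ∷ rb ∷ x ∷ [] → v ∈ S
        inS (here refl) = cr∈
        inS (there (here refl)) = ar∈
        inS (there (there (here refl))) = ta∈
        inS (there (there (there (here refl)))) = bt∈
        inS (there (there (there (there (here refl))))) = rb∈
        inS (there (there (there (there (there (here refl)))))) = x∈

    K-swap : ∀ {t r a b c ta ar rb bt tc cr} → K₂₃ t r a b c ta ar rb bt tc cr → K₂₃ r t a b c ar ta bt rb cr tc
    K-swap K = record
      { t≢r = flip≢ t≢r ; a≢b = a≢b ; a≢c = a≢c ; b≢c = b≢c
      ; jta = joins-sym jar ; jar = joins-sym jta ; jrb = joins-sym jbt ; jbt = joins-sym jrb ; jtc = joins-sym jcr ; jcr = joins-sym jtc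
      ; ta∈ = ar∈ ; ar∈ = ta∈ ; rb∈ = bt∈ ; bt∈ = rb∈ ; tc∈ = cr∈ ; cr∈ = tc∈ }
      where open K₂₃ K

    K-rotate : ∀ {t r a b c ta ar rb bt tc cr} → K₂₃ t r a b c ta ar rb bt tc cr → K₂₃ t r b c a bt rb cr tc ta ar
    K-rotate K = record
      { t≢r = t≢r ; a≢b = b≢c ; a≢c = flip≢ a≢b ; b≢c = flip≢ a≢c
      ; jta = joins-sym jbt ; jar = joins-sym jrb ; jrb = joins-sym jcr ; jbt = joins-sym jtc ; jtc = jta ; jcr = jar
      ; ta∈ = bt∈ ; ar∈ = rb∈ ; rb∈ = cr∈ ; bt∈ = tc∈ ; tc∈ = ta∈ ; cr∈ = ar∈ }
      where open K₂₃ K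

    K-edges : ∀ {t r a b c ta ar rb bt tc cr} → K₂₃ t r a b c ta ar rb bt tc cr → List (Fin m)
    K-edges {ta = ta} {ar} {rb} {bt} {tc} {cr} _ = ta ∷ ar ∷ rb ∷ bt ∷ tc ∷ cr ∷ []

    K-vertices : ∀ {t r a b c ta ar rb bt tc cr} → K₂₃ t r a b c ta ar rb bt tc cr → List (Fin n)
    K-vertices {t} {r} {a} {b} {c} _ = t ∷ r ∷ a ∷ b ∷ c ∷ []

    -- The symmetries `K-swap` and `K-rotate` reduce the five vertices of K₂₃ to one of each part.
    K-extra : ∀ {t r a b c ta ar rb bt tc cr} (K : K₂₃ t r a b c ta ar rb bt tc cr) → ∀ {x v} → x ∈ S → x ∉ K-edges K →
      v ∈ K-vertices K → Inc x v → Configuration k A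
    K-extra K {x} x∈ x∉ v∈ ix with other-end {x} ix
    ... | w , jx = go v∈
      where
      open K₂₃ K
      go : _ ∈ K-vertices K → Configuration k A
      go (here refl) = K₂₃-plus.extra-end K x∈ jx
        (λ { refl → x∉ (here (joins-unique jx jta)) })
        (λ { refl → x∉ (there (there (there (here (joins-unique jx (joins-sym jbt)))))) })
        (λ { refl → x∉ (there (there (there (there (here (joins-unique jx jtc)))))) })
      go (there (here refl)) = K₂₃-plus.extra-end (K-swap K) x∈ jx
        (λ { refl → x∉ (there (here (joins-unique jx (joins-sym jar)))) })
        (λ { refl → x∉ (there (there (here (joins-unique jx jrb)))) })
        (λ { refl → x∉ (there (there (there (there (there (here (joins-unique jx (joins-sym jcr)))))))) })
      go (there (there (here refl))) = K₂₃-plus.extra-middle (K-rotate K) x∈ jx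
        (λ { refl → x∉ (here (joins-unique jx (joins-sym jta))) })
        (λ { refl → x∉ (there (here (joins-unique jx jar))) })
      go (there (there (there (here refl)))) = K₂₃-plus.extra-middle (K-rotate (K-rotate K)) x∈ jx
        (λ { refl → x∉ (there (there (there (here (joins-unique jx jbt))))) })
        (λ { refl → x∉ (there (there (here (joins-unique jx (joins-sym jrb))))) })
      go (there (there (there (there (here refl))))) = K₂₃-plus.extra-middle K x∈ jx
        (λ { refl → x∉ (there (there (there (there (here (joins-unique jx (joins-sym jtc))))))) })
        (λ { refl → x∉ (there (there (there (there (there (here (joins-unique jx jcr))))))) })

    touches? : ∀ (T : List (Fin m)) v → Dec (Any (λ e → Inc e v) T)
    touches? T v = any? (λ e → inc? e v) T

    touched : List (Fin m) → List (Fin n)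
    touched T = filter (touches? T) (allFin n)

    touched⁺ : ∀ {T e v} → e ∈ T → Inc e v → v ∈ touched T
    touched⁺ {T} {e} {v} e∈ i = ∈-filter⁺ (touches? T) (∈-allFin v) (go e∈)
      where
      go : ∀ {T} → e ∈ T → Any (λ e → Inc e v) T
      go (here refl) = here i
      go (there p) = there (go p)

    touched⁻ : ∀ {T v} → v ∈ touched T → ∃ λ e → e ∈ T × Inc e v
    touched⁻ {T} p = go (proj₂ (∈-filter⁻ (touches? T) {xs = allFin n} p))
      where
      go : ∀ {T v} → Any (λ e → Inc e v) T → ∃ λ e → e ∈ T × Inc e v
      go (here i) = _ , here refl , i
      go (there q) = let e , e∈ , i = go q in e , there e∈ , i

    unique-touched : ∀ T → Unique (touched T)
    unique-touched T = Uniq.filter⁺ (touches? T) (Uniq.allFin⁺ n)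

    -- A piece whose removal preserves the bound to be proved: the vertices in vs meet no other
    -- edge, so they disappear along with es and pay for it.
    record Peel (T : List (Fin m)) : Set where
      field
        es     : List (Fin m)
        vs     : List (Fin n)
        uvs    : Unique vs
        ratio  : 5 * length es ≤ 6 * length vs
        some   : ∃ λ e → e ∈ T × e ∈ es
        inside : ∀ {v} → v ∈ vs → v ∈ touched T
        sealed : ∀ {v e} → v ∈ vs → e ∈ T → Inc e v → e ∈ es

    module _ {T : List (Fin m)} (uT : Unique T) (P : Peel T) where
      open Peel P

      peeled : List (Fin m)
      peeled = without es T

      peeled-shorter : length peeled < length T
      peeled-shorter = let e , e∈T , e∈ = some in
        length-⊂ (unique-without {es} uT) (λ p → proj₁ (without⁻ {es} {T} p)) e∈T (λ p → proj₂ (without⁻ {es} {T} p) e∈)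

      peel-bound : 5 * length peeled ≤ 6 * length (touched peeled) → 5 * length T ≤ 6 * length (touched T)
      peel-bound ih = begin
        5 * length T                                       ≤⟨ *-monoʳ-≤ 5 (length-⊆ uT cover) ⟩
        5 * length (peeled ++ es)                          ≡⟨ trans (cong (5 *_) (length-++ peeled)) (*-distribˡ-+ 5 (length peeled) (length es)) ⟩
        5 * length peeled + 5 * length es                  ≤⟨ +-mono-≤ ih ratio ⟩
        6 * length (touched peeled) + 6 * length vs        ≡⟨ trans (sym (*-distribˡ-+ 6 (length (touched peeled)) (length vs))) (cong (6 *_) (sym (length-++ (touched peeled)))) ⟩
        6 * length (touched peeled ++ vs)                  ≤⟨ *-monoʳ-≤ 6 (length-⊆ u sub) ⟩
        6 * length (touched T) ∎
        where
        open ≤-Reasoning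
        cover : ∀ {e} → e ∈ T → e ∈ peeled ++ es
        cover {e} e∈ with e ∈ᵥ? es
        ... | yes q = ∈-++⁺ʳ peeled q
        ... | no q = ∈-++⁺ˡ (without⁺ e∈ q)
        u : Unique (touched peeled ++ vs)
        u = Uniq.++⁺ (unique-touched peeled) uvs λ (a , b) →
          let e , e∈ , i = touched⁻ {peeled} a ; e∈T , e∉ = without⁻ {es} {T} e∈ in e∉ (sealed b e∈T i)
        sub : ∀ {v} → v ∈ touched peeled ++ vs → v ∈ touched T
        sub v∈ with ∈-++⁻ (touched peeled) v∈
        ... | inj₂ q = inside q
        ... | inj₁ q = let e , e∈ , i = touched⁻ {peeled} q in touched⁺ (proj₁ (without⁻ {es} e∈)) i

    module Walk (T : List (Fin m)) (T⊆S : ∀ {e} → e ∈ T → e ∈ S)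
      (continue : ∀ {e v} → e ∈ T → Inc e v → ∃ λ e′ → e′ ∈ T × e′ ≢ e × Inc e′ v) where

      record Path (Z : Fin n → Set) (l : ℕ) (q : ℕ → Fin n) (y : ℕ → Fin m) : Set where
        field
          distinct-q : ∀ {i j} → i < j → j ≤ suc l → q i ≢ q j
          joins-y    : ∀ {i} → i ≤ l → Joins (y i) (q i) (q (suc i))
          y∈         : ∀ {i} → i ≤ l → y i ∈ T
          off        : ∀ {i} → 1 ≤ i → i ≤ suc l → ¬ Z (q i)

      record Stuck (Z : Fin n → Set) (v : Fin n) : Set where
        field
          l       : ℕ
          q       : ℕ → Fin n
          y       : ℕ → Fin m
          path    : Path Z l q y
          start   : q 0 ≡ v
          g       : Fin m
          z       : Fin n
          g∈      : g ∈ T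
          g≢      : g ≢ y l
          joins-g : Joins g (q (suc l)) z
          lands   : Z z ⊎ (∃ λ i → i ≤ suc l × z ≡ q i)

      -- Every end vertex has a further edge, so the path grows until it meets Z or itself. A path
      -- with last index l has l + 2 vertices, hence running out of fuel would exceed n.
      walk : ∀ {Z} → (∀ v → Dec (Z v)) → ∀ fuel l q y → l + fuel ≡ n → Path Z l q y → Stuck Z (q 0)
      walk Z? zero l q y eq P = ⊥-elim (1+n≰n (≤-trans (n≤1+n _) (≤-trans (≤-trans (≤-reflexive (sym (length-applyUpTo q (suc (suc l)))))
          (length-⊆ {ys = allFin n} (Uniq.applyUpTo⁺₁ q (suc (suc l)) (λ lt le → distinct-q lt (≤-pred le))) (λ {v} _ → ∈-allFin v)))
          (≤-reflexive (trans (length-tabulate {n = n} id) (trans (sym eq) (+-identityʳ l)))))))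
        where open Path P
      walk {Z} Z? (suc fuel) l q y eq P with continue (Path.y∈ P ≤-refl) (joins-inc (joins-sym (Path.joins-y P ≤-refl)))
      ... | g , g∈ , g≢ , ig with other-end ig
      ... | z , jg with Z? z | search< (λ i → z F.≟ q i) (suc (suc l))
      ... | yes Zz | _ = record { l = l ; q = q ; y = y ; path = P ; start = refl ; g = g ; z = z ; g∈ = g∈ ; g≢ = g≢ ; joins-g = jg ; lands = inj₁ Zz }
      ... | no _ | inj₁ (i , lt , eqz) = record { l = l ; q = q ; y = y ; path = P ; start = refl ; g = g ; z = z ; g∈ = g∈ ; g≢ = g≢ ; joins-g = jg
            ; lands = inj₂ (i , ≤-pred lt , eqz) }
      ... | no nZ | inj₂ new = subst (Stuck Z) (q-in z≤n) (walk Z? fuel (suc l) q′ y′ (trans (sym (+-suc l fuel)) eq) P′)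
        where
        open Path P
        q′ : ℕ → Fin n
        q′ i with i ≤? suc l
        ... | yes _ = q i
        ... | no _ = z
        y′ : ℕ → Fin m
        y′ i with i ≤? l
        ... | yes _ = y i
        ... | no _ = g
        q-in : ∀ {i} → i ≤ suc l → q′ i ≡ q i
        q-in {i} le with i ≤? suc l
        ... | yes _ = refl
        ... | no nle = ⊥-elim (nle le)
        q-new : ∀ {i} → suc l < i → q′ i ≡ z
        q-new {i} lt with i ≤? suc l
        ... | yes le = ⊥-elim (<⇒≱ lt le)
        ... | no _ = refl
        P′ : Path Z (suc l) q′ y′
        P′ = record { distinct-q = dist ; joins-y = jn ; y∈ = mem ; off = of }
          where
          dist : ∀ {i j} → i < j → j ≤ suc (suc l) → q′ i ≢ q′ j
          dist {i} {j} lt le e with m≤n⇒m<n∨m≡n le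
          ... | inj₁ lt′ = distinct-q lt (≤-pred lt′) (trans (sym (q-in (≤-trans (<⇒≤ lt) (≤-pred lt′)))) (trans e (q-in (≤-pred lt′))))
          ... | inj₂ refl = new (≤-trans lt ≤-refl) (trans (sym (q-new ≤-refl)) (trans (sym e) (q-in (≤-pred lt))))
          jn : ∀ {i} → i ≤ suc l → Joins (y′ i) (q′ i) (q′ (suc i))
          jn {i} le with i ≤? l
          ... | yes le′ = subst₂ (Joins (y i)) (sym (q-in le)) (sym (q-in (s≤s le′))) (joins-y le′)
          ... | no nle = subst₂ (Joins g) (trans (cong q (sym i≡)) (sym (q-in le))) (sym (q-new (s≤s (≰⇒> nle)))) jg
            where
            i≡ : i ≡ suc l
            i≡ = ≤-antisym le (≰⇒> nle)
          mem : ∀ {i} → i ≤ suc l → y′ i ∈ T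
          mem {i} le with i ≤? l
          ... | yes le′ = y∈ le′
          ... | no _ = g∈
          of : ∀ {i} → 1 ≤ i → i ≤ suc (suc l) → ¬ Z (q′ i)
          of {i} a le with m≤n⇒m<n∨m≡n le
          ... | inj₁ lt = λ Zi → off a (≤-pred lt) (subst Z (q-in (≤-pred lt)) Zi)
          ... | inj₂ refl = λ Zi → nZ (subst Z (q-new ≤-refl) Zi)

      edge-path : ∀ Z {e u v} → e ∈ T → Joins e u v → ¬ Z v → Path Z 0 (λ { zero → u ; (suc _) → v }) (λ _ → e)
      edge-path Z {e} {u} {v} e∈ j nZ = record
        { distinct-q = λ { {zero} {suc _} _ _ → joins-≢ j ; {suc _} {suc zero} (s≤s ()) _ ; {suc _} {suc (suc _)} _ (s≤s ()) }
        ; joins-y = λ { {zero} _ → j }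
        ; y∈ = λ _ → e∈
        ; off = λ { {suc _} _ _ → nZ } }

      -- Landing on the last vertex would be a loop, and on the one before it a repetition of the
      -- last edge.
      lands-early : ∀ {Z v} (W : Stuck Z v) → ∀ {i} → i ≤ suc (Stuck.l W) → Stuck.z W ≡ Stuck.q W i → i < Stuck.l W
      lands-early W {i} le eq with m≤n⇒m<n∨m≡n le
      ... | inj₂ refl = ⊥-elim (joins-≢ (Stuck.joins-g W) (sym eq))
      ... | inj₁ lt with m≤n⇒m<n∨m≡n (≤-pred lt)
      ... | inj₁ lt′ = lt′
      ... | inj₂ refl = ⊥-elim (Stuck.g≢ W (joins-unique (subst (Joins (Stuck.g W) _) eq (Stuck.joins-g W))
            (joins-sym (Path.joins-y (Stuck.path W) ≤-refl))))

      find-circuit : ∀ {e₀} → e₀ ∈ T → ∃ λ p → ∃ λ h → ∃ λ e → Circuit p h e × (∀ i → h i ∈ T)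
      find-circuit {e₀} e₀∈ = build (walk {λ _ → ⊥} (λ _ → no λ ()) n 0 _ _ refl (edge-path (λ _ → ⊥) e₀∈ (inj₁ (refl , refl)) λ ()))
        where
        build : ∀ {v} → Stuck (λ _ → ⊥) v → ∃ λ p → ∃ λ h → ∃ λ e → Circuit p h e × (∀ i → h i ∈ T)
        build W with Stuck.lands W
        ... | inj₂ (i , le , eq) = K.p , K.h , e , K.circuit , K.edge-∈ {_∈ T} y∈′ g∈
          where
          open Stuck W
          open Path path
          early : i < l
          early = lands-early W le eq
          e = suc l ∸ i
          whole : i + e ≡ suc l
          whole = m+[n∸m]≡n le
          y∈′ : ∀ {j} → j < e → y (i + j) ∈ T
          y∈′ {j} lt = y∈ (≤-pred (≤-trans (+-monoʳ-< i lt) (≤-reflexive whole)))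
          jn : ∀ {j} → j < e → Joins (y (i + j)) (q (i + j)) (q (i + suc j))
          jn {j} lt = subst (Joins (y (i + j)) (q (i + j))) (cong q (sym (+-suc i j))) (joins-y (≤-pred (≤-trans (+-monoʳ-< i lt) (≤-reflexive whole))))
          jg : Joins g (q (i + e)) (q (i + 0))
          jg = subst₂ (Joins g) (cong q (sym whole)) (trans eq (cong q (sym (+-identityʳ i)))) joins-g
          module K = Close e (λ j → q (i + j)) (λ j → y (i + j)) g (m+n≤o⇒m≤o∸n 2 (s≤s early))
            (λ lt le′ → distinct-q (+-monoʳ-< i lt) (≤-trans (+-monoʳ-≤ i le′) (≤-reflexive whole))) jn jg
            side (λ lt → crosses (T⊆S (y∈′ lt)) (jn lt)) (crosses (T⊆S g∈) jg)

      module FromCircuit {p : ℕ → Fin n} {h : ℕ → Fin m} {e : ℕ} (C : Circuit p h e) (h∈ : ∀ i → h i ∈ T) where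
        open Circuit C

        On : Fin n → Set
        On v = ∃ λ i → i ≤ e × v ≡ p i

        off-all : ∀ {v} → ¬ On v → ∀ j → v ≢ p j
        off-all nO j eq = let i , le , eq′ = reduce-p C j in nO (i , le , trans eq eq′)

        h∈S : ∀ i → h i ∈ S
        h∈S i = T⊆S (h∈ i)

        -- A 4-circuit with a two-edge ear between opposite vertices is K₂₃. A further edge of T at
        -- it gives a configuration; otherwise all of it is peeled, with equality in the ratio.
        four : e ≡ 3 → ∀ {x g z} → x ∈ T → g ∈ T → Joins x (p 0) z → Joins g z (p 2) → ¬ On z → Configuration k A ⊎ Peel T
        four refl {x} {g} {z} x∈ g∈ jx jg nO = decide (search∈ outside? T)
          where
          z≢ : ∀ j → z ≢ p j
          z≢ = off-all nO
          K : K₂₃ (p 0) (p 2) (p 1) (p 3) z (h 0) (h 1) (h 2) (h 3) x g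
          K = record
            { t≢r = apart 0 2 (s≤s z≤n) (s≤s (s≤s z≤n)) ; a≢b = apart 1 2 (s≤s z≤n) (s≤s (s≤s z≤n))
            ; a≢c = λ eq → z≢ 1 (sym eq) ; b≢c = λ eq → z≢ 3 (sym eq)
            ; jta = joins 0 ; jar = joins 1 ; jrb = joins 2 ; jbt = prev C 0 ; jtc = jx ; jcr = jg
            ; ta∈ = h∈S 0 ; ar∈ = h∈S 1 ; rb∈ = h∈S 2 ; bt∈ = h∈S 3 ; tc∈ = T⊆S x∈ ; cr∈ = T⊆S g∈ }
          open K₂₃ K
          Outside : Fin m → Set
          Outside f = f ∉ K-edges K × Any (Inc f) (K-vertices K)
          outside? : ∀ f → Dec (Outside f)
          outside? f = ¬? (f ∈ᵥ? K-edges K) ×-dec any? (inc? f) (K-vertices K)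
          find-inc : ∀ {f vs} → Any (Inc f) vs → ∃ λ v → v ∈ vs × Inc f v
          find-inc (here i) = _ , here refl , i
          find-inc (there q) = let v , v∈ , i = find-inc q in v , there v∈ , i
          inc-any : ∀ {f v vs} → v ∈ vs → Inc f v → Any (Inc f) vs
          inc-any (here refl) i = here i
          inc-any (there v∈) i = there (inc-any v∈ i)
          decide : (∃ λ f → f ∈ T × Outside f) ⊎ (∀ {f} → f ∈ T → ¬ Outside f) → Configuration k A ⊎ Peel T
          decide (inj₁ (f , f∈ , f∉ , i)) = let v , v∈ , iv = find-inc i in inj₁ (K-extra K (T⊆S f∈) f∉ v∈ iv)
          decide (inj₂ none) = inj₂ record
            { es = K-edges K ; vs = K-vertices K
            ; uvs = (t≢r ∷ t≢a ∷ t≢b ∷ t≢c ∷ []) ∷ (r≢a ∷ r≢b ∷ r≢c ∷ []) ∷ (a≢b ∷ a≢c ∷ []) ∷ (b≢c ∷ []) ∷ [] ∷ []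
            ; ratio = ≤-refl
            ; some = x , x∈ , there (there (there (there (here refl))))
            ; inside = λ { (here refl) → touched⁺ x∈ (joins-inc jx) ; (there (here refl)) → touched⁺ g∈ (joins-inc (joins-sym jg))
                         ; (there (there (here refl))) → touched⁺ (h∈ 1) (joins-inc (joins 1))
                         ; (there (there (there (here refl)))) → touched⁺ (h∈ 3) (joins-inc (joins 3))
                         ; (there (there (there (there (here refl))))) → touched⁺ g∈ (joins-inc jg) }
            ; sealed = sealed }
            where
            sealed : ∀ {v f} → v ∈ K-vertices K → f ∈ T → Inc f v → f ∈ K-edges K
            sealed {f = f} v∈ f∈ i with f ∈ᵥ? K-edges K
            ... | yes q = q
            ... | no q = ⊥-elim (none f∈ (q , inc-any v∈ i))

      four-or-more : ∀ b → b ≢ 0 → even? b ≡ true → b ≡ 2 ⊎ 4 ≤ b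
      four-or-more 0 n _ = ⊥-elim (n refl)
      four-or-more 1 _ ()
      four-or-more 2 _ _ = inj₁ refl
      four-or-more 3 _ ()
      four-or-more (suc (suc (suc (suc b)))) _ _ = inj₂ (s≤s (s≤s (s≤s (s≤s z≤n))))

      odd-three : ∀ e → 3 ≤ e → even? (suc e) ≡ true → e ≡ 3 ⊎ 5 ≤ e
      odd-three 3 _ _ = inj₁ refl
      odd-three 4 _ ()
      odd-three (suc (suc (suc (suc (suc e))))) _ _ = inj₂ (s≤s (s≤s (s≤s (s≤s (s≤s z≤n)))))
      odd-three 0 () _
      odd-three 1 (s≤s ()) _
      odd-three 2 (s≤s (s≤s ())) _

      -- The edge x is a chord, or it starts a walk off the circuit. If the walk lands right after
      -- x, x and the landing edge form an ear; any longer walk, landing on the circuit or on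
      -- itself, is a lollipop.
      leave : ∀ {p h e} (C : Circuit p h e) (h∈ : ∀ i → h i ∈ T) → ∀ {x z} → x ∈ T → (∀ i → x ≢ h i) → Joins x (p 0) z →
        Configuration k A ⊎ Peel T
      leave {p} {h} {e} C h∈ {x} {z} x∈ x∉ jx with on-circuit? C z
      ... | yes (b , b≤ , refl) = inj₁ (OnCircuit.chord-configuration C (FromCircuit.h∈S C h∈) (T⊆S x∈) b≤ jx x∉)
      ... | no nO = long (walk {On} (on-circuit? C) n 0 _ _ refl (edge-path On x∈ jx nO))
        where
        open FromCircuit C h∈
        open Circuit C
        -- The two arcs cut off by the ear have even lengths b and `suc e ∸ b`. One of length at
        -- least 4 serves as the tail, after a shift by 2 when b is 2; two arcs of length 2 give
        -- K₂₃.
        short : ∀ {x g z} → x ∈ T → g ∈ T → Joins x (p 0) z → ¬ On z → ∀ {b} → b ≤ e → Joins g z (p b) → g ≢ x → Configuration k A ⊎ Peel T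
        short {x} {g} {z} x∈ g∈ jx nO {b} b≤ jg g≢x with four-or-more b b≢0 (OnCircuit.even-index C h∈S {b} (same-side (T⊆S g∈) (T⊆S x∈) jg (joins-sym jx)))
          where
          b≢0 : b ≢ 0
          b≢0 refl = g≢x (joins-unique jg (joins-sym jx))
        ... | inj₂ b≥4 = inj₁ (OnCircuit.ear-configuration C h∈S (T⊆S x∈) (T⊆S g∈) b≥4 b≤ jx jg (off-all nO))
        ... | inj₁ refl with odd-three e e≥3 even
        ... | inj₁ e≡3 = four e≡3 x∈ g∈ jx jg nO
        ... | inj₂ e≥5 = inj₁ (OnCircuit.ear-configuration (shift-circuit C 2) (λ i → h∈S (2 + i)) {b = e ∸ 1} (T⊆S g∈) (T⊆S x∈)
              (m+n≤o⇒m≤o∸n 4 e≥5) (m∸n≤m e 1) (joins-sym jg) (joins-sym (subst (λ v → Joins x v z) (sym around) jx)) (λ i → off-all nO (2 + i)))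
              where
              around : p (2 + (e ∸ 1)) ≡ p 0
              around = trans (cong (λ i → p (suc i)) (m+[n∸m]≡n (≤-trans (s≤s z≤n) e≥5))) (per-p 0)
        long : (W : Stuck On (p 0)) → Configuration k A ⊎ Peel T
        long W with Stuck.l W in leq
        ... | zero with Stuck.lands W
        ... | inj₂ (i , le , eq) = ⊥-elim (n≮0 (subst (i <_) leq (lands-early W le eq)))
        ... | inj₁ (b , b≤ , eq) = short (y∈ z≤n) g∈ (subst (λ v → Joins (y 0) v (q 1)) start (joins-y z≤n)) (off ≤-refl (s≤s z≤n)) b≤
              (subst₂ (Joins g) (cong (λ i → q (suc i)) leq) eq joins-g) (λ eq′ → g≢ (trans eq′ (cong y (sym leq))))
          where
          open Stuck W
          open Path path
        long W | suc l′ = inj₁ (Lollipop.configuration C h∈S (Stuck.l W) (subst (1 ≤_) (sym leq) (s≤s z≤n)) q y start distinct-q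
              (λ a le → off-all (off a le)) joins-y (λ le → T⊆S (y∈ le)) (T⊆S g∈) joins-g (back lands))
          where
          open Stuck W
          open Path path
          back : (On (Stuck.z W) ⊎ (∃ λ i → i ≤ suc l × Stuck.z W ≡ q i)) → (∃ λ j → Stuck.z W ≡ p j) ⊎ (∃ λ i → suc i < l × Stuck.z W ≡ q (suc i))
          back (inj₁ (j , _ , eq)) = inj₁ (j , eq)
          back (inj₂ (zero , _ , eq)) = inj₁ (0 , trans eq start)
          back (inj₂ (suc i , le , eq)) = inj₂ (i , lands-early W le eq , eq)

      -- A circuit met by no further edge of T has as many vertices as edges, so it may be peeled.
      isolate : ∀ {p h e} (C : Circuit p h e) (h∈ : ∀ i → h i ∈ T) → Configuration k A ⊎ Peel T
      isolate {p} {h} {e} C h∈ with search∈ outside? T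
        where
        outside? : ∀ x → Dec (x ∉ edges C × (∃ λ i → i < suc e × Inc x (p i)))
        outside? x with x ∈ᵥ? edges C | search< (λ i → inc? x (p i)) (suc e)
        ... | yes q | _ = no λ (n , _) → n q
        ... | no n | inj₁ i = yes (n , i)
        ... | no _ | inj₂ none = no λ (_ , i , lt , ix) → none lt ix
      ... | inj₁ (x , x∈ , x∉ , i , _ , ix) = let z , jx = other-end ix in
            leave (shift-circuit C i) (λ j → h∈ (i + j)) x∈ (λ j eq → x∉ (subst (_∈ edges C) (sym eq) (Round.into (round C) (i + j))))
              (subst (λ j → Joins x (p j) z) (sym (+-identityʳ i)) jx)
      ... | inj₂ none = inj₂ record
            { es = edges C ; vs = applyUpTo p (suc e)
            ; uvs = Uniq.applyUpTo⁺₁ p (suc e) (λ {i} lt le → distinct C lt (≤-trans (≤-pred le) (m≤n+m e i)))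
            ; ratio = ≤-trans (≤-reflexive (cong (5 *_) (length-applyUpTo h (suc e))))
                (≤-trans (*-monoˡ-≤ (suc e) (n≤1+n 5)) (≤-reflexive (cong (6 *_) (sym (length-applyUpTo p (suc e))))))
            ; some = h 0 , h∈ 0 , here refl
            ; inside = λ v∈ → let i , _ , eq = ∈-applyUpTo⁻ p v∈ in subst (_∈ touched T) (sym eq) (touched⁺ (h∈ i) (joins-inc (Circuit.joins C i)))
            ; sealed = λ v∈ f∈ ix → let i , lt , eq = ∈-applyUpTo⁻ p v∈ in seal i lt f∈ (subst (Inc _) eq ix) }
        where
        seal : ∀ {f} i → i < suc e → f ∈ T → Inc f (p i) → f ∈ edges C
        seal {f} i lt f∈ ix with f ∈ᵥ? edges C
        ... | yes q = q
        ... | no q = ⊥-elim (none f∈ (q , i , lt , ix))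

    -- The ratio 6 : 5 is that of an isolated K₂₃, the densest component without a configuration.
    dense : ∀ fuel T → length T ≤ fuel → Unique T → (∀ {e} → e ∈ T → e ∈ S) →
      Configuration k A ⊎ 5 * length T ≤ 6 * length (touched T)
    dense fuel [] _ _ _ = inj₂ z≤n
    dense zero (_ ∷ _) () _ _
    dense (suc fuel) T@(e₀ ∷ _) le uT T⊆S = [ inj₁ , again ]′ (choose (search∈ lonely? T))
      where
      -- An edge with an end of degree 1 in T is peeled together with that end. Without such edges
      -- every walk can be continued.
      Lonely : Fin m → Set
      Lonely e = ∃ λ v → Inc e v × (∀ {e′} → e′ ∈ T → e′ ≢ e → ¬ Inc e′ v)
      lonely-at? : ∀ e v → Dec (∀ {e′} → e′ ∈ T → e′ ≢ e → ¬ Inc e′ v)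
      lonely-at? e v with search∈ (λ e′ → ¬? (e′ F.≟ e) ×-dec inc? e′ v) T
      ... | inj₁ (e′ , e′∈ , ne , i) = no λ f → f e′∈ ne i
      ... | inj₂ none = yes λ e′∈ ne i → none e′∈ (ne , i)
      lonely? : ∀ e → Dec (Lonely e)
      lonely? e with lonely-at? e (proj₁ (SimpleGraph.ends G e)) | lonely-at? e (proj₂ (SimpleGraph.ends G e))
      ... | yes f | _ = yes (_ , inj₁ refl , f)
      ... | no _ | yes f = yes (_ , inj₂ refl , f)
      ... | no n₁ | no n₂ = no λ { (_ , inj₁ refl , f) → n₁ f ; (_ , inj₂ refl , f) → n₂ f }
      choose : (∃ λ e → e ∈ T × Lonely e) ⊎ (∀ {e} → e ∈ T → ¬ Lonely e) → Configuration k A ⊎ Peel T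
      choose (inj₁ (e , e∈ , v , i , only)) = inj₂ record
        { es = e ∷ [] ; vs = v ∷ [] ; uvs = [] ∷ [] ; ratio = n≤1+n 5 ; some = e , e∈ , here refl
        ; inside = λ { (here refl) → touched⁺ e∈ i }
        ; sealed = λ { {e = e′} (here refl) e′∈ i′ → case e′ F.≟ e of λ { (yes eq) → here eq ; (no ne) → ⊥-elim (only e′∈ ne i′) } } }
      choose (inj₂ none) = let p , h , e , C , h∈ = find-circuit (here refl) in isolate C h∈
        where
        continue : ∀ {e v} → e ∈ T → Inc e v → ∃ λ e′ → e′ ∈ T × e′ ≢ e × Inc e′ v
        continue {e} {v} e∈ i with search∈ (λ e′ → ¬? (e′ F.≟ e) ×-dec inc? e′ v) T
        ... | inj₁ p = p
        ... | inj₂ no-other = ⊥-elim (none e∈ (v , i , λ e′∈ ne i′ → no-other e′∈ (ne , i′)))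
        open Walk T T⊆S continue
      again : Peel T → Configuration k A ⊎ 5 * length T ≤ 6 * length (touched T)
      again P with dense fuel (peeled uT P) (≤-pred (≤-trans (peeled-shorter uT P) le)) (unique-without {Peel.es P} uT)
          (λ p → T⊆S (proj₁ (without⁻ {Peel.es P} {T} p)))
      ... | inj₁ c = inj₁ c
      ... | inj₂ b = inj₂ (peel-bound uT P b)

-- Assembly by induction on the edge set

≤-maximum : ∀ {x : ℕ} {xs} → x ∈ xs → x ≤ foldr _⊔_ 0 xs
≤-maximum {xs = y ∷ ys} (here refl) = m≤m⊔n y _
≤-maximum {xs = y ∷ ys} (there p) = ≤-trans (≤-maximum p) (m≤n⊔m y _)

module Main {n m : ℕ} (G : SimpleGraph n m) (P : PlaneEmbedding G) (L : Fin m → List ℕ)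
  (uL : ∀ e → Unique (L e)) (lenL : ∀ e → length (L e) ≡ 10 ⊔ suc (maxDegree G)) where
  open SimpleGraph G
  open LineGraph G
  open Coloring F._≟_ Adj adj? adj-sym irr
  open Reduction F._≟_ Adj adj? adj-sym irr L uL

  k : ℕ
  k = 10 ⊔ suc (maxDegree G)

  module Active (A : List (Fin m)) (uA : Unique A) where
    open Embedded G using (D; flip²; Rotation; module Whole)
    open Discharge G A uA
    open Fibres F._≟_ tl using (Σ-fibres; fibre; fibre⁺; fibre⁻)

    tl-edge : ∀ {d d′ : D} → proj₁ d ≡ proj₁ d′ → tl d ≡ tl d′ → d ≡ d′
    tl-edge {e , false} {e , false} refl _ = refl
    tl-edge {e , true} {e , true} refl _ = refl
    tl-edge {e , false} {e , true} refl eq = ⊥-elim (noLoop e eq)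
    tl-edge {e , true} {e , false} refl eq = ⊥-elim (noLoop e (sym eq))

    dart-inc : ∀ d → Inc (proj₁ d) (tl d)
    dart-inc (e , false) = inj₁ refl
    dart-inc (e , true) = inj₂ refl

    inc-dart : ∀ {e v} → Inc e v → ∃ λ d → proj₁ d ≡ e × tl d ≡ v
    inc-dart {e} (inj₁ x) = (e , false) , refl , x
    inc-dart {e} (inj₂ x) = (e , true) , refl , x

    dart-joins : ∀ d → Joins (proj₁ d) (tl d) (hd d)
    dart-joins (e , false) = inj₁ (refl , refl)
    dart-joins (e , true) = inj₂ (refl , refl)

    joins-dart : ∀ {e p q} → Joins e p q → ∃ λ d → proj₁ d ≡ e × tl d ≡ p × hd d ≡ q
    joins-dart {e} (inj₁ (x , y)) = (e , false) , refl , x , y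
    joins-dart {e} (inj₂ (x , y)) = (e , true) , refl , y , x

    dg≤ : ∀ v → dg v ≤ maxDegree G
    dg≤ v = ≤-trans (≤-trans (length-inject proj₁ {ys = select (λ e → incidentB G e v) (allFin m)} (unique-at v) inj into)
        (≤-reflexive (sym (tally-length (λ e → incidentB G e v) (allFin m)))))
      (≤-maximum (∈-map⁺ (degree G) (∈-allFin v)))
      where
      at⁻ : ∀ {d} → d ∈ at v → d ∈ act × tl d ≡ v
      at⁻ = fibre⁻ {v} {act}
      inj : ∀ {d d′} → d ∈ at v → d′ ∈ at v → proj₁ d ≡ proj₁ d′ → d ≡ d′
      inj p q eq = tl-edge eq (trans (proj₂ (at⁻ p)) (sym (proj₂ (at⁻ q))))
      into : ∀ {d} → d ∈ at v → proj₁ d ∈ select (λ e → incidentB G e v) (allFin m)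
      into {d} p = ∈-select⁺ (λ e → incidentB G e v) (∈-allFin (proj₁ d))
        (incident (subst (Inc (proj₁ d)) (proj₂ (at⁻ p)) (dart-inc d)))
        where
        incident : ∀ {e} → Inc e v → T (incidentB G e v)
        incident {e} (inj₁ x) = Equivalence.from (T-∨ {⌊ proj₁ (ends e) F.≟ v ⌋}) (inj₁ (fromWitness x))
        incident {e} (inj₂ x) = Equivalence.from (T-∨ {⌊ proj₁ (ends e) F.≟ v ⌋}) (inj₂ (fromWitness x))

    dg<k : ∀ v → suc (dg v) ≤ k
    dg<k v = ≤-trans (s≤s (dg≤ v)) (m≤n⊔m 10 (suc (maxDegree G)))

    nbrs-degree : ∀ {d} → d ∈ act → 2 + length (nbrs A (proj₁ d)) ≤ dg (tl d) + dg (hd d)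
    nbrs-degree {d} p with remove d (at (tl d)) (in-at p) | remove (flipD G d) (at (hd d)) (in-at {flipD G d} (flip-act p))
    ... | zs , lz , kz | ws , lw , kw = ≤-trans (s≤s (s≤s (≤-trans (length-⊆ (unique-nbrs uA) cover)
          (≤-reflexive (trans (length-++ (map proj₁ zs)) (cong₂ _+_ (length-map proj₁ zs) (length-map proj₁ ws)))))))
        (≤-reflexive (trans (cong suc (sym (+-suc (length zs) (length ws)))) (cong₂ _+_ (sym lz) (sym lw))))
      where
      cover : ∀ {f} → f ∈ nbrs A (proj₁ d) → f ∈ map proj₁ zs ++ map proj₁ ws
      cover {f} q with nbrs-∈ {A} q
      ... | f∈ , ne , x , fx , ex with inc-dart fx | inc-joins (dart-joins d) ex
      ... | d′ , refl , refl | inj₁ eq = ∈-++⁺ˡ (∈-map⁺ proj₁ (kz (fibre⁺ (act⁺ {d′} f∈) eq) (λ { refl → ne refl })))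
      ... | d′ , refl , refl | inj₂ eq = ∈-++⁺ʳ (map proj₁ zs) (∈-map⁺ proj₁ (kw (fibre⁺ (act⁺ {d′} f∈) eq) (λ { refl → ne refl })))

    module Crowded (crowd : ∀ {e} → e ∈ A → k ≤ length (nbrs A e)) where

      weight : ∀ {d} → d ∈ act → 2 + k ≤ dg (tl d) + dg (hd d)
      weight p = ≤-trans (+-monoʳ-≤ 2 (crowd (act⁻ p))) (nbrs-degree p)

      heavy : ∀ {d} → d ∈ act → 12 ≤ dg (tl d) + dg (hd d)
      heavy p = ≤-trans (+-monoʳ-≤ 2 (m≤m⊔n 10 (suc (maxDegree G)))) (weight p)

      -- The other end has degree at most k - 1, and the two degrees sum to at least k + 2.
      deg≥3 : ∀ {d} → d ∈ act → 3 ≤ dg (tl d)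
      deg≥3 {d} p = +-cancelʳ-≤ k 3 (dg (tl d)) (≤-trans (s≤s (weight p))
        (≤-trans (≤-reflexive (sym (+-suc (dg (tl d)) (dg (hd d))))) (+-monoʳ-≤ (dg (tl d)) (dg<k (hd d)))))

      cubic? : ∀ v → Dec (dg v ≡ 3)
      cubic? v = dg v ℕ.≟ 3

      side : Fin n → Bool
      side v = ⌊ cubic? v ⌋

      S : List (Fin m)
      S = filter (λ e → cubic? (proj₁ (ends e)) ⊎-dec cubic? (proj₂ (ends e))) A

      S⁻ : ∀ {e} → e ∈ S → e ∈ A × (dg (proj₁ (ends e)) ≡ 3 ⊎ dg (proj₂ (ends e)) ≡ 3)
      S⁻ = ∈-filter⁻ (λ e → cubic? (proj₁ (ends e)) ⊎-dec cubic? (proj₂ (ends e))) {xs = A}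

      S-dart : ∀ {d} → d ∈ act → dg (tl d) ≡ 3 → proj₁ d ∈ S
      S-dart {e , false} p eq = ∈-filter⁺ (λ e → cubic? (proj₁ (ends e)) ⊎-dec cubic? (proj₂ (ends e))) (act⁻ p) (inj₁ eq)
      S-dart {e , true} p eq = ∈-filter⁺ (λ e → cubic? (proj₁ (ends e)) ⊎-dec cubic? (proj₂ (ends e))) (act⁻ p) (inj₂ eq)

      S-three : ∀ {e} → e ∈ S → ∃ λ d → d ∈ act × proj₁ d ≡ e × dg (tl d) ≡ 3
      S-three {e} p with S⁻ p
      ... | e∈ , inj₁ x = (e , false) , act⁺ e∈ , refl , x
      ... | e∈ , inj₂ x = (e , true) , act⁺ e∈ , refl , x

      -- At most 3 + (k - 1) edge ends, less two for the edge itself: at most k neighbours.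
      degree-S : ∀ {e} → e ∈ S → length (nbrs A e) ≤ k
      degree-S p with S-three p
      ... | d , a , refl , x = +-cancelˡ-≤ 2 _ _ (≤-trans (nbrs-degree a)
            (≤-trans (≤-reflexive (cong (_+ dg (hd d)) x)) (s≤s (s≤s (dg<k (hd d))))))

      not-both : ∀ {d} → d ∈ act → dg (tl d) ≡ 3 → dg (hd d) ≡ 3 → ⊥
      not-both {d} p x y = <⇒≱ (s≤s (m≤m+n 6 5)) (subst₂ (λ a b → 12 ≤ a + b) x y (heavy p))

      crosses : ∀ {e p q} → e ∈ S → Joins e p q → side q ≡ not (side p)
      crosses {e} {p} {q} e∈ j with joins-dart j | S⁻ e∈
      ... | d , refl , refl , refl | a , _ with cubic? (tl d) | cubic? (hd d) | S-three e∈
      ... | yes x | yes y | _ = ⊥-elim (not-both (act⁺ {d} a) x y)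
      ... | yes _ | no _ | _ = refl
      ... | no _ | yes _ | _ = refl
      ... | no x | no y | d′ , _ , eq , z with inc-joins (dart-joins d) (subst (λ f → Inc f (tl d′)) eq (dart-inc d′))
      ... | inj₁ w = ⊥-elim (x (trans (cong dg (sym w)) z))
      ... | inj₂ w = ⊥-elim (y (trans (cong dg (sym w)) z))

      open Extraction.Within G L uL k A S (λ p → proj₁ (S⁻ p)) degree-S side crosses

      -- U consists of the 3-vertices and W of their neighbours. No edge joins two 3-vertices, so S
      -- has at least 3|U| edges, on at most |U| + |W| vertices; the assumed bound then yields the
      -- pot condition of `discharge`.
      impossible : ∀ {e₀} → e₀ ∈ A → 5 * length S ≤ 6 * length (touched S) → ⊥
      impossible e₀∈ bound = discharge e₀∈ pot
        where
        gone-shape = Whole.delete P gone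
        open Count (proj₂ gone-shape)
        open Charges heavy deg≥3 using (discharge; degree-3; feeds?; Feeds)
        open ≤-Reasoning
        U W : List (Fin n)
        U = filter degree-3 vertices
        W = filter feeds? vertices
        ds : List D
        ds = filter (λ d → cubic? (tl d)) act
        ds⁻ : ∀ {d} → d ∈ ds → d ∈ act × dg (tl d) ≡ 3
        ds⁻ = ∈-filter⁻ (λ d → cubic? (tl d)) {xs = act}
        U⁻ : ∀ {v} → v ∈ U → dg v ≡ 3
        U⁻ p = proj₂ (∈-filter⁻ degree-3 {xs = vertices} p)
        many : 3 * length U ≤ length S
        many = begin
          3 * length U                               ≡⟨ sym (Σ-const U 3) ⟩
          Σ[ U ] (λ _ → 3)                           ≤⟨ Σ-mono U each ⟩
          Σ[ U ] (λ v → Σ[ fibre v ds ] (λ _ → 1))   ≡⟨ Σ-fibres (λ _ → 1) (Uniq.filter⁺ degree-3 unique-vertices) ds into ⟩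
          Σ[ ds ] (λ _ → 1)                          ≡⟨ trans (Σ-const ds 1) (*-identityˡ _) ⟩
          length ds                                  ≤⟨ length-inject proj₁ (Uniq.filter⁺ (λ d → cubic? (tl d)) unique-act) inj
                                                          (λ p → S-dart (proj₁ (ds⁻ p)) (proj₂ (ds⁻ p))) ⟩
          length S ∎
          where
          into : ∀ {d} → d ∈ ds → tl d ∈ U
          into {d} p = ∈-filter⁺ degree-3 (vertices⁺ {d} (proj₁ (ds⁻ p))) (proj₂ (ds⁻ p))
          each : ∀ {v} → v ∈ U → 3 ≤ Σ[ fibre v ds ] (λ _ → 1)
          each {v} v∈ = ≤-trans (≤-reflexive (sym (U⁻ v∈))) (≤-trans (length-⊆ (unique-at v) sub)
            (≤-reflexive (sym (trans (Σ-const (fibre v ds) 1) (*-identityˡ _)))))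
            where
            sub : ∀ {d} → d ∈ at v → d ∈ fibre v ds
            sub p = let a , t = fibre⁻ {v} {act} p in fibre⁺ (∈-filter⁺ (λ d → cubic? (tl d)) a (trans (cong dg t) (U⁻ v∈))) t
          inj : ∀ {d d′} → d ∈ ds → d′ ∈ ds → proj₁ d ≡ proj₁ d′ → d ≡ d′
          inj {e , b} {_ , b′} p q refl = go b b′ p q
            where
            go : ∀ b b′ → (e , b) ∈ ds → (e , b′) ∈ ds → (e , b) ≡ (e , b′)
            go false false _ _ = refl
            go true true _ _ = refl
            go false true p q = ⊥-elim (not-both (proj₁ (ds⁻ p)) (proj₂ (ds⁻ p)) (proj₂ (ds⁻ q)))
            go true false p q = ⊥-elim (not-both (proj₁ (ds⁻ p)) (proj₂ (ds⁻ p)) (proj₂ (ds⁻ q)))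
        few : length (touched S) ≤ length U + length W
        few = ≤-trans (length-⊆ (unique-touched S) cover) (≤-reflexive (length-++ U))
          where
          feed : ∀ {d xs} → d ∈ xs → dg (hd d) ≡ 3 → Any (Feeds (tl d)) xs
          feed (here refl) z = here (refl , z)
          feed (there p) z = there (feed p z)
          cover : ∀ {v} → v ∈ touched S → v ∈ U ++ W
          cover {v} p with touched⁻ {S} p
          ... | e , e∈ , i with S-three e∈
          ... | d , a , refl , z with inc-joins (dart-joins d) i
          ... | inj₁ refl = ∈-++⁺ˡ (∈-filter⁺ degree-3 (vertices⁺ {d} a) z)
          ... | inj₂ refl = ∈-++⁺ʳ U (∈-filter⁺ feeds? (vertices⁺ {flipD G d} (flip-act a))
                (feed {flipD G d} (flip-act a) (trans (cong (λ d → dg (tl d)) (flip² d)) z)))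
        pot : 6 * length U ≤ 4 * length W
        pot = *-cancelˡ-≤ 3 (+-cancelʳ-≤ (12 * length U) _ _ (begin
          3 * (6 * length U) + 12 * length U      ≡⟨ solve 1 (λ u → con 3 :* (con 6 :* u) :+ con 12 :* u := con 10 :* (con 3 :* u)) refl (length U) ⟩
          10 * (3 * length U)                     ≤⟨ *-monoʳ-≤ 10 many ⟩
          10 * length S                           ≡⟨ *-assoc 2 5 (length S) ⟩
          2 * (5 * length S)                      ≤⟨ *-monoʳ-≤ 2 (≤-trans bound (*-monoʳ-≤ 6 few)) ⟩
          2 * (6 * (length U + length W))         ≡⟨ solve 2 (λ u w → con 2 :* (con 6 :* (u :+ w)) := con 3 :* (con 4 :* w) :+ con 12 :* u) refl (length U) (length W) ⟩
          3 * (4 * length W) + 12 * length U ∎))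

      configured : ∀ {e₀} → e₀ ∈ A → Configuration k A
      configured e₀∈ with dense (length S) S ≤-refl (Uniq.filter⁺ (λ e → cubic? (proj₁ (ends e)) ⊎-dec cubic? (proj₂ (ends e))) uA) (λ p → p)
      ... | inj₁ c = c
      ... | inj₂ bound = ⊥-elim (impossible e₀∈ bound)

  -- The number k is that of the whole graph throughout, so the lists keep their full length while A
  -- shrinks.
  swappable : ∀ fuel A → length A ≤ fuel → Unique A → Swappable L A
  swappable fuel [] _ _ p _ = step-agree p (λ ()) ◅ ε
  swappable zero (_ ∷ _) () _
  swappable (suc fuel) A@(e₀ ∷ _) le uA with search∈ (λ e → length (nbrs A e) <? k) A
  ... | inj₁ (e , e∈ , light) = swappable-≈ to from (light-swappable e∉ few (swappable fuel B shorter (unique-without {e ∷ []} uA)))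
    where
    B : List (Fin m)
    B = without (e ∷ []) A
    e∉ : e ∉ B
    e∉ p = proj₂ (without⁻ {e ∷ []} {A} p) (here refl)
    B⊆ : ∀ {v} → v ∈ B → v ∈ A
    B⊆ p = proj₁ (without⁻ {e ∷ []} {A} p)
    few : length (nbrs B e) < length (L e)
    few = ≤-trans (s≤s (length-⊆ (unique-nbrs (unique-without {e ∷ []} uA)) (nbrs-mono {B} {A} B⊆))) (≤-trans light (≤-reflexive (sym (lenL e))))
    shorter : length B ≤ fuel
    shorter = ≤-pred (≤-trans (length-⊂ (unique-without {e ∷ []} uA) B⊆ e∈ e∉) le)
    to : ∀ {v} → v ∈ e ∷ B → v ∈ A
    to (here refl) = e∈
    to (there p) = B⊆ p
    from : ∀ {v} → v ∈ A → v ∈ e ∷ B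
    from {v} p with v F.≟ e
    ... | yes eq = here eq
    ... | no ne = there (without⁺ {e ∷ []} p λ { (here eq) → ne eq })
  ... | inj₂ none = configuration-swappable uA (λ e → ≤-reflexive (sym (lenL e))) C (swappable fuel (without H A) shorter (unique-without {H} uA))
    where
    C : Configuration k A
    C = Active.Crowded.configured A uA (λ e∈ → ≮⇒≥ (none e∈)) (here refl)
    open Configuration C using (H; ds⊆; H⊆)
    first : Configuration.h C 0 ∈ H
    first = Round.into (Configuration.round C) 0
    shorter : length (without H A) ≤ fuel
    shorter = ≤-pred (≤-trans (length-⊂ (unique-without {H} uA) (λ p → proj₁ (without⁻ {H} {A} p))
      (ds⊆ (H⊆ first)) (λ p → proj₂ (without⁻ {H} {A} p) first)) le)

theorem4 : (n m : ℕ) (G : SimpleGraph n m) → PlaneEmbedding G →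
    (L : ListAssignment (LineAdj G)) →
    IsKAssignment (LineAdj G) (10 ⊔ suc (maxDegree G)) L →
    LSwappable (LineAdj G) L
theorem4 n m G P L kL = Kempe.swappable→LSwappable (LineAdj G) adj? adj-sym irr L
  (Main.swappable G P L (λ e → proj₁ (kL e)) (λ e → proj₂ (kL e)) m (allFin m) (≤-reflexive (length-tabulate {n = m} id)) (Uniq.allFin⁺ m))
  where open LineGraph G using (adj?; adj-sym; irr)
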